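{- There exist the following approximation algorithms for Parallel Min-Sum Set Cover (PMSSC): (1) for identical machines (i.e. $c(S,j)=c(S)$ does not depend on $j$), an algorithm which, given an instance and $\epsilon>0$, runs in time polynomial in the size of the instance and $1/\epsilon$ and returns a feasible schedule of cost at most $\left(\frac{4e}{e-1}+\epsilon\right)$ times the minimum cost (in particular, for a suitably small $\epsilon$, the ratio is below $6.33$); (2) for unrelated machines (i.e. arbitrary $c$), an algorithm which, given an instance and $\epsilon>0$, runs in time polynomial in the size of the instance and $1/\epsilon$ and returns a feasible schedule of cost at most $\left(\frac{8e}{e-1}+\epsilon\right)$ times the minimum cost (in particular, for a suitably small $\epsilon$, the ratio is below $12.66$).
   Context: Notation: $\mathbb{N}=\{1,2,\dots\}$, $[m]=\{1,\dots,m\}$, and $e$ is the base of the natural logarithm. PMSSC instance: a finite universe $\mathcal{U}$ of $n$ elements, a collection $\mathcal{S}$ of $k$ subsets of $\mathcal{U}$ with $\bigcup_{S\in\mathcal{S}}S=\mathcal{U}$, a number $m\ge1$ of machines, a cost function $c:\mathcal{S}\times[m]\to\mathbb{N}$, and weights $w:\mathcal{U}\to\mathbb{N}$ (numbers encoded in binary). A schedule $\sigma=\{\sigma(j)\}_{j=1}^m$ consists of $m$ sequences of sets from $\mathcal{S}$, where each set is scheduled at most once overall. It is feasible if the sets occurring in it cover $\mathcal{U}$. If $S$ is scheduled on machine $j_S$, its finish time $\operatorname{ft}(S)$ is the sum of $c(S',j_S)$ over all sets $S'$ in the prefix of $\sigma(j_S)$ ending with (and including) $S$. The covering time of $u\in\mathcal{U}$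 is $\operatorname{ct}(u)=\min\{\operatorname{ft}(S): S\ni u,\ S\text{ scheduled in }\sigma\}$. The cost is $\operatorname{cost}(\sigma)=\sum_{u\in\mathcal{U}}w(u)\operatorname{ct}(u)$, to be minimized over feasible schedules. -}

module Defs where

open import Data.Bool using (Bool; true; false)
open import Data.Digit using (Bit; toDigits)
open import Data.Fin as Fin using (Fin; toℕ)
open import Data.Fin.Subset using (Subset; _∈_)
open import Data.Fin.Subset.Properties using (_∈?_)
open import Data.Integer as ℤ using (+_)
import Data.Integer.Properties as ℤ
open import Data.List as List using (List; []; _∷_; _++_; concatMap; allFin; filter; length)
open import Data.List.Extrema.Nat using (min)
open import Data.List.Relation.Unary.Unique.Propositional using (Unique)
open import Data.Maybe as Maybe using (Maybe; just; nothing)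
open import Data.Nat as ℕ using (ℕ; zero; suc; _!)
open import Data.Nat.ListAction using (sum)
import Data.Nat.Properties as ℕ
open import Data.Product using (Σ; ∃; ∃-syntax; _×_; _,_; proj₁; proj₂)
open import Data.Rational
import Data.Rational.Properties as ℚ
open import Algebra.Definitions.RawSemiring +-*-rawSemiring using (_^_)
import Data.Rational.Unnormalised as ℚᵘ
import Data.Rational.Unnormalised.Properties as ℚᵘ
open import Data.Rational.Solver using (module +-*-Solver)
open import Data.Sum using (inj₁; inj₂)
open import Data.Unit using (⊤)
open import Data.Vec as Vec using (Vec)
open import Function using (_∘_; _↔_)
open import Relation.Binary.PropositionalEquality
open import Relation.Nullary using (yes; no; contradiction)

fromℕ : ℕ → ℚ
fromℕ n = + n / 1

------------------------------------------------------------------------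
-- Real numbers, as Cauchy sequences of rationals

IsCauchy : (ℕ → ℚ) → Set
IsCauchy x = ∀ ε → 0ℚ < ε → ∃[ N ] ∀ m n → N ℕ.≤ m → N ℕ.≤ n → ∣ x m - x n ∣ ≤ ε

record ℝ : Set where
  constructor mkℝ
  field
    seq    : ℕ → ℚ
    cauchy : IsCauchy seq

open ℝ

infix 4 _≤ℝ_ _<ℝ_

_≤ℝ_ : ℝ → ℝ → Set
x ≤ℝ y = ∀ ε → 0ℚ < ε → ∃[ N ] ∀ n → N ℕ.≤ n → seq x n ≤ seq y n + ε

_<ℝ_ : ℝ → ℝ → Set
x <ℝ y = ∃[ δ ] 0ℚ < δ × ∃[ N ] ∀ n → N ℕ.≤ n → seq x n + δ ≤ seq y n

module CauchyLemmas where

  open +-*-Solver using (solve; con; _:=_; _:+_; _:-_; _:*_; :-_)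

  double : ∀ e → e + e ≡ (1ℚ + 1ℚ) * e
  double = solve 1 (λ e → e :+ e := (con 1ℚ :+ con 1ℚ) :* e) refl

  neg-sub : ∀ a b → - (a - b) ≡ b - a
  neg-sub = solve 2 (λ a b → :- (a :- b) := b :- a) refl

  sub-neg : ∀ a b → b - a ≡ - a - (- b)
  sub-neg = solve 2 (λ a b → b :- a := (:- a) :- (:- b)) refl

  sub-add : ∀ a b → a ≡ (a - b) + b
  sub-add = solve 2 (λ a b → a := (a :- b) :+ b) refl

  add-sub : ∀ a b → a + b - a ≡ b
  add-sub = solve 2 (λ a b → a :+ b :- a := b) refl

  sum-sub : ∀ a b c d → (a + b) - (c + d) ≡ (a - c) + (b - d)
  sum-sub = solve 4 (λ a b c d → (a :+ b) :- (c :+ d) := (a :- c) :+ (b :- d)) refl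

  product-sub : ∀ a b c d → a * b - c * d ≡ a * (b - d) + (a - c) * d
  product-sub = solve 4 (λ a b c d → a :* b :- c :* d := a :* (b :- d) :+ (a :- c) :* d) refl

  factor : ∀ b c e → b * e + e * c ≡ (b + c) * e
  factor = solve 3 (λ b c e → b :* e :+ e :* c := (b :+ c) :* e) refl

  rotate : ∀ a b c → a * b * c ≡ b * (a * c)
  rotate = solve 3 (λ a b c → a :* b :* c := b :* (a :* c)) refl

  recip-sub : ∀ p q p′ q′ → p′ * (q * q′) - (p * p′) * q′ ≡ (p′ * q′) * (q - p)
  recip-sub = solve 4 (λ p q p′ q′ → p′ :* (q :* q′) :- (p :* p′) :* q′ := (p′ :* q′) :* (q :- p)) refl

  *-mono : ∀ a b c d → 0ℚ ≤ a → 0ℚ ≤ d → a ≤ b → c ≤ d → a * c ≤ b * d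
  *-mono a b c d 0≤a 0≤d a≤b c≤d =
    ℚ.≤-trans {a * c} {a * d} {b * d}
              (ℚ.*-monoˡ-≤-nonNeg a {{nonNegative 0≤a}} c≤d)
              (ℚ.*-monoʳ-≤-nonNeg d {{nonNegative 0≤d}} a≤b)

  ∣-∣-sym : ∀ a b → ∣ a - b ∣ ≡ ∣ b - a ∣
  ∣-∣-sym a b = trans (sym (ℚ.∣-p∣≡∣p∣ (a - b)))
    (cong ∣_∣ (neg-sub a b))

  -- It suffices to bound |xₘ - xₙ| by a fixed multiple of ε.
  scale : ∀ K → 0ℚ < K → (x : ℕ → ℚ) →
          (∀ ε → 0ℚ < ε → ∃[ N ] ∀ m n → N ℕ.≤ m → N ℕ.≤ n → ∣ x m - x n ∣ ≤ K * ε) →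
          IsCauchy x
  scale K 0<K x h ε 0<ε = proj₁ r , λ m n N≤m N≤n →
      subst (∣ x m - x n ∣ ≤_) eq (proj₂ r m n N≤m N≤n)
    where
    instance _ = ℚ.pos⇒nonZero K {{positive 0<K}}
    δ = 1/ K * ε
    eq : K * δ ≡ ε
    eq = trans (sym (ℚ.*-assoc K (1/ K) ε))
           (trans (cong (_* ε) (ℚ.*-inverseʳ K)) (ℚ.*-identityˡ ε))
    0<δ : 0ℚ < δ
    0<δ = ℚ.positive⁻¹ δ {{ℚ.pos*pos⇒pos (1/ K) {{ℚ.1/pos⇒pos K {{positive 0<K}}}} ε {{positive 0<ε}}}}
    r = h δ 0<δ

  bounded : ∀ x → IsCauchy x → ∃[ B ] 0ℚ < B × ∃[ N ] ∀ n → N ℕ.≤ n → ∣ x n ∣ ≤ B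
  bounded x c with c 1ℚ (ℚ.positive⁻¹ 1ℚ)
  ... | N , h = 1ℚ + ∣ x N ∣
      , ℚ.positive⁻¹ _ {{ℚ.pos+nonNeg⇒pos 1ℚ ∣ x N ∣ {{ℚ.∣-∣-nonNeg (x N)}}}}
      , N , λ n N≤n → begin
        ∣ x n ∣                 ≡⟨ cong ∣_∣ (sub-add (x n) (x N)) ⟩
        ∣ (x n - x N) + x N ∣   ≤⟨ ℚ.∣p+q∣≤∣p∣+∣q∣ (x n - x N) (x N) ⟩
        ∣ x n - x N ∣ + ∣ x N ∣ ≤⟨ ℚ.+-monoˡ-≤ ∣ x N ∣ (h n N N≤n ℕ.≤-refl) ⟩
        1ℚ + ∣ x N ∣            ∎
    where open ℚ.≤-Reasoning

  const-cauchy : ∀ q → IsCauchy (λ _ → q)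
  const-cauchy q ε 0<ε = 0 , λ _ _ _ _ →
    subst (λ z → ∣ z ∣ ≤ ε) (sym (ℚ.+-inverseʳ q)) (ℚ.<⇒≤ 0<ε)

  +-cauchy : ∀ {x y} → IsCauchy x → IsCauchy y → IsCauchy (λ n → x n + y n)
  +-cauchy {x} {y} cx cy = scale (1ℚ + 1ℚ) (ℚ.positive⁻¹ (1ℚ + 1ℚ)) (λ n → x n + y n) λ ε 0<ε →
    let (N , f) = cx ε 0<ε ; (M , g) = cy ε 0<ε in
    N ℕ.⊔ M , λ m n a b → begin
      ∣ (x m + y m) - (x n + y n) ∣
        ≡⟨ cong ∣_∣ (sum-sub (x m) (y m) (x n) (y n)) ⟩
      ∣ (x m - x n) + (y m - y n) ∣
        ≤⟨ ℚ.∣p+q∣≤∣p∣+∣q∣ (x m - x n) (y m - y n) ⟩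
      ∣ x m - x n ∣ + ∣ y m - y n ∣
        ≤⟨ ℚ.+-mono-≤ (f m n (ℕ.m⊔n≤o⇒m≤o N M a) (ℕ.m⊔n≤o⇒m≤o N M b))
                      (g m n (ℕ.m⊔n≤o⇒n≤o N M a) (ℕ.m⊔n≤o⇒n≤o N M b)) ⟩
      ε + ε ≡⟨ double ε ⟩
      (1ℚ + 1ℚ) * ε ∎
    where open ℚ.≤-Reasoning

  neg-cauchy : ∀ {x} → IsCauchy x → IsCauchy (λ n → - x n)
  neg-cauchy {x} cx ε 0<ε = let (N , f) = cx ε 0<ε in N , λ m n a b →
    subst (_≤ ε) (trans (∣-∣-sym (x m) (x n))
      (cong ∣_∣ (sub-neg (x m) (x n)))) (f m n a b)

  product-bound : ∀ a b c d B C ε → 0ℚ ≤ C → 0ℚ ≤ ε → ∣ a ∣ ≤ B → ∣ d ∣ ≤ C →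
                  ∣ b - d ∣ ≤ ε → ∣ a - c ∣ ≤ ε → ∣ a * b - c * d ∣ ≤ (B + C) * ε
  product-bound a b c d B C ε 0≤C 0≤ε a≤B d≤C b-d≤ε a-c≤ε = begin
      ∣ a * b - c * d ∣                     ≡⟨ cong ∣_∣ (product-sub a b c d) ⟩
      ∣ a * (b - d) + (a - c) * d ∣         ≤⟨ ℚ.∣p+q∣≤∣p∣+∣q∣ (a * (b - d)) ((a - c) * d) ⟩
      ∣ a * (b - d) ∣ + ∣ (a - c) * d ∣     ≡⟨ cong₂ _+_ (ℚ.∣p*q∣≡∣p∣*∣q∣ a (b - d)) (ℚ.∣p*q∣≡∣p∣*∣q∣ (a - c) d) ⟩
      ∣ a ∣ * ∣ b - d ∣ + ∣ a - c ∣ * ∣ d ∣ ≤⟨ ℚ.+-mono-≤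
          (*-mono (∣ a ∣) B (∣ b - d ∣) ε (ℚ.0≤∣p∣ a) 0≤ε a≤B b-d≤ε)
          (*-mono (∣ a - c ∣) ε (∣ d ∣) C (ℚ.0≤∣p∣ (a - c)) 0≤C a-c≤ε d≤C) ⟩
      B * ε + ε * C                         ≡⟨ factor B C ε ⟩
      (B + C) * ε                           ∎
    where open ℚ.≤-Reasoning

  *-cauchy : ∀ {x y} → IsCauchy x → IsCauchy y → IsCauchy (λ n → x n * y n)
  *-cauchy {x} {y} cx cy = go (bounded x cx) (bounded y cy)
    where
    go : (∃[ B ] 0ℚ < B × ∃[ N ] ∀ n → N ℕ.≤ n → ∣ x n ∣ ≤ B) →
         (∃[ B ] 0ℚ < B × ∃[ N ] ∀ n → N ℕ.≤ n → ∣ y n ∣ ≤ B) →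
         IsCauchy (λ n → x n * y n)
    go (B , 0<B , P , hB) (C , 0<C , Q , hC) =
      scale (B + C) (ℚ.positive⁻¹ (B + C) {{ℚ.pos+pos⇒pos B {{positive 0<B}} C {{positive 0<C}}}})
        (λ n → x n * y n) λ ε 0<ε →
      let (N , f) = cx ε 0<ε
          (M , g) = cy ε 0<ε
          P≤ = ℕ.≤-trans (ℕ.m≤m⊔n P Q) (ℕ.m≤m⊔n (P ℕ.⊔ Q) (N ℕ.⊔ M))
          Q≤ = ℕ.≤-trans (ℕ.m≤n⊔m P Q) (ℕ.m≤m⊔n (P ℕ.⊔ Q) (N ℕ.⊔ M))
          N≤ = ℕ.≤-trans (ℕ.m≤m⊔n N M) (ℕ.m≤n⊔m (P ℕ.⊔ Q) (N ℕ.⊔ M))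
          M≤ = ℕ.≤-trans (ℕ.m≤n⊔m N M) (ℕ.m≤n⊔m (P ℕ.⊔ Q) (N ℕ.⊔ M))
      in (P ℕ.⊔ Q) ℕ.⊔ (N ℕ.⊔ M) , λ m n a b →
        product-bound (x m) (y m) (x n) (y n) B C ε (ℚ.<⇒≤ 0<C) (ℚ.<⇒≤ 0<ε)
          (hB m (ℕ.≤-trans P≤ a)) (hC n (ℕ.≤-trans Q≤ b))
          (g m n (ℕ.≤-trans M≤ a) (ℕ.≤-trans M≤ b))
          (f m n (ℕ.≤-trans N≤ a) (ℕ.≤-trans N≤ b))

open CauchyLemmas

fromℚ : ℚ → ℝ
fromℚ q = mkℝ (λ _ → q) (const-cauchy q)

infixl 6 _+ℝ_ _-ℝ_
infixl 7 _*ℝ_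

_+ℝ_ : ℝ → ℝ → ℝ
x +ℝ y = mkℝ (λ n → seq x n + seq y n) (+-cauchy {seq x} {seq y} (cauchy x) (cauchy y))

_-ℝ_ : ℝ → ℝ → ℝ
x -ℝ y = mkℝ (λ n → seq x n - seq y n) (+-cauchy {seq x} (cauchy x) (neg-cauchy {seq y} (cauchy y)))

_*ℝ_ : ℝ → ℝ → ℝ
x *ℝ y = mkℝ (λ n → seq x n * seq y n) (*-cauchy {seq x} {seq y} (cauchy x) (cauchy y))

-- Finitely many terms of a sequence with positive limit may vanish; the junk
-- value at 0 only affects those.
recip : ℚ → ℚ
recip q with q ℚ.≟ 0ℚ
... | yes _  = 0ℚ
... | no q≢0 = (1/ q) {{≢-nonZero q≢0}}

module RecipLemmas where

  recip-inverse : ∀ q → 0ℚ < q → q * recip q ≡ 1ℚ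
  recip-inverse q 0<q with q ℚ.≟ 0ℚ
  ... | yes q≡0 = contradiction (sym q≡0) (ℚ.<⇒≢ 0<q)
  ... | no q≢0  = ℚ.*-inverseʳ q {{≢-nonZero q≢0}}

  recip-nonNeg : ∀ q → 0ℚ < q → 0ℚ ≤ recip q
  recip-nonNeg q 0<q = ℚ.*-cancelˡ-≤-pos q {{positive 0<q}}
    (subst₂ _≤_ (sym (ℚ.*-zeroʳ q)) (sym (recip-inverse q 0<q)) (ℚ.nonNegative⁻¹ 1ℚ))

  recip-anti : ∀ p q → 0ℚ < p → p ≤ q → recip q ≤ recip p
  recip-anti p q 0<p p≤q = begin
      recip q                 ≡⟨ sym (ℚ.*-identityˡ (recip q)) ⟩
      1ℚ * recip q            ≡⟨ cong (_* recip q) (sym (recip-inverse p 0<p)) ⟩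
      p * recip p * recip q   ≤⟨ ℚ.*-monoʳ-≤-nonNeg (recip q) {{nonNegative (recip-nonNeg q 0<q)}}
                                   (ℚ.*-monoʳ-≤-nonNeg (recip p) {{nonNegative (recip-nonNeg p 0<p)}} p≤q) ⟩
      q * recip p * recip q   ≡⟨ rotate q (recip p) (recip q) ⟩
      recip p * (q * recip q) ≡⟨ cong (recip p *_) (recip-inverse q 0<q) ⟩
      recip p * 1ℚ            ≡⟨ ℚ.*-identityʳ (recip p) ⟩
      recip p                 ∎
    where open ℚ.≤-Reasoning
          0<q = ℚ.<-≤-trans 0<p p≤q

  recip-cauchy : ∀ {x} → IsCauchy x → (δ : ℚ) → 0ℚ < δ →
                 ∃[ N ] (∀ n → N ℕ.≤ n → δ ≤ x n) → IsCauchy (recip ∘ x)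
  recip-cauchy {x} cx δ 0<δ (P , δ≤) =
    scale (K * K) 0<KK (recip ∘ x) λ ε 0<ε → let (N , f) = cx ε 0<ε in
    P ℕ.⊔ N , λ m n a b →
      let p  = x m ; q = x n
          p′ = recip p ; q′ = recip q
          δ≤p = δ≤ m (ℕ.m⊔n≤o⇒m≤o P N a)
          δ≤q = δ≤ n (ℕ.m⊔n≤o⇒m≤o P N b)
          0<p = ℚ.<-≤-trans 0<δ δ≤p
          0<q = ℚ.<-≤-trans 0<δ δ≤q
          0≤p′ = recip-nonNeg p 0<p
          0≤q′ = recip-nonNeg q 0<q
          0≤p′q′ = ℚ.nonNegative⁻¹ _ {{ℚ.nonNeg*nonNeg⇒nonNeg p′ {{nonNegative 0≤p′}} q′ {{nonNegative 0≤q′}}}}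
      in begin
        ∣ p′ - q′ ∣
          ≡⟨ cong ∣_∣ (trans
               (trans (cong₂ _-_ (sym (ℚ.*-identityʳ p′)) (sym (ℚ.*-identityˡ q′)))
                 (cong₂ (λ s t → p′ * s - t * q′) (sym (recip-inverse q 0<q)) (sym (recip-inverse p 0<p))))
               (recip-sub p q p′ q′)) ⟩
        ∣ (p′ * q′) * (q - p) ∣
          ≡⟨ ℚ.∣p*q∣≡∣p∣*∣q∣ (p′ * q′) (q - p) ⟩
        ∣ p′ * q′ ∣ * ∣ q - p ∣
          ≡⟨ cong (_* ∣ q - p ∣) (ℚ.0≤p⇒∣p∣≡p 0≤p′q′) ⟩
        (p′ * q′) * ∣ q - p ∣
          ≤⟨ *-mono (p′ * q′) (K * K) (∣ q - p ∣) ε 0≤p′q′ (ℚ.<⇒≤ 0<ε)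
               (*-mono p′ K q′ K 0≤p′ 0≤K (recip-anti δ p 0<δ δ≤p) (recip-anti δ q 0<δ δ≤q))
               (f n m (ℕ.m⊔n≤o⇒n≤o P N b) (ℕ.m⊔n≤o⇒n≤o P N a)) ⟩
        (K * K) * ε ∎
    where
    open ℚ.≤-Reasoning
    K = recip δ
    0≤K = recip-nonNeg δ 0<δ
    0<K : 0ℚ < K
    0<K = ℚ.*-cancelˡ-<-nonNeg δ {{nonNegative (ℚ.<⇒≤ 0<δ)}}
      (subst₂ _<_ (sym (ℚ.*-zeroʳ δ)) (sym (recip-inverse δ 0<δ)) (ℚ.positive⁻¹ 1ℚ))
    0<KK : 0ℚ < K * K
    0<KK = ℚ.positive⁻¹ _ {{ℚ.pos*pos⇒pos K {{positive 0<K}} K {{positive 0<K}}}}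

open RecipLemmas

infix 8 _⁻¹⟨_⟩

_⁻¹⟨_⟩ : (x : ℝ) → fromℚ 0ℚ <ℝ x → ℝ
x ⁻¹⟨ δ , 0<δ , N , h ⟩ = mkℝ (recip ∘ seq x)
  (recip-cauchy {seq x} (cauchy x) δ 0<δ
    (N , λ n N≤n → subst (_≤ seq x n) (ℚ.+-identityˡ δ) (h n N≤n)))

------------------------------------------------------------------------
-- e = Σ 1/n!

invFact : ℕ → ℚ
invFact n = (+ 1 / n !) {{n ℕ.!≢0}}

eSeq : ℕ → ℚ
eSeq zero    = invFact 0
eSeq (suc n) = eSeq n + invFact (suc n)

module SeriesLemmas where

  unit : ∀ a → .{{_ : ℕ.NonZero a}} → ℚ
  unit a = + 1 / a

  unitᵘ : ∀ a → toℚᵘ (unit (suc a)) ℚᵘ.≃ ℚᵘ.mkℚᵘ (+ 1) a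
  unitᵘ a = ℚ.toℚᵘ-fromℚᵘ (ℚᵘ.mkℚᵘ (+ 1) a)

  double-unit : ∀ a b → .{{_ : ℕ.NonZero a}} → .{{_ : ℕ.NonZero b}} →
                2 ℕ.* b ℕ.≤ a → unit a + unit a ≤ unit b
  double-unit (suc a) (suc b) 2b≤a = ℚ.toℚᵘ-cancel-≤ (begin
      toℚᵘ (unit (suc a) + unit (suc a))         ≃⟨ ℚ.toℚᵘ-homo-+ (unit (suc a)) (unit (suc a)) ⟩
      toℚᵘ (unit (suc a)) ℚᵘ.+ toℚᵘ (unit (suc a)) ≃⟨ ℚᵘ.+-cong (unitᵘ a) (unitᵘ a) ⟩
      ℚᵘ.mkℚᵘ (+ 1) a ℚᵘ.+ ℚᵘ.mkℚᵘ (+ 1) a       ≤⟨ ℚᵘ.*≤* (subst₂ ℤ._≤_ (sym lhs) (sym rhs) (ℤ.+≤+ goal)) ⟩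
      ℚᵘ.mkℚᵘ (+ 1) b                            ≃⟨ ℚᵘ.≃-sym (unitᵘ b) ⟩
      toℚᵘ (unit (suc b))                        ∎)
    where
    open ℚᵘ.≤-Reasoning
    A = suc a
    B = suc b
    lhs : (+ 1 ℤ.* + A ℤ.+ + 1 ℤ.* + A) ℤ.* + B ≡ + ((A ℕ.+ A) ℕ.* B)
    lhs = trans (cong (λ z → (z ℤ.+ z) ℤ.* + B) (ℤ.*-identityˡ (+ A))) (sym (ℤ.pos-* (A ℕ.+ A) B))
    rhs : + 1 ℤ.* + (A ℕ.* A) ≡ + (A ℕ.* A)
    rhs = ℤ.*-identityˡ (+ (A ℕ.* A))
    goal : (A ℕ.+ A) ℕ.* B ℕ.≤ A ℕ.* A
    goal = ℕ.≤-trans (ℕ.≤-reflexive eq) (ℕ.*-monoʳ-≤ A 2b≤a)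
      where
      eq : (A ℕ.+ A) ℕ.* B ≡ A ℕ.* (2 ℕ.* B)
      eq = trans (cong (ℕ._* B) (trans (cong (A ℕ.+_) (sym (ℕ.+-identityʳ A))) (ℕ.*-comm 2 A)))
                 (ℕ.*-assoc A 2 B)

  unit-small : ∀ a ε → .{{_ : ℕ.NonZero a}} → 0ℚ < ε → ↧ₙ ε ℕ.≤ a → unit a ≤ ε
  unit-small (suc a) ε@(mkℚ (+ suc p) d _) 0<ε d≤a = ℚ.toℚᵘ-cancel-≤ (begin
      toℚᵘ (unit (suc a))      ≃⟨ unitᵘ a ⟩
      ℚᵘ.mkℚᵘ (+ 1) a          ≤⟨ ℚᵘ.*≤* (subst₂ ℤ._≤_ (ℤ.pos-* 1 (suc d)) (ℤ.pos-* (suc p) (suc a))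
                                    (ℤ.+≤+ (ℕ.*-mono-≤ (ℕ.s≤s (ℕ.z≤n {p})) d≤a))) ⟩
      toℚᵘ ε                   ∎)
    where open ℚᵘ.≤-Reasoning
  unit-small a (mkℚ (+ zero) d _) (*<* (ℤ.+<+ ())) _
  unit-small a (mkℚ (ℤ.-[1+ n ]) d _) (*<* ()) _

  0≤invFact : ∀ n → 0ℚ ≤ invFact n
  0≤invFact n = ℚ.nonNegative⁻¹ _ {{ℚ.normalize-nonNeg 1 (n !) {{n ℕ.!≢0}}}}

  eSeq-step : ∀ n → eSeq n ≤ eSeq (suc n)
  eSeq-step n = subst (_≤ eSeq (suc n)) (ℚ.+-identityʳ (eSeq n)) (ℚ.+-monoʳ-≤ (eSeq n) (0≤invFact (suc n)))

  eSeq-mono : ∀ {m n} → m ℕ.≤′ n → eSeq m ≤ eSeq n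
  eSeq-mono ℕ.≤′-refl     = ℚ.≤-refl
  eSeq-mono {n = suc n} (ℕ.≤′-step p) = ℚ.≤-trans (eSeq-mono p) (eSeq-step n)

  -- eSeq n + 1/n! decreases for n ≥ 1.
  upper-step : ∀ n → eSeq (2 ℕ.+ n) + invFact (2 ℕ.+ n) ≤ eSeq (1 ℕ.+ n) + invFact (1 ℕ.+ n)
  upper-step n = subst (_≤ eSeq (1 ℕ.+ n) + invFact (1 ℕ.+ n))
      (sym (ℚ.+-assoc (eSeq (1 ℕ.+ n)) (invFact (2 ℕ.+ n)) (invFact (2 ℕ.+ n))))
      (ℚ.+-monoʳ-≤ (eSeq (1 ℕ.+ n))
        (double-unit ((2 ℕ.+ n) !) ((1 ℕ.+ n) !) {{(2 ℕ.+ n) ℕ.!≢0}} {{(1 ℕ.+ n) ℕ.!≢0}}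
          (ℕ.*-monoˡ-≤ ((1 ℕ.+ n) !) (ℕ.s≤s (ℕ.s≤s (ℕ.z≤n {n}))))))

  upper-mono : ∀ {m n} → 1 ℕ.≤ m → m ℕ.≤′ n → eSeq n + invFact n ≤ eSeq m + invFact m
  upper-mono 1≤m ℕ.≤′-refl = ℚ.≤-refl
  upper-mono {m} {suc zero} 1≤m (ℕ.≤′-step p) =
    contradiction (ℕ.≤-trans 1≤m (ℕ.≤′⇒≤ p)) λ ()
  upper-mono {m} {suc (suc n)} 1≤m (ℕ.≤′-step p) = ℚ.≤-trans (upper-step n) (upper-mono 1≤m p)

  n≤n! : ∀ n → n ℕ.≤ n !
  n≤n! zero    = ℕ.z≤n
  n≤n! (suc n) = ℕ.m≤m*n (suc n) (n !) {{n ℕ.!≢0}}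

  e-gap : ∀ ε → 0ℚ < ε → ∀ {m n} → ↧ₙ ε ℕ.≤ m → m ℕ.≤ n → ∣ eSeq n - eSeq m ∣ ≤ ε
  e-gap ε 0<ε {m} {n} d≤m m≤n = begin
      ∣ eSeq n - eSeq m ∣          ≡⟨ ℚ.0≤p⇒∣p∣≡p (subst (_≤ eSeq n - eSeq m) (ℚ.+-inverseʳ (eSeq m))
                                        (ℚ.+-monoˡ-≤ (- eSeq m) (eSeq-mono (ℕ.≤⇒≤′ m≤n)))) ⟩
      eSeq n - eSeq m              ≡⟨ cong (_- eSeq m) (sym (ℚ.+-identityʳ (eSeq n))) ⟩
      eSeq n + 0ℚ - eSeq m         ≤⟨ ℚ.+-monoˡ-≤ (- eSeq m) (ℚ.+-monoʳ-≤ (eSeq n) (0≤invFact n)) ⟩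
      eSeq n + invFact n - eSeq m     ≤⟨ ℚ.+-monoˡ-≤ (- eSeq m)
                                        (upper-mono (ℕ.≤-trans (ℕ.s≤s ℕ.z≤n) d≤m) (ℕ.≤⇒≤′ m≤n)) ⟩
      eSeq m + invFact m - eSeq m     ≡⟨ add-sub (eSeq m) (invFact m) ⟩
      invFact m                       ≤⟨ unit-small (m !) ε {{m ℕ.!≢0}} 0<ε (ℕ.≤-trans d≤m (n≤n! m)) ⟩
      ε                            ∎
    where open ℚ.≤-Reasoning

  eSeq-cauchy : IsCauchy eSeq
  eSeq-cauchy ε 0<ε = ↧ₙ ε , λ m n d≤m d≤n → go m n d≤m d≤n
    where
    go : ∀ m n → ↧ₙ ε ℕ.≤ m → ↧ₙ ε ℕ.≤ n → ∣ eSeq m - eSeq n ∣ ≤ ε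
    go m n d≤m d≤n with ℕ.≤-total n m
    ... | inj₁ n≤m = e-gap ε 0<ε d≤n n≤m
    ... | inj₂ m≤n = subst (_≤ ε) (∣-∣-sym (eSeq n) (eSeq m)) (e-gap ε 0<ε d≤m m≤n)

open SeriesLemmas

e : ℝ
e = mkℝ eSeq eSeq-cauchy

0<e-1 : fromℚ 0ℚ <ℝ e -ℝ fromℚ 1ℚ
0<e-1 = 1ℚ , ℚ.positive⁻¹ 1ℚ , 1 , λ n 1≤n → ℚ.+-monoˡ-≤ (- 1ℚ) (eSeq-mono (ℕ.≤⇒≤′ 1≤n))

e/[e-1] : ℝ
e/[e-1] = e *ℝ (e -ℝ fromℚ 1ℚ) ⁻¹⟨ 0<e-1 ⟩

------------------------------------------------------------------------
-- Parallel Min-Sum Set Cover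

-- The collection of sets is an indexed family, so repeated sets are allowed.
record Instance : Set where
  field
    n k m   : ℕ
    m≥1     : 1 ℕ.≤ m
    sets    : Fin k → Subset n
    covered : ∀ u → ∃[ S ] u ∈ sets S
    c       : Fin k → Fin m → ℕ
    c≥1     : ∀ S j → 1 ℕ.≤ c S j
    w       : Fin n → ℕ
    w≥1     : ∀ u → 1 ℕ.≤ w u

Identical : Instance → Set
Identical I = ∀ S j j′ → c S j ≡ c S j′
  where open Instance I

Unrelated : Instance → Set
Unrelated _ = ⊤

module _ (I : Instance) where
  open Instance I

  record Schedule : Set where
    field
      on   : Fin m → List (Fin k)
      once : Unique (concatMap on (allFin m))

  module _ (σ : Schedule) where
    open Schedule σ

    -- A scheduled set, given by its machine and its position on that machine.
    Slot : Set
    Slot = Σ (Fin m) λ j → Fin (length (on j))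

    slots : List Slot
    slots = concatMap (λ j → List.map (j ,_) (allFin (length (on j)))) (allFin m)

    setAt : Slot → Fin k
    setAt (j , i) = List.lookup (on j) i

    Feasible : Set
    Feasible = ∀ u → ∃[ s ] u ∈ sets (setAt s)

    ft : Slot → ℕ
    ft (j , i) = sum (List.map (λ S → c S j) (List.take (suc (toℕ i)) (on j)))

    -- The slot supplied by feasibility only makes the minimum one over a
    -- visibly nonempty list; it is itself among the slots minimised over.
    ct : Feasible → Fin n → ℕ
    ct feasible u =
      min (ft (proj₁ (feasible u)))
          (List.map ft (filter (λ s → u ∈? sets (setAt s)) slots))

    cost : Feasible → ℕ
    cost feasible = sum (List.map (λ u → w u ℕ.* ct feasible u) (allFin n))

  IsMinCost : ℕ → Set
  IsMinCost v =
    (∃[ σ ] Σ (Feasible σ) λ feasible → cost σ feasible ≡ v) ×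
    (∀ σ (feasible : Feasible σ) → v ℕ.≤ cost σ feasible)

------------------------------------------------------------------------
-- Encodings as strings over a fixed finite alphabet

data Token : Set where
  bit : Bit → Token
  end : Token           -- ends a number
  [[ ]] : Token         -- delimit a list

-- Binary, least significant bit first.
encodeℕ : ℕ → List Token
encodeℕ x = List.map bit (proj₁ (toDigits 2 x)) ++ end ∷ []

encodeList : {A : Set} → (A → List Token) → List A → List Token
encodeList enc xs = [[ ∷ concatMap enc xs ++ ]] ∷ []

encodeBool : Bool → List Token
encodeBool false = bit Fin.zero ∷ []
encodeBool true  = bit (Fin.suc Fin.zero) ∷ []

encodeInstance : Instance → List Token
encodeInstance I =
     encodeList (λ u → encodeℕ (w u)) (allFin n)
  ++ encodeList (λ S → encodeList encodeBool (Vec.toList (sets S))) (allFin k)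
  ++ encodeList (λ j → encodeList (λ S → encodeℕ (c S j)) (allFin k)) (allFin m)
  where open Instance I

-- Used for positive rationals only, so the sign is dropped.
encodeℚ : ℚ → List Token
encodeℚ q = encodeℕ ℤ.∣ ↥ q ∣ ++ encodeℕ (↧ₙ q)

encodeSchedule : ∀ {I} → Schedule I → List Token
encodeSchedule {I} σ = encodeList (λ j → encodeList (encodeℕ ∘ toℕ) (on j)) (allFin m)
  where
  open Instance I
  open Schedule σ

------------------------------------------------------------------------
-- Deterministic multi-tape Turing machines

Finite : Set → Set
Finite A = ∃[ n ] (A ↔ Fin n)

data Symbol (Aux : Set) : Set where
  blank : Symbol Aux
  tok   : Token → Symbol Aux
  aux   : Aux → Symbol Aux

data Move : Set where
  left stay right : Move

record TM : Set₁ where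
  field
    State        : Set
    finiteState  : Finite State
    start        : State
    Aux          : Set
    finiteAux    : Finite Aux
    workTapes    : ℕ
    -- nothing means that the machine halts
    δ            : State → Vec (Symbol Aux) (suc workTapes) →
                   Maybe (State × Vec (Symbol Aux × Move) (suc workTapes))

-- A tape is infinite in both directions: all cells beyond the two lists are
-- blank. The list to the left of the head starts with the nearest cell.
record Tape (A : Set) : Set where
  constructor tape
  field
    before : List (Symbol A)
    head   : Symbol A
    after  : List (Symbol A)

module _ {A : Set} where

  fromList : List (Symbol A) → Tape A
  fromList []       = tape [] blank []
  fromList (x ∷ xs) = tape [] x xs

  move : Move → Tape A → Tape A
  move stay  t                    = t
  move left  (tape []       x rs) = tape [] blank (x ∷ rs)
  move left  (tape (l ∷ ls) x rs) = tape ls l (x ∷ rs)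
  move right (tape ls x [])       = tape (x ∷ ls) blank []
  move right (tape ls x (r ∷ rs)) = tape (x ∷ ls) r rs

  act : Symbol A × Move → Tape A → Tape A
  act (y , d) (tape ls _ rs) = move d (tape ls y rs)

  leadingTokens : List (Symbol A) → List Token
  leadingTokens (tok a ∷ xs) = a ∷ leadingTokens xs
  leadingTokens _            = []

module _ (M : TM) where
  open TM M

  record Config : Set where
    constructor config
    field
      state : State
      tapes : Vec (Tape Aux) (suc workTapes)

  initial : List Token → Config
  initial x = config start
    (fromList (List.map tok x) Vec.∷ Vec.replicate workTapes (fromList []))

  step : Config → Maybe Config
  step (config q ts) =
    Maybe.map (λ (q′ , as) → config q′ (Vec.zipWith act as ts))
              (δ q (Vec.map Tape.head ts))

  -- The output is read from the first tape, starting at the head.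
  output : Config → List Token
  output (config _ (tape _ x rs Vec.∷ _)) = leadingTokens (x ∷ rs)

  data _⇓[_]_ : Config → ℕ → Config → Set where
    halt : ∀ {a} → step a ≡ nothing → a ⇓[ 0 ] a
    next : ∀ {a b z t} → step a ≡ just b → b ⇓[ t ] z → a ⇓[ suc t ] z

  Computes_↦_In_Steps : List Token → List Token → ℕ → Set
  Computes x ↦ y In t Steps = ∃[ z ] initial x ⇓[ t ] z × output z ≡ y

------------------------------------------------------------------------
-- Approximation algorithms

-- A polynomial in two variables, as a list of monomials (a , i , j)
-- standing for a · Xⁱ · Yʲ.
Polynomial : Set
Polynomial = List (ℕ × ℕ × ℕ)

eval : Polynomial → ℚ → ℚ → ℚ
eval p x y = List.foldr (λ (a , i , j) r → fromℕ a * x ^ i * y ^ j + r) 0ℚ p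

-- A (ρ + ε)-approximation for the instances satisfying P, with ε part of the
-- input, in time polynomial in the length of the input and 1/ε.
HasApproximation : (P : Instance → Set) (ρ : ℝ) → Set₁
HasApproximation P ρ =
  Σ TM λ M → ∃[ p ] ∀ I → P I → ∀ ε → .{{_ : Positive ε}} →
  let input = encodeInstance I ++ encodeℚ ε in
  Σ (Schedule I) λ σ → Σ (Feasible I σ) λ feasible → ∃[ t ]
    (Computes_↦_In_Steps M input (encodeSchedule σ) t
      × fromℕ t ≤ eval p (fromℕ (length input)) ((1/ ε) {{ℚ.pos⇒nonZero ε}}))
    × ∃[ opt ] IsMinCost I opt
      × fromℚ (fromℕ (cost I σ feasible)) ≤ℝ (ρ +ℝ fromℚ ε) *ℝ fromℚ (fromℕ opt)

{-# OPTIONS --safe #-}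

-- A greedy algorithm that ignores ε does slightly better than required: its
-- ratio is 6 for identical and 8 for unrelated machines, while 4e/(e-1) ≥ 6 and
-- 8e/(e-1) ≥ 12 because e ≤ 3.
--
-- A set of cost c may be started on a machine only at a time s ≥ a c. The greedy
-- choice is the pair of a set and a machine that can start first; among those
-- that can start at the same time it is the one with the highest density, which
-- is the weight of the newly covered elements divided by c. Compare with a
-- schedule of cost OPT. If a set O of it has finished by time t / b, where
-- b = a + 1, then O was already admissible when the machine of O chose the set
-- that it runs at time t, so the density of that set is at least that of O on
-- the elements which are not yet taken at time t. Summing over the sets O of the
-- optimal schedule bounds the untaken weight at time t by the weight uncovered
-- in it at time t / b plus t / b times the total current density, and summing
-- over t gives b Σ w s ≤ Σ w f + b² OPT for the start and finish times s and f
-- of the elements. For unrelated machines, with a = 3, this yields Σ w f ≤ 8 OPT.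
-- For m identical machines the greedy algorithm runs on one virtual machine, on
-- which time is the total processing volume, with b = 3 m. Here s may be replaced
-- by f on the left, which gives Σ w f ≤ (9/2) m OPT, and list scheduling of the
-- chosen sets finishes a set with virtual finish time f by time (4/3) f / m.
--
-- The Turing machine is obtained from combinators for functions between types
-- whose values are serialized as binary trees in Polish notation on a stack.

module Submission where

-- The delay `a` balances two losses. `balance` reads q S ≤ F + q b OPT, with S and F the weighted
-- start and finish times. For unrelated machines q = b = a + 1 and waiting gives F ≤ (b / a) S, so
-- F ≤ (a + 1)² / (a - 1) OPT, which is least at a = 3. For identical machines F stands in place of
-- S and b = q m; list scheduling multiplies the bound q² m / (q - 1) by (1 + 1 / q) / m, which
-- leaves q (q + 1) / (q - 1), and q = 3 gives 6. Finish times may replace start times on one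
-- machine because the only set in progress was chosen against all the weight that still counts as
-- untaken; with several machines other sets may be in progress. Time is discrete and densities are
-- scaled by a common multiple of the costs, so the comparison takes place in ℕ; reals enter only
-- through bounds on e / (e - 1). Polynomial time has to survive loops, where composing polynomials
-- a variable number of times would fail. Each program therefore carries a bound on its output size,
-- and folds are used only when a step enlarges the accumulator by an amount that does not depend on
-- it.

-- Binary digits: equations for the library's conversion.

module Digits where

  open import Data.Digit using (Bit; toDigits; fromDigits)
  open import Data.Nat
  open import Data.Nat.Properties
  open import Data.Nat.DivMod
  open import Data.Nat.Induction using (<′-Rec; <′-wellFounded; <′-wellFounded′)
  open import Induction.WellFounded using (Acc; module Some; module FixPoint)
  open import Relation.Unary using (_⊆′_)
  open import Data.Fin as Fin using (toℕ; zero; suc)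
  open import Data.List using (List; []; _∷_)
  open import Data.Product using (∃; _,_; proj₁; proj₂; _×_)
  open import Relation.Binary.PropositionalEquality

  Pred : ℕ → Set
  Pred n = ∃ λ (ds : List Bit) → fromDigits ds ≡ n

  Step : Set
  Step = <′-Rec Pred ⊆′ Pred

  -- toDigits is defined by well-founded recursion over a step function that is
  -- local to the library module. Unification recovers that function from the
  -- stuck recursive call that remains after two digits have been produced.
  private
    stepIn : ∀ {h : Step} {n} (wf : <′-Rec (Acc _<′_) n) {m} {m<n : m <′ n} {y} {y<m : y <′ m} {r r′ : Bit} {ds} →
             r ∷ r′ ∷ proj₁ (Some.wfRecBuilder Pred h m (wf m<n) y<m) ≡ ds → Step
    stepIn {h} _ _ = h

    stepOf : ∀ n (ds : List Bit) → proj₁ (toDigits 2 n) ≡ ds → Step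
    stepOf n ds eq with n divMod 2
    -- Fewer digits leave no recursive call to read; such clauses return an arbitrary function and
    -- are not reached from `step`.
    stepOf n ds eq | result zero r _ = λ n _ → toDigits 2 n
    stepOf n ds eq | result (suc x) r refl with <′-wellFounded′ (toℕ r + suc x * 2) | suc x divMod 2
    ... | wf | result zero r′ _             = λ n _ → toDigits 2 n
    ... | wf | result (suc y) zero refl     = stepIn wf eq
    ... | wf | result (suc y) (suc zero) refl = stepIn wf eq

    step : Step
    -- 4 is the least number with three digits: after two of them a recursive call, on 1, is still
    -- left.
    step = stepOf 4 _ refl

    -- Unfolding a well-founded fixed point requires that its functional respects pointwise equality
    -- of the recursive calls.
    step-ext : ∀ n {IH IH′ : <′-Rec Pred n} → (∀ {y} y<n → IH {y} y<n ≡ IH′ y<n) → step n IH ≡ step n IH′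
    step-ext n h with n divMod 2
    ... | result zero r eq      = refl
    ... | result (suc x) r refl = cong (λ p → r ∷ proj₁ p , cong (λ i → toℕ r + i * 2) (proj₂ p)) (h _)

    toDigits-unfold : ∀ n → toDigits 2 n ≡ step n (λ {y} _ → toDigits 2 y)
    toDigits-unfold n = FixPoint.unfold-wfRec <′-wellFounded Pred step step-ext

  -- In the mixed cases, removing one from both sides exchanges the parities, so the quotients
  -- decrease alternately until the equation is absurd.
  divMod-unique : ∀ (b r : Bit) q q′ → toℕ b + q * 2 ≡ toℕ r + q′ * 2 → b ≡ r × q ≡ q′
  divMod-unique zero       zero       q q′ eq = refl , *-cancelʳ-≡ q q′ 2 eq
  divMod-unique (suc zero) (suc zero) q q′ eq = refl , *-cancelʳ-≡ q q′ 2 (suc-injective eq)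
  divMod-unique zero       (suc zero) (suc q) q′ eq with () ← proj₁ (divMod-unique (suc zero) zero q q′ (suc-injective eq))
  divMod-unique (suc zero) zero       q (suc q′) eq with () ← proj₁ (divMod-unique zero (suc zero) q q′ (suc-injective eq))

  private
    digits′ : ℕ → List Bit
    digits′ n = proj₁ (toDigits 2 n)

    digits-∷′ : ∀ (b : Bit) x → digits′ (toℕ b + suc x * 2) ≡ b ∷ digits′ (suc x)
    digits-∷′ b x = trans (cong proj₁ (toDigits-unfold n)) go
      where
      n = toℕ b + suc x * 2
      split : ∀ {N q} (r : Bit) → N ≡ n → N ≡ toℕ r + q * 2 → b ≡ r × suc x ≡ q
      split r e eq = divMod-unique b r (suc x) _ (trans (sym e) eq)
      go : proj₁ (step n (λ {y} _ → toDigits 2 y)) ≡ b ∷ digits′ (suc x)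
      go = aux n refl
        where
        aux : ∀ N → N ≡ n → proj₁ (step N (λ {y} _ → toDigits 2 y)) ≡ b ∷ digits′ (suc x)
        aux N e with N divMod 2
        ... | result zero r eq with () ← proj₂ (split {q = zero} r e eq)
        ... | result (suc y) r refl with split {q = suc y} r e refl
        ...   | refl , refl = refl

  opaque
    -- Opaque, so that the type checker never unfolds the well-founded recursion; all later
    -- reasoning rests on the four equations that follow.
    digits : ℕ → List Bit
    digits n = proj₁ (toDigits 2 n)

    digits-toDigits : ∀ n → digits n ≡ proj₁ (toDigits 2 n)
    digits-toDigits n = refl

    digits-bit : ∀ (b : Bit) → digits (toℕ b) ≡ b ∷ []
    digits-bit zero       = refl
    digits-bit (suc zero) = refl

    digits-∷ : ∀ (b : Bit) x → digits (toℕ b + suc x * 2) ≡ b ∷ digits (suc x)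
    digits-∷ = digits-∷′

    fromDigits-digits : ∀ n → fromDigits (digits n) ≡ n
    fromDigits-digits n = proj₂ (toDigits 2 n)

-- Structured programs on four stacks and their compilation to Turing machines.

module Machine where

  open import Defs
  open import Data.Bool using (Bool; true; false; if_then_else_)
  open import Data.Fin as Fin using (Fin; zero; suc)
  open import Data.Fin.Properties using (+↔⊎)
  open import Data.List as List using (List; []; _∷_; _++_; drop; replicate)
  open import Data.Maybe as Maybe using (Maybe; just; nothing)
  open import Data.Nat using (ℕ; zero; suc; _+_; _≤_; s≤s)
  open import Data.Nat.Properties using (≤-refl; ≤-trans; +-mono-≤)
  open import Data.Product using (∃₂; ∃-syntax; _×_; _,_)
  open import Data.Sum using (_⊎_; inj₁; inj₂)
  open import Data.Sum.Function.Propositional using (_⊎-↔_)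
  open import Data.Unit using (⊤; tt)
  open import Data.Vec as Vec using (Vec; []; _∷_; lookup; _[_]≔_; _[_]%=_)
  open import Data.Vec.Relation.Binary.Pointwise.Inductive as Pw using (Pointwise; []; _∷_)
  open import Function using (mk↔ₛ′)
  open import Function.Construct.Composition using (_↔-∘_)
  open import Function.Construct.Symmetry using (↔-sym)
  open import Relation.Binary.PropositionalEquality

  -- A main stack, two stacks for values that are set aside, and one for a counter.
  K : ℕ
  K = 4

  Sym : Set
  Sym = Symbol (Fin 0)

  topSym : Sym → Maybe Token
  topSym blank    = nothing
  topSym (tok t)  = just t
  topSym (aux ())

  data Code : Set where
    skip  : Code
    push  : Fin K → Token → Code
    pop   : Fin K → Code
    _⨾_   : Code → Code → Code
    ifTop : Fin K → (Maybe Token → Bool) → Code → Code → Code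
    while : Fin K → (Maybe Token → Bool) → Code → Code

  infixr 5 _⨾_

  -- Control states are positions in the syntax tree, so an execution of a subprogram becomes one of
  -- the whole program by injecting its states.
  St : Code → Set
  St skip            = ⊤
  St (push i t)      = Bool
  St (pop i)         = ⊤
  St (c ⨾ d)         = St c ⊎ St d
  St (ifTop i P c d) = ⊤ ⊎ (St c ⊎ St d)
  St (while i P c)   = ⊤ ⊎ St c

  private
    finite-⊤ : Finite ⊤
    finite-⊤ = 1 , mk↔ₛ′ (λ _ → zero) (λ _ → tt) (λ { zero → refl }) (λ _ → refl)

    finite-⊎ : ∀ {A B : Set} → Finite A → Finite B → Finite (A ⊎ B)
    finite-⊎ (m , f) (n , g) = m + n , ↔-sym +↔⊎ ↔-∘ (f ⊎-↔ g)

    finite-Bool : Finite Bool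
    finite-Bool = 2 , mk↔ₛ′ (λ { false → zero ; true → suc zero }) (λ { zero → false ; (suc zero) → true })
      (λ { zero → refl ; (suc zero) → refl }) (λ { false → refl ; true → refl })

    finite-Maybe : ∀ {A : Set} → Finite A → Finite (Maybe A)
    finite-Maybe (n , f) = suc n , mk↔ₛ′
      (λ { nothing → zero ; (just x) → suc (to x) }) (λ { zero → nothing ; (suc i) → just (from i) })
      (λ { zero → refl ; (suc i) → cong suc (strictlyInverseˡ i) })
      (λ { nothing → refl ; (just x) → cong just (strictlyInverseʳ x) })
      where open Function.Inverse f

  finite-St : ∀ c → Finite (St c)
  finite-St skip            = finite-⊤
  finite-St (push i t)      = finite-Bool
  finite-St (pop i)         = finite-⊤
  finite-St (c ⨾ d)         = finite-⊎ (finite-St c) (finite-St d)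
  finite-St (ifTop i P c d) = finite-⊎ finite-⊤ (finite-⊎ (finite-St c) (finite-St d))
  finite-St (while i P c)   = finite-⊎ finite-⊤ (finite-St c)

  startOf : ∀ c → St c
  startOf skip            = tt
  startOf (push i t)      = false
  startOf (pop i)         = tt
  startOf (c ⨾ d)         = inj₁ (startOf c)
  startOf (ifTop i P c d) = inj₁ tt
  startOf (while i P c)   = inj₁ tt

  stays : ∀ {k} → Vec Sym k → Vec (Sym × Move) k
  stays = Vec.map (_, stay)

  -- A stack is stored with its top under the head and the rest to the right, so
  -- a push first moves left and only then writes. The successor state nothing
  -- means that the code has been left.
  next-step : ∀ c → St c → Vec Sym K → Maybe (St c) × Vec (Sym × Move) K
  next-step skip       _     hs = nothing , stays hs
  next-step (push i t) false hs = just true , stays hs [ i ]≔ (lookup hs i , left)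
  next-step (push i t) true  hs = nothing , stays hs [ i ]≔ (tok t , stay)
  next-step (pop i)    _     hs = nothing , stays hs [ i ]≔ (lookup hs i , right)
  next-step (c ⨾ d) (inj₁ s) hs with next-step c s hs
  -- Leaving the first part and entering the second is a single step, so running times add exactly.
  ... | nothing , as = just (inj₂ (startOf d)) , as
  ... | just s′ , as = just (inj₁ s′) , as
  next-step (c ⨾ d) (inj₂ s) hs with next-step d s hs
  ... | nothing , as = nothing , as
  ... | just s′ , as = just (inj₂ s′) , as
  next-step (ifTop i P c d) (inj₁ _) hs =
    just (inj₂ (if P (topSym (lookup hs i)) then inj₁ (startOf c) else inj₂ (startOf d))) , stays hs
  next-step (ifTop i P c d) (inj₂ (inj₁ s)) hs with next-step c s hs
  ... | nothing , as = nothing , as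
  ... | just s′ , as = just (inj₂ (inj₁ s′)) , as
  next-step (ifTop i P c d) (inj₂ (inj₂ s)) hs with next-step d s hs
  ... | nothing , as = nothing , as
  ... | just s′ , as = just (inj₂ (inj₂ s′)) , as
  next-step (while i P c) (inj₁ _) hs =
    (if P (topSym (lookup hs i)) then just (inj₂ (startOf c)) else nothing) , stays hs
  next-step (while i P c) (inj₂ s) hs with next-step c s hs
  ... | nothing , as = just (inj₁ tt) , as
  ... | just s′ , as = just (inj₂ s′) , as

  compile : Code → TM
  compile c = record
    { State       = Maybe (St c)
    ; finiteState = finite-Maybe (finite-St c)
    ; start       = just (startOf c)
    ; Aux         = Fin 0
    ; finiteAux   = 0 , mk↔ₛ′ (λ x → x) (λ x → x) (λ _ → refl) (λ _ → refl)
    ; workTapes   = 3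
    ; δ           = λ { nothing hs → nothing ; (just s) hs → just (next-step c s hs) }
    }

  Tapes : Set
  Tapes = Vec (Tape (Fin 0)) K

  heads : ∀ {k} → Vec (Tape (Fin 0)) k → Vec Sym k
  heads = Vec.map Tape.head

  -- The step that leaves the code is counted; only tapes are recorded at the end, since no control
  -- state of the code is left.
  data Exec (c : Code) : St c → Tapes → ℕ → Tapes → Set where
    exit : ∀ {s ts as} → next-step c s (heads ts) ≡ (nothing , as) →
           Exec c s ts 1 (Vec.zipWith act as ts)
    more : ∀ {s s′ ts as n ts′} → next-step c s (heads ts) ≡ (just s′ , as) →
           Exec c s′ (Vec.zipWith act as ts) n ts′ → Exec c s ts (suc n) ts′

  module _ {c d : Code} where

    exec-seqʳ : ∀ {s ts n ts′} → Exec d s ts n ts′ → Exec (c ⨾ d) (inj₂ s) ts n ts′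
    exec-seqʳ (exit eq)   = exit (helper eq)
      where
      helper : ∀ {s hs as} → next-step d s hs ≡ (nothing , as) → next-step (c ⨾ d) (inj₂ s) hs ≡ (nothing , as)
      helper eq rewrite eq = refl
    exec-seqʳ (more eq r) = more (helper eq) (exec-seqʳ r)
      where
      helper : ∀ {s s′ hs as} → next-step d s hs ≡ (just s′ , as) → next-step (c ⨾ d) (inj₂ s) hs ≡ (just (inj₂ s′) , as)
      helper eq rewrite eq = refl

    exec-seq : ∀ {s ts m ts′ n ts″} → Exec c s ts m ts′ → Exec d (startOf d) ts′ n ts″ →
               Exec (c ⨾ d) (inj₁ s) ts (m + n) ts″
    exec-seq (exit eq) q   = more (helper eq) (exec-seqʳ q)
      where
      helper : ∀ {s hs as} → next-step c s hs ≡ (nothing , as) →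
               next-step (c ⨾ d) (inj₁ s) hs ≡ (just (inj₂ (startOf d)) , as)
      helper eq rewrite eq = refl
    exec-seq (more eq r) q = more (helper eq) (exec-seq r q)
      where
      helper : ∀ {s s′ hs as} → next-step c s hs ≡ (just s′ , as) → next-step (c ⨾ d) (inj₁ s) hs ≡ (just (inj₁ s′) , as)
      helper eq rewrite eq = refl

    exec-then : ∀ {i P s ts n ts′} → Exec c s ts n ts′ → Exec (ifTop i P c d) (inj₂ (inj₁ s)) ts n ts′
    exec-then {i} {P} (exit eq)   = exit (helper eq)
      where
      helper : ∀ {s hs as} → next-step c s hs ≡ (nothing , as) →
               next-step (ifTop i P c d) (inj₂ (inj₁ s)) hs ≡ (nothing , as)
      helper eq rewrite eq = refl
    exec-then {i} {P} (more eq r) = more (helper eq) (exec-then r)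
      where
      helper : ∀ {s s′ hs as} → next-step c s hs ≡ (just s′ , as) →
               next-step (ifTop i P c d) (inj₂ (inj₁ s)) hs ≡ (just (inj₂ (inj₁ s′)) , as)
      helper eq rewrite eq = refl

    exec-else : ∀ {i P s ts n ts′} → Exec d s ts n ts′ → Exec (ifTop i P c d) (inj₂ (inj₂ s)) ts n ts′
    exec-else {i} {P} (exit eq)   = exit (helper eq)
      where
      helper : ∀ {s hs as} → next-step d s hs ≡ (nothing , as) →
               next-step (ifTop i P c d) (inj₂ (inj₂ s)) hs ≡ (nothing , as)
      helper eq rewrite eq = refl
    exec-else {i} {P} (more eq r) = more (helper eq) (exec-else r)
      where
      helper : ∀ {s s′ hs as} → next-step d s hs ≡ (just s′ , as) →
               next-step (ifTop i P c d) (inj₂ (inj₂ s)) hs ≡ (just (inj₂ (inj₂ s′)) , as)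
      helper eq rewrite eq = refl

  exec-loop : ∀ {i P c s ts m ts′ n ts″} → Exec c s ts m ts′ → Exec (while i P c) (inj₁ tt) ts′ n ts″ →
              Exec (while i P c) (inj₂ s) ts (m + n) ts″
  exec-loop {i} {P} {c} (exit eq) q   = more (helper eq) q
    where
    helper : ∀ {s hs as} → next-step c s hs ≡ (nothing , as) →
             next-step (while i P c) (inj₂ s) hs ≡ (just (inj₁ tt) , as)
    helper eq rewrite eq = refl
  exec-loop {i} {P} {c} (more eq r) q = more (helper eq) (exec-loop r q)
    where
    helper : ∀ {s s′ hs as} → next-step c s hs ≡ (just s′ , as) →
             next-step (while i P c) (inj₂ s) hs ≡ (just (inj₂ s′) , as)
    helper eq rewrite eq = refl

  -- The blanks absorb the cells visited when an empty stack is popped.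
  Holds : Tape (Fin 0) → List Token → Set
  Holds (tape _ x rs) xs = ∃[ b ] x ∷ rs ≡ List.map tok xs ++ replicate b blank

  Stacks : Set
  Stacks = Vec (List Token) K

  Hold : ∀ {k} → Vec (Tape (Fin 0)) k → Vec (List Token) k → Set
  Hold = Pointwise Holds

  top : Fin K → Stacks → Maybe Token
  top i ss = List.head (lookup ss i)

  -- A Hoare triple with a time bound. It quantifies over all tapes that hold the stacks, because
  -- the cells left of the head and the number of trailing blanks are not determined by the stacks.
  Runs : Code → Stacks → ℕ → Stacks → Set
  Runs c ss n ss′ = ∀ {ts} → Hold ts ss →
    ∃₂ λ t ts′ → t ≤ n × Hold ts′ ss′ × Exec c (startOf c) ts t ts′

  private
    act-stays : ∀ {k} (ts : Vec (Tape (Fin 0)) k) → Vec.zipWith act (stays (heads ts)) ts ≡ ts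
    act-stays []       = refl
    act-stays (t ∷ ts) = cong (t ∷_) (act-stays ts)

    act-update : ∀ {k} (i : Fin k) a (ts : Vec (Tape (Fin 0)) k) →
                 Vec.zipWith act (stays (heads ts) [ i ]≔ a) ts ≡ ts [ i ]%= act a
    act-update zero    a (t ∷ ts) = cong (_ ∷_) (act-stays ts)
    act-update (suc i) a (t ∷ ts) = cong (t ∷_) (act-update i a ts)

    hold-update : ∀ {k} (i : Fin k) {ts : Vec (Tape (Fin 0)) k} {ss f g} → Hold ts ss →
                  (∀ {t s} → lookup ts i ≡ t → Holds t s → Holds (f t) (g s)) → Hold (ts [ i ]%= f) (ss [ i ]%= g)
    hold-update zero    (h ∷ hs) k = k refl h ∷ hs
    hold-update (suc i) (h ∷ hs) k = h ∷ hold-update i hs k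

    hold-lookup : ∀ {k} (i : Fin k) {ts : Vec (Tape (Fin 0)) k} {ss} → Hold ts ss → Holds (lookup ts i) (lookup ss i)
    hold-lookup i hs = Pw.lookup hs i

    head-lookup : ∀ {k} (i : Fin k) (ts : Vec (Tape (Fin 0)) k) → lookup (heads ts) i ≡ Tape.head (lookup ts i)
    head-lookup zero    (t ∷ ts) = refl
    head-lookup (suc i) (t ∷ ts) = head-lookup i ts

    holds-top : ∀ {t xs} → Holds t xs → topSym (Tape.head t) ≡ List.head xs
    holds-top {tape _ x rs} {[]}     (zero , ())
    holds-top {tape _ x rs} {[]}     (suc b , refl) = refl
    holds-top {tape _ x rs} {y ∷ xs} (b , refl)     = refl

    top-correct : ∀ i {ts ss} → Hold ts ss → topSym (lookup (heads ts) i) ≡ top i ss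
    top-correct i {ts} hs = trans (cong topSym (head-lookup i ts)) (holds-top {lookup ts i} (hold-lookup i hs))

    holds-right : ∀ {ls x rs xs} → Holds (tape ls x rs) xs → Holds (move right (tape ls x rs)) (drop 1 xs)
    holds-right {rs = []}     {[]}          h              = 1 , refl
    holds-right {rs = []}     {x ∷ []}      (b , eq)       = 1 , refl
    holds-right {rs = []}     {x ∷ x′ ∷ xs} (b , ())
    holds-right {rs = r ∷ rs} {[]}          (suc b , eq)   = b , cong (drop 1) eq
    holds-right {rs = r ∷ rs} {x ∷ xs}      (b , eq)       = b , cong (drop 1) eq

    -- The cell reached on the left is overwritten at once, so nothing has to be known about its
    -- content.
    holds-left : ∀ u {xs} → Holds u xs → ∀ t → Holds (act (tok t , stay) (move left u)) (t ∷ xs)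
    holds-left (tape []       x rs) (b , eq) t = b , cong (tok t ∷_) eq
    holds-left (tape (l ∷ ls) x rs) (b , eq) t = b , cong (tok t ∷_) eq

  runs-skip : ∀ {ss} → Runs skip ss 1 ss
  runs-skip {ss} {ts} h = 1 , _ , ≤-refl , subst (λ ts′ → Hold ts′ ss) (sym (act-stays ts)) h , exit refl

  runs-pop : ∀ i {ss} → Runs (pop i) ss 1 (ss [ i ]%= drop 1)
  runs-pop i {ss} {ts} h = 1 , _ , ≤-refl ,
    subst (λ ts′ → Hold ts′ (ss [ i ]%= drop 1)) (sym (act-update i _ ts))
      (hold-update i h λ { {t} refl k → subst (λ y → Holds (move right (tape (Tape.before t) y (Tape.after t))) _)
                             (sym (head-lookup i ts)) (holds-right k) }) ,
    exit refl

  runs-push : ∀ i t {ss} → Runs (push i t) ss 2 (ss [ i ]%= (t ∷_))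
  runs-push i t {ss} {ts} h = 2 , _ , ≤-refl , hold , more refl (exit refl)
    where
    a = lookup (heads ts) i , left
    ts₁ = Vec.zipWith act (stays (heads ts) [ i ]≔ a) ts
    eq : ts₁ [ i ]%= act (tok t , stay) ≡ ts [ i ]%= (λ u → act (tok t , stay) (act a u))
    eq = trans (cong (_[ i ]%= act (tok t , stay)) (act-update i a ts))
               (updateAt-∘ i ts)
      where
      updateAt-∘ : ∀ {k} {A : Set} {f g : A → A} (i : Fin k) (xs : Vec A k) →
                   (xs [ i ]%= f) [ i ]%= g ≡ xs [ i ]%= (λ x → g (f x))
      updateAt-∘ zero    (x ∷ xs) = refl
      updateAt-∘ (suc i) (x ∷ xs) = cong (x ∷_) (updateAt-∘ i xs)
    hold : Hold (Vec.zipWith act (stays (heads ts₁) [ i ]≔ (tok t , stay)) ts₁) (ss [ i ]%= (t ∷_))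
    hold = subst (λ ts′ → Hold ts′ (ss [ i ]%= (t ∷_))) (sym (trans (act-update i _ ts₁) eq))
      (hold-update i h λ { {u} {s} refl k →
        subst (λ y → Holds (act (tok t , stay) (move left (tape (Tape.before u) y (Tape.after u)))) (t ∷ s))
              (sym (head-lookup i ts)) (holds-left u k t) })

  runs-weaken : ∀ {c ss m n ss′} → m ≤ n → Runs c ss m ss′ → Runs c ss n ss′
  runs-weaken m≤n r h = let t , ts , t≤ , h′ , x = r h in t , ts , ≤-trans t≤ m≤n , h′ , x

  runs-seq : ∀ {c d ss m ss′ n ss″} → Runs c ss m ss′ → Runs d ss′ n ss″ → Runs (c ⨾ d) ss (m + n) ss″
  runs-seq r q h =
    let t , ts  , t≤ , h′  , x = r h
        u , ts′ , u≤ , h″ , y = q h′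
    in t + u , ts′ , +-mono-≤ t≤ u≤ , h″ , exec-seq x y

  private
    if-step : ∀ i P {c d b} {ts ss} → Hold ts ss → P (top i ss) ≡ b →
              next-step (ifTop i P c d) (inj₁ tt) (heads ts) ≡
              (just (inj₂ (if b then inj₁ (startOf c) else inj₂ (startOf d))) , stays (heads ts))
    if-step i P {ts = ts} h refl rewrite top-correct i h = refl

    while-step : ∀ i P {c b} {ts ss} → Hold ts ss → P (top i ss) ≡ b →
                 next-step (while i P c) (inj₁ tt) (heads ts) ≡
                 ((if b then just (inj₂ (startOf c)) else nothing) , stays (heads ts))
    while-step i P h refl rewrite top-correct i h = refl

  runs-then : ∀ {i P c d ss n ss′} → P (top i ss) ≡ true → Runs c ss n ss′ → Runs (ifTop i P c d) ss (suc n) ss′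
  runs-then {i} {P} {c} {d} eq r {ts} h =
    let t , ts′ , t≤ , h′ , x = r h
    in suc t , ts′ , s≤s t≤ , h′ ,
       more (if-step i P {c} {d} h eq) (subst (λ us → Exec _ _ us t ts′) (sym (act-stays ts)) (exec-then x))

  runs-else : ∀ {i P c d ss n ss′} → P (top i ss) ≡ false → Runs d ss n ss′ → Runs (ifTop i P c d) ss (suc n) ss′
  runs-else {i} {P} {c} {d} eq r {ts} h =
    let t , ts′ , t≤ , h′ , x = r h
    in suc t , ts′ , s≤s t≤ , h′ ,
       more (if-step i P {c} {d} h eq) (subst (λ us → Exec _ _ us t ts′) (sym (act-stays ts)) (exec-else x))

  runs-stop : ∀ {i P c ss} → P (top i ss) ≡ false → Runs (while i P c) ss 1 ss
  runs-stop {i} {P} {c} {ss} eq {ts} h = 1 , _ , ≤-refl ,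
    subst (λ ts′ → Hold ts′ ss) (sym (act-stays ts)) h , exit (while-step i P {c} h eq)

  runs-loop : ∀ {i P c ss m ss′ n ss″} → P (top i ss) ≡ true → Runs c ss m ss′ → Runs (while i P c) ss′ n ss″ →
              Runs (while i P c) ss (suc (m + n)) ss″
  runs-loop {i} {P} {c} eq r q {ts} h =
    let t , ts′ , t≤ , h′  , x = r h
        u , ts″ , u≤ , h″ , y = q h′
    in suc (t + u) , ts″ , s≤s (+-mono-≤ t≤ u≤) , h″ ,
       more (while-step i P {c} h eq) (subst (λ us → Exec _ _ us (t + u) ts″) (sym (act-stays ts)) (exec-loop x y))

  private
    exec⇒⇓ : ∀ {c s ts t ts′} → Exec c s ts t ts′ →
             _⇓[_]_ (compile c) (config (just s) ts) t (config nothing ts′)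
    exec⇒⇓ (exit eq)   = next (cong (λ { (s′ , as) → just (config s′ (Vec.zipWith act as _)) }) eq) (halt refl)
    exec⇒⇓ (more eq r) = next (cong (λ { (s′ , as) → just (config s′ (Vec.zipWith act as _)) }) eq) (exec⇒⇓ r)

    leading : ∀ xs b → leadingTokens {Fin 0} (List.map tok xs ++ replicate b blank) ≡ xs
    leading []       zero    = refl
    leading []       (suc b) = refl
    leading (x ∷ xs) b       = cong (x ∷_) (leading xs b)

    holds-initial : ∀ xs → Holds (fromList (List.map tok xs)) xs
    holds-initial []       = 1 , refl
    holds-initial (x ∷ xs) = 0 , cong (tok x ∷_) (lemma xs)
      where
      lemma : ∀ xs → List.map tok xs ≡ List.map tok xs ++ []
      lemma []       = refl
      lemma (x ∷ xs) = cong (tok x ∷_) (lemma xs)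

    holds-output : ∀ {c q t ts xs ss} → Hold {4} (t ∷ ts) (xs ∷ ss) → output (compile c) (config q (t ∷ ts)) ≡ xs
    holds-output {t = tape _ x rs} {xs = xs} ((b , eq) ∷ _) = trans (cong leadingTokens eq) (leading xs b)

  runs⇒computes : ∀ {c xs n ys ss} → Runs c (xs ∷ [] ∷ [] ∷ [] ∷ []) n (ys ∷ ss) →
                  ∃[ t ] t ≤ n × Computes_↦_In_Steps (compile c) xs ys t
  -- The head of an empty tape rests on a blank, so an empty stack is held with one blank.
  runs⇒computes {c} {xs} {ys = ys} {ss} r with r (holds-initial xs ∷ (1 , refl) ∷ (1 , refl) ∷ (1 , refl) ∷ [])
  ... | t , (u ∷ ts) , t≤ , h , x = t , t≤ , _ , exec⇒⇓ x , holds-output {c} {nothing} {u} {ts} {ys} {ss} h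

-- Polynomial bounds in one variable.

module Bounds where

  open import Data.Nat
  open import Data.Nat.Properties
  open import Data.Product using (∃₂; _,_)
  open import Relation.Binary.PropositionalEquality

  -- A syntax instead of functions, so that monotonicity and domination by a monomial follow by
  -- induction. Composition is a constructor because the cost of a second program is measured at the
  -- output size of the first.
  data Bound : Set where
    var         : Bound
    con         : ℕ → Bound
    _⊕_ _⊗_ _⊙_ : Bound → Bound → Bound

  infixl 6 _⊕_
  infixl 7 _⊗_
  infixr 9 _⊙_
  infix  8 _at_

  _at_ : Bound → ℕ → ℕ
  var     at n = n
  con c   at n = c
  (p ⊕ q) at n = p at n + q at n
  (p ⊗ q) at n = p at n * q at n
  (p ⊙ q) at n = p at (q at n)

  at-mono : ∀ p {m n} → m ≤ n → p at m ≤ p at n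
  at-mono var     m≤n = m≤n
  at-mono (con c) m≤n = ≤-refl
  at-mono (p ⊕ q) m≤n = +-mono-≤ (at-mono p m≤n) (at-mono q m≤n)
  at-mono (p ⊗ q) m≤n = *-mono-≤ (at-mono p m≤n) (at-mono q m≤n)
  at-mono (p ⊙ q) m≤n = at-mono p (at-mono q m≤n)

  -- The base `suc n` is at least 1, so that powers grow with the exponent also at n = 0 and
  -- additive constants are absorbed.
  monomial : ∀ p → ∃₂ λ C D → ∀ n → p at n ≤ C * suc n ^ D
  monomial var = 1 , 1 , λ n → begin
    n               ≤⟨ n≤1+n n ⟩
    suc n           ≡⟨ sym (trans (*-identityˡ _) (*-identityʳ _)) ⟩
    1 * (suc n * 1) ∎
    where open ≤-Reasoning
  monomial (con c) = c , 0 , λ n → ≤-reflexive (sym (*-identityʳ c))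
  monomial (p ⊕ q) with monomial p | monomial q
  ... | C , D , f | C′ , D′ , g = C + C′ , D + D′ , λ n → begin
    p at n + q at n                                  ≤⟨ +-mono-≤ (f n) (g n) ⟩
    C * suc n ^ D + C′ * suc n ^ D′                  ≤⟨ +-mono-≤ (*-monoʳ-≤ C (^-monoʳ-≤ (suc n) (m≤m+n D D′)))
                                                                 (*-monoʳ-≤ C′ (^-monoʳ-≤ (suc n) (m≤n+m D′ D))) ⟩
    C * suc n ^ (D + D′) + C′ * suc n ^ (D + D′)     ≡⟨ sym (*-distribʳ-+ (suc n ^ (D + D′)) C C′) ⟩
    (C + C′) * suc n ^ (D + D′)                      ∎
    where open ≤-Reasoning
  monomial (p ⊗ q) with monomial p | monomial q
  ... | C , D , f | C′ , D′ , g = C * C′ , D + D′ , λ n → begin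
    p at n * q at n                          ≤⟨ *-mono-≤ (f n) (g n) ⟩
    (C * suc n ^ D) * (C′ * suc n ^ D′)      ≡⟨ [m*n]*[o*p]≡[m*o]*[n*p] C (suc n ^ D) C′ (suc n ^ D′) ⟩
    (C * C′) * (suc n ^ D * suc n ^ D′)      ≡⟨ cong (C * C′ *_) (sym (^-distribˡ-+-* (suc n) D D′)) ⟩
    (C * C′) * suc n ^ (D + D′)              ∎
    where open ≤-Reasoning
  monomial (p ⊙ q) with monomial p | monomial q
  ... | C , D , f | C′ , D′ , g = C * suc C′ ^ D , D′ * D , λ n → begin
    p at (q at n)                              ≤⟨ f (q at n) ⟩
    C * suc (q at n) ^ D                       ≤⟨ *-monoʳ-≤ C (^-monoˡ-≤ D (begin
        suc (q at n)                             ≤⟨ +-mono-≤ (m^n>0 (suc n) D′) (g n) ⟩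
        suc C′ * suc n ^ D′                      ∎)) ⟩
    C * (suc C′ * suc n ^ D′) ^ D              ≡⟨ cong (C *_) (^-distribʳ-* D (suc C′) (suc n ^ D′)) ⟩
    C * (suc C′ ^ D * (suc n ^ D′) ^ D)        ≡⟨ cong (λ z → C * (suc C′ ^ D * z)) (^-*-assoc (suc n) D′ D) ⟩
    C * (suc C′ ^ D * suc n ^ (D′ * D))        ≡⟨ sym (*-assoc C (suc C′ ^ D) _) ⟩
    C * suc C′ ^ D * suc n ^ (D′ * D)          ∎
    where
    open ≤-Reasoning
    ^-distribʳ-* : ∀ k a b → (a * b) ^ k ≡ a ^ k * b ^ k
    ^-distribʳ-* zero    a b = refl
    ^-distribʳ-* (suc k) a b = trans (cong (a * b *_) (^-distribʳ-* k a b)) ([m*n]*[o*p]≡[m*o]*[n*p] a b (a ^ k) (b ^ k))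

-- Binary trees in Polish notation on the stacks: moving, swapping, copying.

module Trees where

  open Machine
  open import Defs using (Token; bit; end; [[; ]])
  open import Data.Bool using (Bool; true; false)
  open import Data.Fin using (Fin; zero; suc)
  open import Data.List as List using (List; []; _∷_; _ʳ++_; length; drop)
  open import Data.Maybe using (Maybe; just; nothing)
  open import Data.Nat
  open import Data.Nat.Properties
  open import Data.Nat.Tactic.RingSolver using (solve-∀)
  open import Data.Vec as Vec using ([]; _∷_; _[_]%=_)
  open import Relation.Binary.PropositionalEquality

  pattern b0 = bit zero
  pattern b1 = bit (suc zero)

  pattern A# = zero
  pattern B# = suc zero
  pattern C# = suc (suc zero)
  pattern E# = suc (suc (suc zero))

  is0 is1 isEnd is[[ some : Maybe Token → Bool
  is0 (just b0)    = true
  is0 _            = false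
  is1 (just b1)    = true
  is1 _            = false
  isEnd (just end) = true
  isEnd _          = false
  is[[ (just [[)   = true
  is[[ _           = false
  some (just _)    = true
  some nothing     = false

  caseTop : Fin K → (Token → Code) → Code
  caseTop i f = ifTop i is0 (f b0) (ifTop i is1 (f b1) (ifTop i isEnd (f end) (ifTop i is[[ (f [[) (f ]]))))

  runs-caseTop : ∀ {i f ss t n ss′} → top i ss ≡ just t → Runs (f t) ss n ss′ → Runs (caseTop i f) ss (4 + n) ss′
  runs-caseTop {t = b0}  eq r = runs-weaken (m≤n+m _ 3) (runs-then (cong is0 eq) r)
  runs-caseTop {t = b1}  eq r = runs-weaken (m≤n+m _ 2) (runs-else (cong is0 eq) (runs-then (cong is1 eq) r))
  runs-caseTop {t = end} eq r = runs-weaken (m≤n+m _ 1)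
    (runs-else (cong is0 eq) (runs-else (cong is1 eq) (runs-then (cong isEnd eq) r)))
  runs-caseTop {t = [[}  eq r =
    runs-else (cong is0 eq) (runs-else (cong is1 eq) (runs-else (cong isEnd eq) (runs-then (cong is[[ eq) r)))
  runs-caseTop {t = ]]}  eq r =
    runs-else (cong is0 eq) (runs-else (cong is1 eq) (runs-else (cong isEnd eq) (runs-else (cong is[[ eq) r)))

  runs-≡ : ∀ {c ss₁ ss₂ n ss₁′ ss₂′} → ss₁ ≡ ss₂ → ss₁′ ≡ ss₂′ → Runs c ss₁ n ss₁′ → Runs c ss₂ n ss₂′
  runs-≡ refl refl r = r

  -- The argument view abstracts over the stacks that a loop does not touch.
  unload : Fin K → (Token → Code) → Code
  unload i f = while i some (caseTop i λ t → pop i ⨾ f t)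

  runs-unload : ∀ i f k (view : List Token → List Token → Stacks) →
    (∀ xs ys → top i (view xs ys) ≡ List.head xs) →
    (∀ t xs ys → view (t ∷ xs) ys [ i ]%= drop 1 ≡ view xs ys) →
    (∀ t xs ys → Runs (f t) (view xs ys) k (view xs (t ∷ ys))) →
    ∀ xs ys → Runs (unload i f) (view xs ys) ((6 + k) * length xs + 1) (view [] (xs ʳ++ ys))
  runs-unload i f k view tp po fo []       ys = runs-weaken (≤-reflexive (cong (_+ 1) (sym (*-zeroʳ k)))) (runs-stop (cong some (tp [] ys)))
  runs-unload i f k view tp po fo (t ∷ xs) ys = runs-weaken (≤-reflexive (arith k (length xs)))
    (runs-loop (cong some (tp (t ∷ xs) ys))
      (runs-caseTop {f = λ t → pop i ⨾ f t} (tp (t ∷ xs) ys) (runs-seq (runs-≡ refl (po t xs ys) (runs-pop i)) (fo t xs ys)))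
      (runs-unload i f k view tp po fo xs (t ∷ ys)))
    where
    arith : ∀ k l → suc ((4 + (1 + k)) + ((6 + k) * l + 1)) ≡ (6 + k) * suc l + 1
    arith = solve-∀

  data Tree : Set where
    leaf : Tree
    node : Tree → Tree → Tree

  -- Polish notation, and the same string as it is found after moving it to
  -- another stack.
  ser : Tree → List Token → List Token
  ser leaf       r = b0 ∷ r
  ser (node t u) r = b1 ∷ ser t (ser u r)

  res : Tree → List Token → List Token
  res leaf       r = b0 ∷ r
  res (node t u) r = res u (res t (b1 ∷ r))

  size : Tree → ℕ
  size leaf       = 1
  size (node t u) = suc (size t + size u)

  -- Moving a stored tree back token by token restores Polish notation, so a tree has to be
  -- delimited only when it is set aside.
  res-ʳ++ : ∀ t ys a → res t ys ʳ++ a ≡ ys ʳ++ ser t a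
  res-ʳ++ leaf       ys a = refl
  res-ʳ++ (node t u) ys a = trans (res-ʳ++ u (res t (b1 ∷ ys)) a) (res-ʳ++ t (b1 ∷ ys) (ser u a))

  length-ser : ∀ t r → length (ser t r) ≡ size t + length r
  length-ser leaf       r = refl
  length-ser (node t u) r = cong suc (trans (length-ser t (ser u r))
    (trans (cong (size t +_) (length-ser u r)) (sym (+-assoc (size t) (size u) (length r)))))

  length-res : ∀ t r → length (res t r) ≡ size t + length r
  length-res leaf       r = refl
  length-res (node t u) r = trans (length-res u _) (trans (cong (size u +_) (length-res t (b1 ∷ r)))
    (arith (size t) (size u) (length r)))
    where
    arith : ∀ a b l → b + (a + suc l) ≡ suc (a + b) + l
    arith = solve-∀

  -- Polish notation is self-delimiting: a node replaces one expected tree by two and a leaf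
  -- completes one, so a unary counter finds the end of the first tree.
  scan : Fin K → Code
  scan d = while C# some (ifTop A# is1 (pop A# ⨾ push d b1 ⨾ push C# end) (pop A# ⨾ push d b0 ⨾ pop C#))

  detach : Fin K → Code
  detach d = push C# end ⨾ scan d

  private
    module Scan (d : Fin K) (view : List Token → List Token → List Token → Stacks)
                (topA : ∀ xs ys cs → top A# (view xs ys cs) ≡ List.head xs)
                (topC : ∀ xs ys cs → top C# (view xs ys cs) ≡ List.head cs)
                (popA : ∀ t xs ys cs → view (t ∷ xs) ys cs [ A# ]%= drop 1 ≡ view xs ys cs)
                (popC : ∀ t xs ys cs → view xs ys (t ∷ cs) [ C# ]%= drop 1 ≡ view xs ys cs)
                (pushD : ∀ t xs ys cs → view xs ys cs [ d ]%= (t ∷_) ≡ view xs (t ∷ ys) cs)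
                (pushC : ∀ t xs ys cs → view xs ys cs [ C# ]%= (t ∷_) ≡ view xs ys (t ∷ cs)) where

      -- The counter on the third stack is the number of trees still to be moved.
      runs-scan : ∀ t {xs ys cs n ss} → Runs (scan d) (view xs (res t ys) cs) n ss →
                  Runs (scan d) (view (ser t xs) ys (end ∷ cs)) (7 * size t + n) ss
      runs-scan leaf {xs} {ys} {cs} r = runs-weaken (n≤1+n _)
        (runs-loop (cong some (topC (b0 ∷ xs) ys (end ∷ cs)))
          (runs-else (cong is1 (topA (b0 ∷ xs) ys (end ∷ cs)))
            (runs-seq (runs-≡ refl (popA b0 xs ys (end ∷ cs)) (runs-pop A#))
              (runs-seq (runs-≡ refl (pushD b0 xs ys (end ∷ cs)) (runs-push d b0))
                (runs-≡ refl (popC end xs (b0 ∷ ys) cs) (runs-pop C#)))))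
          r)
      runs-scan (node t u) {xs} {ys} {cs} {n} r = runs-weaken (≤-reflexive (arith (size t) (size u) n))
        (runs-loop (cong some (topC (b1 ∷ zs) ys (end ∷ cs)))
          (runs-then (cong is1 (topA (b1 ∷ zs) ys (end ∷ cs)))
            (runs-seq (runs-≡ refl (popA b1 zs ys (end ∷ cs)) (runs-pop A#))
              (runs-seq (runs-≡ refl (pushD b1 zs ys (end ∷ cs)) (runs-push d b1))
                (runs-≡ refl (pushC end zs (b1 ∷ ys) (end ∷ cs)) (runs-push C# end)))))
          (runs-scan t (runs-scan u r)))
        where
        zs = ser t (ser u xs)
        arith : ∀ a b n → suc (6 + (7 * a + (7 * b + n))) ≡ 7 * suc (a + b) + n
        arith = solve-∀

      runs-detach : ∀ t {xs ys} → Runs (detach d) (view (ser t xs) ys []) (7 * size t + 3) (view xs (res t ys) [])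
      runs-detach t {xs} {ys} = runs-weaken (≤-reflexive (arith (size t)))
        (runs-seq (runs-≡ refl (pushC end (ser t xs) ys []) (runs-push C# end))
                  (runs-scan t (runs-stop (cong some (topC xs (res t ys) [])))))
        where
        arith : ∀ a → 2 + (7 * a + 1) ≡ 7 * a + 3
        arith = solve-∀

  detachB : ∀ t {xs es} → Runs (detach B#) (ser t xs ∷ [] ∷ [] ∷ es ∷ []) (7 * size t + 3) (xs ∷ res t [] ∷ [] ∷ es ∷ [])
  detachB t {es = es} = Scan.runs-detach B# (λ a b c → a ∷ b ∷ c ∷ es ∷ [])
    (λ _ _ _ → refl) (λ _ _ _ → refl) (λ _ _ _ _ → refl) (λ _ _ _ _ → refl) (λ _ _ _ _ → refl) (λ _ _ _ _ → refl) t

  detachE : ∀ t {xs bs} → Runs (detach E#) (ser t xs ∷ bs ∷ [] ∷ [] ∷ []) (7 * size t + 3) (xs ∷ bs ∷ [] ∷ res t [] ∷ [])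
  detachE t {bs = bs} = Scan.runs-detach E# (λ a e c → a ∷ bs ∷ c ∷ e ∷ [])
    (λ _ _ _ → refl) (λ _ _ _ → refl) (λ _ _ _ _ → refl) (λ _ _ _ _ → refl) (λ _ _ _ _ → refl) (λ _ _ _ _ → refl) t

  main : List Token → Stacks
  main a = a ∷ [] ∷ [] ∷ [] ∷ []

  shift : Fin K → Fin K → Code
  shift i j = unload i (push j)

  runs-shift-BA : ∀ bs {as es} → Runs (shift B# A#) (as ∷ bs ∷ [] ∷ es ∷ []) (8 * length bs + 1) ((bs ʳ++ as) ∷ [] ∷ [] ∷ es ∷ [])
  runs-shift-BA bs {as} {es} = runs-unload B# (push A#) 2 (λ b a → a ∷ b ∷ [] ∷ es ∷ [])
    (λ _ _ → refl) (λ _ _ _ → refl) (λ t _ _ → runs-push A# t) bs as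

  drop# : Code
  drop# = detach B# ⨾ unload B# (λ _ → skip)

  runs-drop : ∀ t {xs} → Runs drop# (main (ser t xs)) (14 * size t + 4) (main xs)
  runs-drop t {xs} = runs-weaken (≤-reflexive (trans (cong (λ l → 7 * size t + 3 + (7 * l + 1)) (trans (length-res t []) (+-identityʳ _))) (arith (size t))))
    (runs-seq (detachB t)
      (runs-unload B# (λ _ → skip) 1 (λ b _ → xs ∷ b ∷ [] ∷ [] ∷ []) (λ _ _ → refl) (λ _ _ _ → refl) (λ _ _ _ → runs-skip) (res t []) []))
    where
    arith : ∀ a → 7 * a + 3 + (7 * a + 1) ≡ 14 * a + 4
    arith = solve-∀

  -- The trees are put back in the order in which they were set aside, which brings the second one
  -- to the top.
  swap# : Code
  swap# = detach B# ⨾ detach E# ⨾ shift B# A# ⨾ shift E# A#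

  runs-swap : ∀ t u {xs} → Runs swap# (main (ser t (ser u xs))) (15 * (size t + size u) + 8) (main (ser u (ser t xs)))
  runs-swap t u {xs} = runs-weaken (≤-reflexive (trans (cong₂ (λ l k → 7 * size t + 3 + (7 * size u + 3 + (8 * l + 1 + (8 * k + 1))))
      (trans (length-res t []) (+-identityʳ _)) (trans (length-res u []) (+-identityʳ _))) (arith (size t) (size u))))
    (runs-seq (detachB t) (runs-seq (detachE u {bs = res t []}) (runs-seq (runs-shift-BA (res t []) {xs} {res u []})
      (runs-≡ (cong (λ z → z ∷ [] ∷ [] ∷ res u [] ∷ []) (sym (res-ʳ++ t [] xs)))
              (cong main (res-ʳ++ u [] (ser t xs)))
              (runs-unload E# (push A#) 2 (λ e a → a ∷ [] ∷ [] ∷ e ∷ []) (λ _ _ → refl) (λ _ _ _ → refl)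
                           (λ t _ _ → runs-push A# t) (res u []) (ser t xs))))))
    where
    arith : ∀ a b → 7 * a + 3 + (7 * b + 3 + (8 * a + 1 + (8 * b + 1))) ≡ 15 * (a + b) + 8
    arith = solve-∀

  -- The copy on the fourth stack comes out in forward order, so it is reversed through the second
  -- stack before it is put on top.
  dup# : Code
  dup# = detach B# ⨾ unload B# (λ t → push A# t ⨾ push E# t) ⨾ shift E# B# ⨾ shift B# A#

  private
    runs-copy : ∀ bs as es → Runs (unload B# (λ t → push A# t ⨾ push E# t)) (as ∷ bs ∷ [] ∷ es ∷ [])
                (10 * length bs + 1) ((bs ʳ++ as) ∷ [] ∷ [] ∷ (bs ʳ++ es) ∷ [])
    runs-copy []       as es = runs-stop refl
    runs-copy (t ∷ bs) as es = runs-weaken (≤-reflexive (arith (length bs)))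
      (runs-loop refl
        (runs-caseTop {f = λ t → pop B# ⨾ push A# t ⨾ push E# t} refl
          (runs-seq (runs-pop B#) (runs-seq (runs-push A# t) (runs-push E# t))))
        (runs-copy bs (t ∷ as) (t ∷ es)))
      where
      arith : ∀ l → suc ((4 + (1 + (2 + 2))) + (10 * l + 1)) ≡ 10 * suc l + 1
      arith = solve-∀

    ser-ʳ++ : ∀ t r ys → ser t r ʳ++ ys ≡ r ʳ++ res t ys
    ser-ʳ++ leaf       r ys = refl
    ser-ʳ++ (node t u) r ys = trans (ser-ʳ++ t (ser u r) (b1 ∷ ys)) (ser-ʳ++ u r (res t (b1 ∷ ys)))

  runs-dup : ∀ t {xs} → Runs dup# (main (ser t xs)) (33 * size t + 6) (main (ser t (ser t xs)))
  runs-dup t {xs} = runs-weaken (≤-reflexive (trans (cong₂ (λ l k → 7 * size t + 3 + (10 * l + 1 + (8 * k + 1 + (8 * l + 1))))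
      (trans (length-res t []) (+-identityʳ _)) (trans (length-ser t []) (+-identityʳ _))) (arith (size t))))
    (runs-seq (detachB t) (runs-seq
      (runs-≡ refl (cong₂ (λ x y → x ∷ [] ∷ [] ∷ y ∷ []) (res-ʳ++ t [] xs) (res-ʳ++ t [] [])) (runs-copy (res t []) xs []))
      (runs-seq
        (runs-≡ refl (cong (λ z → ser t xs ∷ z ∷ [] ∷ [] ∷ []) (ser-ʳ++ t [] []))
          (runs-unload E# (push B#) 2 (λ e b → ser t xs ∷ b ∷ [] ∷ e ∷ []) (λ _ _ → refl) (λ _ _ _ → refl)
                       (λ t _ _ → runs-push B# t) (ser t []) []))
        (runs-≡ refl (cong main (res-ʳ++ t [] (ser t xs))) (runs-shift-BA (res t []))))))
    where
    arith : ∀ a → 7 * a + 3 + (10 * a + 1 + (8 * a + 1 + (8 * a + 1))) ≡ 33 * a + 6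
    arith = solve-∀

  pushTree : Tree → Code
  pushTree leaf       = push A# b0
  pushTree (node t u) = pushTree u ⨾ pushTree t ⨾ push A# b1

  runs-pushTree : ∀ t {xs} → Runs (pushTree t) (main xs) (2 * size t) (main (ser t xs))
  runs-pushTree leaf       = runs-push A# b0
  runs-pushTree (node t u) = runs-weaken (≤-reflexive (arith (size t) (size u)))
    (runs-seq (runs-pushTree u) (runs-seq (runs-pushTree t) (runs-push A# b1)))
    where
    arith : ∀ a b → 2 * b + (2 * a + 2) ≡ 2 * suc (a + b)
    arith = solve-∀

-- Combinators for functions computable in polynomial time.

module PolynomialTime where

  open Machine
  open Trees
  open Bounds
  open Digits
  open import Defs using (Token; end; [[; ]])
  open import Data.Bool using (Bool; true; false; if_then_else_)
  open import Data.Digit using (Bit)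
  open import Data.Fin using (zero; suc)
  open import Data.List as List using (List; []; _∷_; _++_; _ʳ++_; length; foldl; foldr; reverse; map)
  open import Data.List.Properties using (++-identityʳ; ++-assoc; ʳ++-defn; reverse-involutive; reverse-foldl)
  open import Data.Nat
  open import Data.Nat.Properties
  open import Data.Nat.Tactic.RingSolver using (solve-∀)
  open import Data.Product using (_×_; _,_; proj₁; proj₂)
  open import Data.Unit using (⊤; tt)
  open import Relation.Binary.PropositionalEquality

  record Enc (A : Set) : Set where
    field enc : A → Tree

  open Enc {{...}} public

  sz : ∀ {A} {{_ : Enc A}} → A → ℕ
  sz a = size (enc a)

  encList : ∀ {A} {{_ : Enc A}} → List A → Tree
  encList []       = leaf
  encList (x ∷ xs) = node (enc x) (encList xs)

  instance
    Enc-⊤ : Enc ⊤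
    Enc-⊤ = record { enc = λ _ → leaf }

    Enc-Bool : Enc Bool
    Enc-Bool = record { enc = λ { false → leaf ; true → node leaf leaf } }

    -- Both bits have the same size, so that the size of a number depends on its
    -- length only.
    Enc-Bit : Enc Bit
    Enc-Bit = record { enc = λ { zero → node leaf (node leaf leaf) ; (suc zero) → node (node leaf leaf) leaf } }

    Enc-× : ∀ {A B} {{_ : Enc A}} {{_ : Enc B}} → Enc (A × B)
    Enc-× = record { enc = λ (a , b) → node (enc a) (enc b) }

    Enc-List : ∀ {A} {{_ : Enc A}} → Enc (List A)
    Enc-List = record { enc = encList }

    Enc-ℕ : Enc ℕ
    Enc-ℕ = record { enc = λ n → encList (digits n) }

  -- Unary numbers turn a case distinction on tokens into nested case distinctions on lists.
  tokenRank : Token → List ⊤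
  tokenRank b0  = []
  tokenRank b1  = tt ∷ []
  tokenRank end = tt ∷ tt ∷ []
  tokenRank [[  = tt ∷ tt ∷ tt ∷ []
  tokenRank ]]  = tt ∷ tt ∷ tt ∷ tt ∷ []

  instance
    Enc-Token : Enc Token
    Enc-Token = record { enc = λ t → encList (tokenRank t) }

  size>0 : ∀ t → 1 ≤ size t
  size>0 leaf       = ≤-refl
  size>0 (node t u) = s≤s z≤n

  -- The bound on the output size is what lets costs compose; the arbitrary `rest` lets a program
  -- run on top of values that are kept for later.
  record PolyTime {A B : Set} {{EA : Enc A}} {{EB : Enc B}} (f : A → B) : Set where
    field
      code    : Code
      cost    : Bound
      growth  : Bound
      runs    : ∀ a rest → Runs code (main (ser (enc a) rest)) (cost at sz a) (main (ser (enc (f a)) rest))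
      growth≤ : ∀ a → sz (f a) ≤ growth at sz a

  open PolyTime

  module _ {A B : Set} {{_ : Enc A}} {{_ : Enc B}} where

    ext : {f g : A → B} → (∀ a → f a ≡ g a) → PolyTime f → PolyTime g
    ext eq p = record
      { code = code p ; cost = cost p ; growth = growth p
      ; runs = λ a rest → runs-≡ refl (cong (λ b → main (ser (enc b) rest)) (eq a)) (runs p a rest)
      ; growth≤ = λ a → ≤-trans (≤-reflexive (cong sz (sym (eq a)))) (growth≤ p a) }

    retype : {f : A → B} → (∀ a → enc (f a) ≡ enc a) → PolyTime f
    retype eq = record
      { code = skip ; cost = con 1 ; growth = var
      ; runs = λ a rest → runs-≡ refl (cong (λ t → main (ser t rest)) (sym (eq a))) runs-skip
      ; growth≤ = λ a → ≤-reflexive (cong size (eq a)) }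

    const∘ : (b : B) → PolyTime {A} (λ _ → b)
    const∘ b = record
      { code = drop# ⨾ pushTree (enc b) ; cost = con 14 ⊗ var ⊕ con 4 ⊕ con (2 * sz b) ; growth = con (sz b)
      ; runs = λ a rest → runs-seq (runs-drop (enc a)) (runs-pushTree (enc b))
      ; growth≤ = λ a → ≤-refl }

  id∘ : ∀ {A} {{_ : Enc A}} → PolyTime {A} (λ a → a)
  id∘ = retype (λ _ → refl)

  module _ {A B C : Set} {{_ : Enc A}} {{_ : Enc B}} {{_ : Enc C}} where

    infixr 9 _∘ᵖ_

    _∘ᵖ_ : {g : B → C} {f : A → B} → PolyTime g → PolyTime f → PolyTime (λ a → g (f a))
    _∘ᵖ_ {g} {f} q p = record
      { code = code p ⨾ code q ; cost = cost p ⊕ cost q ⊙ growth p ; growth = growth q ⊙ growth p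
      ; runs = λ a rest → runs-weaken (+-monoʳ-≤ (cost p at sz a) (at-mono (cost q) (growth≤ p a)))
                 (runs-seq (runs p a rest) (runs q (f a) rest))
      ; growth≤ = λ a → ≤-trans (growth≤ q (f a)) (at-mono (growth q) (growth≤ p a)) }

    infixr 4 _,∘_

    -- Forming the pair costs one push: `b1` in front of two consecutive trees is already the
    -- encoding of the pair.
    _,∘_ : {f : A → B} {g : A → C} → PolyTime f → PolyTime g → PolyTime (λ a → f a , g a)
    _,∘_ {f} {g} p q = record
      { code = dup# ⨾ code p ⨾ swap# ⨾ code q ⨾ swap# ⨾ push A# b1
      ; cost = con 33 ⊗ var ⊕ con 6 ⊕ (cost p ⊕ (con 15 ⊗ (growth p ⊕ var) ⊕ con 8 ⊕
                 (cost q ⊕ (con 15 ⊗ (growth q ⊕ growth p) ⊕ con 8 ⊕ con 2))))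
      ; growth = con 1 ⊕ (growth p ⊕ growth q)
      ; runs = λ a rest → runs-weaken
          (+-monoʳ-≤ (33 * sz a + 6) (+-monoʳ-≤ (cost p at sz a) (+-mono-≤
            (+-monoˡ-≤ 8 (*-monoʳ-≤ 15 (+-monoˡ-≤ (sz a) (growth≤ p a))))
            (+-monoʳ-≤ (cost q at sz a) (+-monoˡ-≤ 2 (+-monoˡ-≤ 8 (*-monoʳ-≤ 15 (+-mono-≤ (growth≤ q a) (growth≤ p a)))))))))
          (runs-seq (runs-dup (enc a)) (runs-seq (runs p a (ser (enc a) rest)) (runs-seq (runs-swap (enc (f a)) (enc a))
            (runs-seq (runs q a (ser (enc (f a)) rest)) (runs-seq (runs-swap (enc (g a)) (enc (f a))) (runs-push A# b1))))))
      ; growth≤ = λ a → s≤s (+-mono-≤ (growth≤ p a) (growth≤ q a)) }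

  module _ {A B : Set} {{_ : Enc A}} {{_ : Enc B}} where

    private
      proj₁ᵖ : PolyTime {A × B} proj₁
      proj₁ᵖ = record
        { code = pop A# ⨾ swap# ⨾ drop# ; cost = con 1 ⊕ (con 15 ⊗ var ⊕ con 8 ⊕ (con 14 ⊗ var ⊕ con 4)) ; growth = var
        ; runs = λ (a , b) rest → runs-weaken
            (s≤s (+-mono-≤ (+-monoˡ-≤ 8 (*-monoʳ-≤ 15 (n≤1+n _)))
                           (+-monoˡ-≤ 4 (*-monoʳ-≤ 14 (m≤n⇒m≤1+n (m≤n+m (sz b) (sz a)))))))
            (runs-seq (runs-pop A#) (runs-seq (runs-swap (enc a) (enc b)) (runs-drop (enc b))))
        ; growth≤ = λ (a , b) → m≤n⇒m≤1+n (m≤m+n (sz a) (sz b)) }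

      proj₂ᵖ : PolyTime {A × B} proj₂
      proj₂ᵖ = record
        { code = pop A# ⨾ drop# ; cost = con 1 ⊕ (con 14 ⊗ var ⊕ con 4) ; growth = var
        ; runs = λ (a , b) rest → runs-weaken
            (s≤s (+-monoˡ-≤ 4 (*-monoʳ-≤ 14 (m≤n⇒m≤1+n (m≤m+n (sz a) (sz b))))))
            (runs-seq (runs-pop A#) (runs-drop (enc a)))
        ; growth≤ = λ (a , b) → m≤n⇒m≤1+n (m≤n+m (sz b) (sz a)) }

    module _ {Γ : Set} {{_ : Enc Γ}} where

      fst∘ : {p : Γ → A × B} → PolyTime p → PolyTime (λ γ → proj₁ (p γ))
      fst∘ p = proj₁ᵖ ∘ᵖ p

      snd∘ : {p : Γ → A × B} → PolyTime p → PolyTime (λ γ → proj₂ (p γ))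
      snd∘ p = proj₂ᵖ ∘ᵖ p

  module _ {Γ A : Set} {{_ : Enc Γ}} {{_ : Enc A}} where

    infixr 5 _∷∘_

    _∷∘_ : {x : Γ → A} {xs : Γ → List A} → PolyTime x → PolyTime xs → PolyTime (λ γ → x γ ∷ xs γ)
    p ∷∘ q = retype {f = λ (x , xs) → x ∷ xs} (λ _ → refl) ∘ᵖ (p ,∘ q)

    []∘ : PolyTime {Γ} {List A} (λ _ → [])
    []∘ = const∘ []

  module _ {A B : Set} where

    -- An eliminator in function form, because the combinators follow the structure of terms and
    -- cannot see pattern matching.
    caseList : List A → B → (A → List A → B) → B
    caseList []       n c = n
    caseList (x ∷ xs) n c = c x xs

  module _ {Γ A B : Set} {{_ : Enc Γ}} {{_ : Enc A}} {{_ : Enc B}} where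

    let∘ : {e : Γ → A} {b : Γ × A → B} → PolyTime e → PolyTime b → PolyTime (λ γ → b (γ , e γ))
    let∘ p q = q ∘ᵖ (id∘ ,∘ p)

    private
      caseᵖ : {n : Γ → B} {c : (A × List A) × Γ → B} → PolyTime n → PolyTime c →
              PolyTime {List A × Γ} (λ (l , γ) → caseList l (n γ) (λ x xs → c ((x , xs) , γ)))
      caseᵖ {n} {c} p q = record
        -- Below the tag of the pair lies the tag of the list. In the case of a cons the pushed `b1`
        -- completes the encoding of `((x , xs) , γ)`; nothing is moved.
        { code = pop A# ⨾ ifTop A# is1 (push A# b1 ⨾ code q) (pop A# ⨾ code p)
        ; cost = con 4 ⊕ cost p ⊕ cost q ; growth = growth p ⊕ growth q
        ; runs = go
        ; growth≤ = λ { ([] , γ)     → ≤-trans (growth≤ p γ) (≤-trans (at-mono (growth p) (m≤n+m _ 2)) (m≤m+n _ _))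
                      ; (x ∷ xs , γ) → ≤-trans (growth≤ q ((x , xs) , γ)) (m≤n+m _ (growth p at sz (x ∷ xs , γ))) } }
        where
        go : ∀ a rest → Runs _ (main (ser (enc a) rest)) (4 + cost p at sz a + cost q at sz a) _
        go ([] , γ) rest = runs-weaken (s≤s (s≤s (s≤s (≤-trans (at-mono (cost p) (m≤n+m _ 2)) (≤-trans (m≤m+n _ _) (n≤1+n _))))))
          (runs-seq (runs-pop A#) (runs-else refl (runs-seq (runs-pop A#) (runs p γ rest))))
        go (x ∷ xs , γ) rest = runs-weaken (+-monoʳ-≤ 4 (m≤n+m _ (cost p at sz (x ∷ xs , γ))))
          (runs-seq (runs-pop A#) (runs-then refl (runs-seq (runs-push A# b1) (runs q ((x , xs) , γ) rest))))

    case∘ : {l : Γ → List A} {n : Γ → B} {c : (Γ × A) × List A → B} → PolyTime l → PolyTime n → PolyTime c →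
            PolyTime (λ γ → caseList (l γ) (n γ) (λ x xs → c ((γ , x) , xs)))
    case∘ {c = c} l n p = caseᵖ n (p ∘ᵖ ((snd∘ id∘ ,∘ fst∘ (fst∘ id∘)) ,∘ snd∘ (fst∘ id∘))) ∘ᵖ (l ,∘ id∘)

  module _ {Γ B : Set} {{_ : Enc Γ}} {{_ : Enc B}} where

    if∘ : {b : Γ → Bool} {t e : Γ → B} → PolyTime b → PolyTime t → PolyTime e → PolyTime (λ γ → if b γ then t γ else e γ)
    if∘ {b} {t} {e} p q r = ext (λ γ → lemma (b γ))
      (case∘ {A = ⊤} (retype {f = λ b → if b then tt ∷ [] else []} (λ { false → refl ; true → refl }) ∘ᵖ p)
             r (q ∘ᵖ fst∘ (fst∘ id∘)))
      where
      lemma : ∀ b {e t : B} → caseList (if b then tt ∷ [] else []) e (λ _ _ → t) ≡ (if b then t else e)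
      lemma false = refl
      lemma true  = refl

  length≤sz : ∀ {A} {{_ : Enc A}} (xs : List A) → length xs ≤ sz xs
  length≤sz []       = z≤n
  length≤sz (x ∷ xs) = s≤s (≤-trans (length≤sz xs) (m≤n+m _ (sz x)))

  sz-++ : ∀ {A} {{_ : Enc A}} (xs ys : List A) → suc (sz (xs ++ ys)) ≡ sz xs + sz ys
  sz-++ []       ys = refl
  sz-++ (x ∷ xs) ys = cong suc (trans (sym (+-suc (sz x) _)) (trans (cong (sz x +_) (sz-++ xs ys)) (sym (+-assoc (sz x) _ _))))

  module _ {X S : Set} {{_ : Enc X}} {{_ : Enc S}} {h : S → X → S} where

    private
      -- List and accumulator lie on the stack without the tag of their pair, so the tag of the list
      -- is on top and controls the loop; the body works with the tag put back.
      foldl-code : Code → Code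
      foldl-code c = while A# is1 (push A# b1 ⨾ c ⨾ pop A#)

      -- Every round is charged at one size `N` that bounds all intermediate states. Iterating the
      -- growth bound of the body would not stay polynomial.
      runs-foldl : (body : PolyTime {(X × List X) × S} {List X × S} (λ ((x , xs) , s) → xs , h s x)) → ∀ N xs s →
        (∀ ys zs → xs ≡ ys ++ zs → sz (zs , foldl h s ys) ≤ N) → ∀ rest →
        Runs (foldl-code (code body)) (main (ser (enc xs) (ser (enc s) rest))) (length xs * (4 + cost body at N) + 1)
             (main (b0 ∷ ser (enc (foldl h s xs)) rest))
      runs-foldl body N []       s b rest = runs-stop refl
      runs-foldl body N (x ∷ xs) s b rest = runs-weaken (≤-trans
        (≤-reflexive (arith (cost body at sz (x ∷ xs , s)) (length xs * (4 + cost body at N))))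
        (+-monoˡ-≤ 1 (+-monoˡ-≤ _ (+-monoʳ-≤ 4 (at-mono (cost body) (b [] (x ∷ xs) refl))))))
        (runs-loop refl (runs-seq (runs-push A# b1) (runs-seq (runs body ((x , xs) , s) rest) (runs-pop A#)))
          (runs-foldl body N xs (h s x) (λ ys zs eq → b (x ∷ ys) zs (cong (x ∷_) eq)) rest))
        where
        arith : ∀ c l → suc ((2 + (c + 1)) + (l + 1)) ≡ 4 + c + l + 1
        arith = solve-∀

    foldlᵖ : ∀ {Γ : Set} {{_ : Enc Γ}} {xs : Γ → List X} {s : Γ → S} → PolyTime xs → PolyTime s →
             PolyTime {S × X} (λ (s , x) → h s x) → (N : Bound) →
             (∀ γ ys zs → xs γ ≡ ys ++ zs → sz (zs , foldl h (s γ) ys) ≤ N at sz γ) →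
             PolyTime (λ γ → foldl h (s γ) (xs γ))
    foldlᵖ {Γ} {xs} {s} q r p N b = record
      { code = code start ⨾ pop A# ⨾ foldl-code (code body) ⨾ pop A#
      ; cost = cost start ⊕ (con 1 ⊕ (N ⊗ (con 4 ⊕ cost body ⊙ N) ⊕ con 1 ⊕ con 1))
      ; growth = N
      ; runs = λ γ rest → runs-weaken
          (+-monoʳ-≤ (cost start at sz γ) (s≤s (+-monoˡ-≤ 1 (+-monoˡ-≤ 1 (*-monoˡ-≤ _
            (≤-trans (length≤sz (xs γ)) (≤-trans (m≤n⇒m≤1+n (m≤m+n (sz (xs γ)) (sz (s γ)))) (b γ [] (xs γ) refl))))))))
          (runs-seq (runs start γ rest) (runs-seq (runs-pop A#)
            (runs-seq (runs-foldl body (N at sz γ) (xs γ) (s γ) (b γ) rest) (runs-pop A#))))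
      ; growth≤ = λ γ → ≤-trans (m≤n+m _ 2) (b γ (xs γ) [] (sym (++-identityʳ (xs γ)))) }
      where
      start : PolyTime (λ γ → xs γ , s γ)
      start = q ,∘ r
      body : PolyTime {(X × List X) × S} {List X × S} (λ ((x , xs) , s) → xs , h s x)
      body = snd∘ (fst∘ id∘) ,∘ p ∘ᵖ (snd∘ id∘ ,∘ fst∘ (fst∘ id∘))

  module _ {Γ X T : Set} {{_ : Enc Γ}} {{_ : Enc X}} {{_ : Enc T}} where

    private
      -- The increments of the single steps just add up, because none of them depends on the
      -- accumulator.
      foldl-growth : ∀ {h : (Γ × T) × X → T} (I : Γ → T → Set) {r} → (∀ γ t x → I γ t → I γ (h ((γ , t) , x))) →
                     (∀ γ t x → I γ t → sz (h ((γ , t) , x)) ≤ sz t + r at (sz γ + sz x)) →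
                     ∀ n γ t ys → I γ t → sz γ + sz ys ≤ n →
                     sz (foldl (λ t x → h ((γ , t) , x)) t ys) ≤ sz t + length ys * r at n
      foldl-growth         I     i a n γ t []       it le = m≤m+n (sz t) 0
      foldl-growth {h = h} I {r} i a n γ t (y ∷ ys) it le = begin
        sz (foldl _ (h ((γ , t) , y)) ys)            ≤⟨ foldl-growth {h = h} I {r} i a n γ _ ys (i γ t y it)
                                                          (≤-trans (+-monoʳ-≤ (sz γ) (m≤n⇒m≤1+n (m≤n+m _ (sz y)))) le) ⟩
        sz (h ((γ , t) , y)) + length ys * r at n    ≤⟨ +-monoˡ-≤ _ (≤-trans (a γ t y it) (+-monoʳ-≤ (sz t)
                                                          (at-mono r (≤-trans (+-monoʳ-≤ (sz γ) (m≤n⇒m≤1+n (m≤m+n (sz y) _))) le)))) ⟩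
        sz t + r at n + length ys * r at n           ≡⟨ +-assoc (sz t) _ _ ⟩
        sz t + (r at n + length ys * r at n)         ∎
        where open ≤-Reasoning

      -- The environment travels in the accumulator, since the loop body sees nothing else.
      foldl-env : ∀ (h : (Γ × T) × X → T) (γ : Γ) (t : T) (xs : List X) →
                  foldl (λ (γ , t) x → γ , h ((γ , t) , x)) (γ , t) xs ≡ (γ , foldl (λ t x → h ((γ , t) , x)) t xs)
      foldl-env h γ t []       = refl
      foldl-env h γ t (x ∷ xs) = foldl-env h γ _ xs

    -- The invariant `I` serves steps whose increment can be bounded only in the states that
    -- actually occur.
    foldl-inv∘ : {xs : Γ → List X} {t : Γ → T} {h : (Γ × T) × X → T} → PolyTime xs → PolyTime t → PolyTime h →
                 (I : Γ → T → Set) (r : Bound) → (∀ γ → I γ (t γ)) → (∀ γ t x → I γ t → I γ (h ((γ , t) , x))) →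
                 (∀ γ t x → I γ t → sz (h ((γ , t) , x)) ≤ sz t + r at (sz γ + sz x)) →
                 PolyTime (λ γ → foldl (λ t x → h ((γ , t) , x)) (t γ) (xs γ))
    foldl-inv∘ {xs} {t} {h} p q k I r init pres a = ext (λ γ → cong proj₂ (foldl-env h γ (t γ) (xs γ)))
      (snd∘ (foldlᵖ {h = λ (γ , t) x → γ , h ((γ , t) , x)} p (id∘ ,∘ q) (fst∘ (fst∘ id∘) ,∘ k) N bound))
      where
      N : Bound
      N = con 2 ⊕ growth p ⊕ var ⊕ (growth q ⊕ growth p ⊗ r ⊙ (var ⊕ growth p))
      bound : ∀ γ ys zs → xs γ ≡ ys ++ zs →
              sz (zs , foldl (λ (γ , t) x → γ , h ((γ , t) , x)) (γ , t γ) ys) ≤ N at sz γ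
      bound γ ys zs eq = begin
        sz (zs , foldl _ (γ , t γ) ys)
          ≡⟨ cong (λ s → sz (zs , s)) (foldl-env h γ (t γ) ys) ⟩
        suc (sz zs + suc (sz γ + sz (foldl _ (t γ) ys)))
          ≡⟨ cong suc (trans (+-suc (sz zs) _) (cong suc (sym (+-assoc (sz zs) (sz γ) _)))) ⟩
        2 + (sz zs + sz γ + sz (foldl _ (t γ) ys))
          ≤⟨ +-monoʳ-≤ 2 (+-mono-≤ (+-monoˡ-≤ (sz γ) z≤) (≤-trans
               (foldl-growth {h = h} I {r} pres a (sz γ + G) γ (t γ) ys (init γ) (+-monoʳ-≤ (sz γ) y≤))
               (+-mono-≤ (growth≤ q γ) (*-monoˡ-≤ _ (≤-trans (length≤sz ys) y≤))))) ⟩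
        2 + (G + sz γ + (growth q at sz γ + G * r at (sz γ + G))) ∎
        where
        open ≤-Reasoning
        G = growth p at sz γ
        sum≤ : sz ys + sz zs ≤ suc G
        sum≤ = ≤-trans (≤-reflexive (sym (sz-++ ys zs))) (s≤s (subst (λ l → sz l ≤ G) eq (growth≤ p γ)))
        z≤ : sz zs ≤ G
        z≤ = s≤s⁻¹ (≤-trans (+-monoˡ-≤ (sz zs) (size>0 (enc ys))) sum≤)
        y≤ : sz ys ≤ G
        y≤ = s≤s⁻¹ (≤-trans (≤-reflexive (+-comm 1 (sz ys))) (≤-trans (+-monoʳ-≤ (sz ys) (size>0 (enc zs))) sum≤))

    Additive : ((Γ × T) × X → T) → Bound → Set
    Additive h r = ∀ γ t x → sz (h ((γ , t) , x)) ≤ sz t + r at (sz γ + sz x)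

    foldl∘ : {xs : Γ → List X} {t : Γ → T} {h : (Γ × T) × X → T} → PolyTime xs → PolyTime t → PolyTime h →
             (r : Bound) → Additive h r → PolyTime (λ γ → foldl (λ t x → h ((γ , t) , x)) (t γ) (xs γ))
    foldl∘ p q k r a = foldl-inv∘ p q k (λ _ _ → ⊤) r _ _ (λ γ t x _ → a γ t x)

  module _ {Γ X : Set} {{_ : Enc Γ}} {{_ : Enc X}} where

    private
      consʳ : PolyTime {(Γ × List X) × X} (λ ((γ , ys) , y) → y ∷ ys)
      consʳ = snd∘ id∘ ∷∘ snd∘ (fst∘ id∘)

      consʳ-additive : Additive {Γ} {X} {List X} (λ ((γ , ys) , y) → y ∷ ys) (var ⊕ con 1)
      consʳ-additive γ ys y = ≤-trans (≤-reflexive (arith (sz y) (sz ys)))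
        (+-monoʳ-≤ (sz ys) (+-monoˡ-≤ 1 (m≤n+m (sz y) (sz γ))))
        where
        arith : ∀ a b → suc (a + b) ≡ b + (a + 1)
        arith = solve-∀

    reverse∘ : {xs : Γ → List X} → PolyTime xs → PolyTime (λ γ → reverse (xs γ))
    reverse∘ p = foldl∘ p []∘ consʳ (var ⊕ con 1) consʳ-additive

    infixr 5 _++∘_

    _++∘_ : {xs ys : Γ → List X} → PolyTime xs → PolyTime ys → PolyTime (λ γ → xs γ ++ ys γ)
    _++∘_ {xs} {ys} p q = ext (λ γ → trans (ʳ++-defn (reverse (xs γ))) (cong (_++ ys γ) (reverse-involutive (xs γ))))
      (foldl∘ (reverse∘ p) q consʳ (var ⊕ con 1) consʳ-additive)

  module _ {Γ X T : Set} {{_ : Enc Γ}} {{_ : Enc X}} {{_ : Enc T}} where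

    foldr∘ : {xs : Γ → List X} {t : Γ → T} {h : (Γ × T) × X → T} → PolyTime xs → PolyTime t → PolyTime h →
             (r : Bound) → Additive h r → PolyTime (λ γ → foldr (λ x t → h ((γ , t) , x)) (t γ) (xs γ))
    foldr∘ {xs} p q k r a = ext (λ γ → reverse-foldl _ _ (xs γ)) (foldl∘ (reverse∘ p) q k r a)

  module _ {Γ X Y : Set} {{_ : Enc Γ}} {{_ : Enc X}} {{_ : Enc Y}} where

    map∘ : {f : Γ × X → Y} {xs : Γ → List X} → PolyTime f → PolyTime xs → PolyTime (λ γ → map (λ x → f (γ , x)) (xs γ))
    map∘ {f} {xs} p q = ext (λ γ → lemma γ (xs γ))
      (reverse∘ (foldl∘ q []∘ (p ∘ᵖ (fst∘ (fst∘ id∘) ,∘ snd∘ id∘) ∷∘ snd∘ (fst∘ id∘)) (growth p ⊙ (con 1 ⊕ var) ⊕ con 1) additive))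
      where
      additive : Additive {Γ} {X} {List Y} (λ ((γ , ys) , x) → f (γ , x) ∷ ys) (growth p ⊙ (con 1 ⊕ var) ⊕ con 1)
      additive γ ys x = ≤-trans (s≤s (+-monoˡ-≤ (sz ys) (growth≤ p (γ , x)))) (≤-reflexive (arith _ (sz ys)))
        where
        arith : ∀ a b → suc (a + b) ≡ b + (a + 1)
        arith = solve-∀
      foldl-map : ∀ γ xs ys → foldl (λ ys x → f (γ , x) ∷ ys) ys xs ≡ map (λ x → f (γ , x)) xs ʳ++ ys
      foldl-map γ []       ys = refl
      foldl-map γ (x ∷ xs) ys = foldl-map γ xs _
      lemma : ∀ γ xs → reverse (foldl (λ ys x → f (γ , x) ∷ ys) [] xs) ≡ map (λ x → f (γ , x)) xs
      lemma γ xs = trans (cong reverse (foldl-map γ xs [])) (reverse-involutive _)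

    concatMap∘ : {f : Γ × X → List Y} {xs : Γ → List X} → PolyTime f → PolyTime xs →
                 PolyTime (λ γ → List.concatMap (λ x → f (γ , x)) (xs γ))
    concatMap∘ {f} {xs} p q = ext (λ γ → lemma γ (xs γ) [])
      (foldl∘ q []∘ (snd∘ (fst∘ id∘) ++∘ p ∘ᵖ (fst∘ (fst∘ id∘) ,∘ snd∘ id∘)) (growth p ⊙ (con 1 ⊕ var)) additive)
      where
      additive : Additive {Γ} {X} {List Y} (λ ((γ , ys) , x) → ys ++ f (γ , x)) (growth p ⊙ (con 1 ⊕ var))
      additive γ ys x = ≤-trans (n≤1+n _) (≤-trans (≤-reflexive (sz-++ ys _)) (+-monoʳ-≤ (sz ys) (growth≤ p (γ , x))))
      lemma : ∀ γ xs ys → foldl (λ ys x → ys ++ f (γ , x)) ys xs ≡ ys ++ List.concatMap (λ x → f (γ , x)) xs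
      lemma γ []       ys = sym (++-identityʳ ys)
      lemma γ (x ∷ xs) ys = trans (lemma γ xs (ys ++ f (γ , x))) (++-assoc ys (f (γ , x)) _)

-- Conversion between raw strings and encoded token lists.

module InOut where

  open Machine
  open Trees
  open Bounds
  open PolynomialTime
  open import Defs using (Token; end; [[; ]]; TM; Computes_↦_In_Steps)
  open import Data.Fin using (suc)
  open import Data.List as List using (List; []; _∷_; _ʳ++_; length; reverse)
  open import Data.List.Properties using (length-reverse; ʳ++-defn; reverse-involutive; ++-identityʳ)
  open import Data.Nat
  open import Data.Nat.Properties
  open import Data.Nat.Tactic.RingSolver using (solve-∀)
  open import Data.Product using (∃-syntax; _×_; _,_)
  open import Data.Vec using ([]; _∷_)
  open import Relation.Binary.PropositionalEquality

  private
    token-size : (t : Token) → sz t ≤ 9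
    token-size b0  = s≤s z≤n
    token-size b1  = s≤s (s≤s (s≤s z≤n))
    token-size end = s≤s (s≤s (s≤s (s≤s (s≤s z≤n))))
    token-size [[  = s≤s (s≤s (s≤s (s≤s (s≤s (s≤s (s≤s z≤n))))))
    token-size ]]  = ≤-refl

    tokens-size : (ts : List Token) → sz ts ≤ 10 * length ts + 1
    tokens-size []       = ≤-refl
    tokens-size (t ∷ ts) = ≤-trans (s≤s (+-mono-≤ (token-size t) (tokens-size ts))) (≤-reflexive (arith (length ts)))
      where
      arith : ∀ l → suc (9 + (10 * l + 1)) ≡ 10 * suc l + 1
      arith = solve-∀

    -- The string is reversed first, so that the encoded list can be built from its end.
    read : Code
    read = shift A# B# ⨾ push A# b0 ⨾ unload B# (λ t → pushTree (enc t) ⨾ push A# b1)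

    runs-read : ∀ xs → Runs read (main xs) (34 * length xs + 4) (main (ser (enc xs) []))
    runs-read xs = runs-weaken (≤-reflexive (trans (cong (λ l → 8 * length xs + 1 + (2 + (26 * l + 1))) (length-reverse xs)) (arith (length xs))))
      (runs-seq (runs-unload A# (push B#) 2 (λ a b → a ∷ b ∷ [] ∷ [] ∷ []) (λ _ _ → refl) (λ _ _ _ → refl) (λ t _ _ → runs-push B# t) xs [])
      (runs-seq (runs-push A# b0)
      (runs-≡ refl (cong (λ z → main (ser (enc z) [])) (trans (ʳ++-defn (reverse xs)) (trans (++-identityʳ _) (reverse-involutive xs))))
        (runs-unload B# (λ t → pushTree (enc t) ⨾ push A# b1) 20 (λ b ys → ser (enc ys) [] ∷ b ∷ [] ∷ [] ∷ [])
          (λ _ _ → refl) (λ _ _ _ → refl) pushed (reverse xs) []))))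
      where
      arith : ∀ l → 8 * l + 1 + (2 + (26 * l + 1)) ≡ 34 * l + 4
      arith = solve-∀
      pushed : ∀ t b ys → Runs (pushTree (enc t) ⨾ push A# b1) (ser (enc ys) [] ∷ b ∷ [] ∷ [] ∷ []) 20 (ser (enc (t ∷ ys)) [] ∷ b ∷ [] ∷ [] ∷ [])
      pushed t b ys = runs-weaken (+-monoˡ-≤ 2 (*-monoʳ-≤ 2 (token-size t))) (runs-seq (pushTree′ (enc t)) (runs-push A# b1))
        where
        pushTree′ : ∀ t {xs} → Runs (pushTree t) (xs ∷ b ∷ [] ∷ [] ∷ []) (2 * size t) (ser t xs ∷ b ∷ [] ∷ [] ∷ [])
        pushTree′ leaf       = runs-push A# b0
        pushTree′ (node t u) = runs-weaken (≤-reflexive (arith′ (size t) (size u)))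
          (runs-seq (pushTree′ u) (runs-seq (pushTree′ t) (runs-push A# b1)))
          where
          arith′ : ∀ a b → 2 * b + (2 * a + 2) ≡ 2 * suc (a + b)
          arith′ = solve-∀

    emit : Token → Code
    emit t = pop A# ⨾ push B# t

    emit-or : Token → Code → Code
    emit-or t c = ifTop A# is1 (pop A# ⨾ pop A# ⨾ c) (emit t)

    -- A token is a list of units, each written `b1` followed by `b0`. Counting off such pairs
    -- identifies the token; after four of them only `]]` remains.
    decode : Code
    decode = emit-or b0 (emit-or b1 (emit-or end (emit-or [[ (emit ]]))))

    runs-emit : ∀ t {xs bs} → Runs (emit t) ((b0 ∷ xs) ∷ bs ∷ [] ∷ [] ∷ []) 3 (xs ∷ (t ∷ bs) ∷ [] ∷ [] ∷ [])
    runs-emit t = runs-seq (runs-pop A#) (runs-push B# t)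

    runs-or : ∀ {t c xs bs n ss} → Runs c (xs ∷ bs ∷ [] ∷ [] ∷ []) n ss →
              Runs (emit-or t c) ((b1 ∷ b0 ∷ xs) ∷ bs ∷ [] ∷ [] ∷ []) (3 + n) ss
    runs-or r = runs-then refl (runs-seq (runs-pop A#) (runs-seq (runs-pop A#) r))

    runs-decode : ∀ t xs bs → Runs decode (ser (enc t) xs ∷ bs ∷ [] ∷ [] ∷ []) 16 (xs ∷ (t ∷ bs) ∷ [] ∷ [] ∷ [])
    runs-decode b0  xs bs = runs-weaken (m≤m+n 4 _)  (runs-else refl (runs-emit b0))
    runs-decode b1  xs bs = runs-weaken (m≤m+n 7 _)  (runs-or (runs-else refl (runs-emit b1)))
    runs-decode end xs bs = runs-weaken (m≤m+n 10 _) (runs-or (runs-or (runs-else refl (runs-emit end))))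
    runs-decode [[  xs bs = runs-weaken (m≤m+n 13 _) (runs-or (runs-or (runs-or (runs-else refl (runs-emit [[)))))
    runs-decode ]]  xs bs = runs-weaken (m≤m+n 15 _) (runs-or (runs-or (runs-or (runs-or (runs-emit ]])))))

    decodeAll : Code
    decodeAll = while A# is1 (pop A# ⨾ decode)

    runs-decodeAll : ∀ ys bs → Runs decodeAll (ser (enc ys) [] ∷ bs ∷ [] ∷ [] ∷ []) (18 * length ys + 1)
                                              ((b0 ∷ []) ∷ (ys ʳ++ bs) ∷ [] ∷ [] ∷ [])
    runs-decodeAll []       bs = runs-stop refl
    runs-decodeAll (y ∷ ys) bs = runs-weaken (≤-reflexive (arith (length ys)))
      (runs-loop refl (runs-seq (runs-pop A#) (runs-decode y _ bs)) (runs-decodeAll ys (y ∷ bs)))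
      where
      arith : ∀ l → suc (17 + (18 * l + 1)) ≡ 18 * suc l + 1
      arith = solve-∀

    write : Code
    write = decodeAll ⨾ pop A# ⨾ shift B# A#

    runs-write : ∀ ys → Runs write (main (ser (enc ys) [])) (26 * length ys + 3) (main ys)
    runs-write ys = runs-weaken (≤-reflexive (trans (cong (λ l → 18 * length ys + 1 + (1 + (8 * l + 1))) (length-reverse ys)) (arith (length ys))))
      (runs-seq (runs-decodeAll ys []) (runs-seq (runs-pop A#)
        (runs-≡ refl (cong main (trans (ʳ++-defn (reverse ys)) (trans (++-identityʳ _) (reverse-involutive ys)))) (runs-shift-BA (reverse ys)))))
      where
      arith : ∀ l → 18 * l + 1 + (1 + (8 * l + 1)) ≡ 26 * l + 3
      arith = solve-∀

  machine : ∀ {f : List Token → List Token} → PolyTime f → TM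
  machine p = compile (read ⨾ PolyTime.code p ⨾ write)

  machine-correct : ∀ {f : List Token → List Token} (p : PolyTime f) → ∃[ q ] ∀ xs →
                    ∃[ t ] t ≤ q at length xs × Computes_↦_In_Steps (machine p) xs (f xs) t
  machine-correct {f} p = con 34 ⊗ var ⊕ con 4 ⊕ (cost ⊙ s ⊕ (con 26 ⊗ (growth ⊙ s) ⊕ con 3)) , λ xs →
    runs⇒computes {ss = [] ∷ [] ∷ [] ∷ []} (runs-weaken
      (+-monoʳ-≤ (34 * length xs + 4) (+-mono-≤ (at-mono cost (tokens-size xs))
        (+-monoˡ-≤ 3 (*-monoʳ-≤ 26 (≤-trans (length≤sz (f xs)) (≤-trans (growth≤ xs) (at-mono growth (tokens-size xs))))))))
      (runs-seq (runs-read xs) (runs-seq (runs xs []) (runs-write (f xs)))))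
    where
    open PolynomialTime.PolyTime p
    s = con 10 ⊗ var ⊕ con 1

-- Polynomial-time arithmetic on binary numbers.

module Arith where

  open Bounds
  open Trees using (size)
  open PolynomialTime
  open Digits
  open import Data.Bool using (Bool; true; false; if_then_else_; T)
  open import Data.Digit using (Bit; fromDigits)
  open import Data.Fin using (zero; suc; toℕ)
  open import Data.List as List using (List; []; _∷_; _++_; foldl; length; reverse)
  open import Data.List.Properties using (length-++; reverse-foldr)
  open import Data.Nat
  open import Data.Nat.DivMod
  open import Data.Nat.Properties
  open import Data.Nat.Tactic.RingSolver using (solve-∀)
  open import Data.Product using (_×_; _,_; proj₁; proj₂)
  open import Relation.Binary.PropositionalEquality
  open import Relation.Nullary using (contradiction)

  open PolynomialTime.PolyTime

  -- A program sees encodings only, so a number may be processed as its list of digits and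
  -- conversely.
  recode : ∀ {A B C : Set} {{_ : Enc A}} {{_ : Enc B}} {{_ : Enc C}} {f : A → B} {g : A → C} →
           (∀ a → enc (f a) ≡ enc (g a)) → PolyTime f → PolyTime g
  recode eq p = record
    { code = code p ; cost = cost p ; growth = growth p
    ; runs = λ a rest → Trees.runs-≡ refl (cong (λ t → Trees.main (Trees.ser t rest)) (eq a)) (runs p a rest)
    ; growth≤ = λ a → ≤-trans (≤-reflexive (cong size (sym (eq a)))) (growth≤ p a) }

  bool : Bool → ℕ
  bool false = 0
  bool true  = 1

  infixr 5 _∷ᵇ_

  _∷ᵇ_ : Bool → ℕ → ℕ
  b ∷ᵇ n = bool b + n * 2

  isOne : Bit → Bool
  isOne zero       = false
  isOne (suc zero) = true

  odd : ℕ → Bool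
  odd n = isOne (n mod 2)

  half : ℕ → ℕ
  half n = n / 2

  private
    bitOf : Bool → Bit
    bitOf false = zero
    bitOf true  = suc zero

    toℕ-bitOf : ∀ b → toℕ (bitOf b) ≡ bool b
    toℕ-bitOf false = refl
    toℕ-bitOf true  = refl

    bitOf-isOne : ∀ b → bitOf (isOne b) ≡ b
    bitOf-isOne zero       = refl
    bitOf-isOne (suc zero) = refl

  odd∷half : ∀ n → n ≡ odd n ∷ᵇ half n
  odd∷half n = trans (DivMod.property (n divMod 2))
    (cong (_+ half n * 2) (trans (cong toℕ (sym (bitOf-isOne (n mod 2)))) (toℕ-bitOf (odd n))))

  ∷ᵇ-injective : ∀ a b m n → a ∷ᵇ m ≡ b ∷ᵇ n → a ≡ b × m ≡ n
  ∷ᵇ-injective false false m n eq = refl , *-cancelʳ-≡ m n 2 eq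
  ∷ᵇ-injective true  true  m n eq = refl , *-cancelʳ-≡ m n 2 (suc-injective eq)
  ∷ᵇ-injective false true  m n eq with () ← proj₁ (divMod-unique zero (suc zero) m n eq)
  ∷ᵇ-injective true  false m n eq with () ← proj₁ (divMod-unique (suc zero) zero m n eq)

  odd-∷ᵇ : ∀ b n → odd (b ∷ᵇ n) ≡ b
  odd-∷ᵇ b n = sym (proj₁ (∷ᵇ-injective b (odd (b ∷ᵇ n)) n (half (b ∷ᵇ n)) (odd∷half (b ∷ᵇ n))))

  half-∷ᵇ : ∀ b n → half (b ∷ᵇ n) ≡ n
  half-∷ᵇ b n = sym (proj₂ (∷ᵇ-injective b (odd (b ∷ᵇ n)) n (half (b ∷ᵇ n)) (odd∷half (b ∷ᵇ n))))

  private
    digits-single : ∀ b → digits (b ∷ᵇ 0) ≡ bitOf b ∷ []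
    digits-single false = digits-bit zero
    digits-single true  = digits-bit (suc zero)

    digits-cons : ∀ b n → digits (b ∷ᵇ suc n) ≡ bitOf b ∷ digits (suc n)
    digits-cons false n = digits-∷ zero n
    digits-cons true  n = digits-∷ (suc zero) n

  -- 0 has one digit.
  len : ℕ → ℕ
  len n = length (digits n)

  len>0 : ∀ n → 1 ≤ len n
  len>0 n = subst (λ n → 1 ≤ len n) (sym (odd∷half n)) (go (odd n) (half n))
    where
    go : ∀ b m → 1 ≤ len (b ∷ᵇ m)
    go b zero    rewrite digits-single b = ≤-refl
    go b (suc m) rewrite digits-cons b m = s≤s z≤n

  <2^len : ∀ n → n < 2 ^ len n
  <2^len n = subst (_< 2 ^ len n) (fromDigits-digits n) (go (digits n))
    where
    go : (ds : List Bit) → fromDigits ds < 2 ^ length ds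
    go []       = s≤s z≤n
    go (d ∷ ds) = begin-strict
      toℕ d + fromDigits ds * 2   <⟨ +-monoˡ-< (fromDigits ds * 2) (d<2 d) ⟩
      suc (fromDigits ds) * 2     ≤⟨ *-monoˡ-≤ 2 (go ds) ⟩
      2 ^ length ds * 2           ≡⟨ *-comm (2 ^ length ds) 2 ⟩
      2 * 2 ^ length ds           ∎
      where
      open ≤-Reasoning
      d<2 : (d : Bit) → toℕ d < 2
      d<2 zero       = s≤s z≤n
      d<2 (suc zero) = s≤s (s≤s z≤n)

  n≤b∷ᵇn : ∀ b n → n * 2 ≤ b ∷ᵇ n
  n≤b∷ᵇn b n = m≤n+m (n * 2) (bool b)

  len-minimal : ∀ l n → n < 2 ^ suc l → len n ≤ suc l
  len-minimal l n n< = subst (λ n → len n ≤ suc l) (sym (odd∷half n)) (go l (odd n) (half n) (subst (_< 2 ^ suc l) (odd∷half n) n<))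
    where
    go : ∀ l b m → b ∷ᵇ m < 2 ^ suc l → len (b ∷ᵇ m) ≤ suc l
    go l b zero    lt rewrite digits-single b = s≤s z≤n
    go zero b (suc m) lt = contradiction (≤-trans (s≤s (n≤b∷ᵇn b (suc m))) lt) (λ { (s≤s (s≤s ())) })
    go (suc l) b (suc m) lt rewrite digits-cons b m = s≤s (len-minimal l (suc m)
      (*-cancelʳ-< 2 (suc m) (2 ^ suc l) (≤-<-trans (n≤b∷ᵇn b (suc m)) (subst (b ∷ᵇ suc m <_) (*-comm 2 (2 ^ suc l)) lt))))

  len-bound : ∀ {l n} → 1 ≤ l → n < 2 ^ l → len n ≤ l
  len-bound {suc l} {n} _ lt = len-minimal l n lt

  sz-len : ∀ n → sz n ≡ 6 * len n + 1
  sz-len n = go (digits n)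
    where
    bit-size : (b : Bit) → sz b ≡ 5
    bit-size zero       = refl
    bit-size (suc zero) = refl
    go : (ds : List Bit) → size (encList ds) ≡ 6 * length ds + 1
    go []       = refl
    go (d ∷ ds) = trans (cong₂ (λ a b → suc (a + b)) (bit-size d) (go ds)) (arith (length ds))
      where
      arith : ∀ l → suc (5 + (6 * l + 1)) ≡ 6 * suc l + 1
      arith = solve-∀

  sz-≤ : ∀ {m n} → len m ≤ len n → sz m ≤ sz n
  sz-≤ {m} {n} le = subst₂ _≤_ (sym (sz-len m)) (sym (sz-len n)) (+-monoˡ-≤ 1 (*-monoʳ-≤ 6 le))

  sz-mono : ∀ {m n} → m ≤ n → sz m ≤ sz n
  sz-mono {m} {n} m≤n = sz-≤ {m} {n} (len-bound (len>0 n) (≤-<-trans m≤n (<2^len n)))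

  private
    2≤2^ : ∀ {a} → 1 ≤ a → 2 ≤ 2 ^ a
    2≤2^ {suc a} _ = *-monoʳ-≤ 2 {1} {2 ^ a} (m^n>0 2 a)

    m+n≤m*n : ∀ m n → 2 ≤ m → 2 ≤ n → m + n ≤ m * n
    m+n≤m*n (suc (suc m)) (suc (suc n)) _ _ = ≤-trans (m≤m+n _ (m + (n + m * n))) (≤-reflexive (arith m n))
      where
      arith : ∀ m n → (2 + m + (2 + n)) + (m + (n + m * n)) ≡ (2 + m) * (2 + n)
      arith = solve-∀
    m+n≤m*n (suc zero) _ (s≤s ()) _
    m+n≤m*n (suc (suc m)) (suc zero) _ (s≤s ())

    -- Both powers 2 ^ `len` are at least 2, hence their sum is at most their product; this avoids
    -- an additive constant.
    len-+ : ∀ m n → len (m + n) ≤ len m + len n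
    len-+ m n = len-bound (≤-trans (len>0 m) (m≤m+n _ _)) (begin-strict
      m + n                     <⟨ +-mono-< (<2^len m) (<2^len n) ⟩
      2 ^ len m + 2 ^ len n     ≤⟨ m+n≤m*n (2 ^ len m) (2 ^ len n) (2≤2^ (len>0 m)) (2≤2^ (len>0 n)) ⟩
      2 ^ len m * 2 ^ len n     ≡⟨ sym (^-distribˡ-+-* 2 (len m) (len n)) ⟩
      2 ^ (len m + len n)       ∎)
      where open ≤-Reasoning

  sz-+ : ∀ m n → sz (m + n) ≤ sz m + sz n
  sz-+ m n = begin
    sz (m + n)                            ≡⟨ sz-len (m + n) ⟩
    6 * len (m + n) + 1                   ≤⟨ +-monoˡ-≤ 1 (*-monoʳ-≤ 6 (len-+ m n)) ⟩
    6 * (len m + len n) + 1               ≤⟨ n≤1+n _ ⟩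
    suc (6 * (len m + len n) + 1)         ≡⟨ arith (len m) (len n) ⟩
    (6 * len m + 1) + (6 * len n + 1)     ≡⟨ sym (cong₂ _+_ (sz-len m) (sz-len n)) ⟩
    sz m + sz n                           ∎
    where
    open ≤-Reasoning
    arith : ∀ a b → suc (6 * (a + b) + 1) ≡ (6 * a + 1) + (6 * b + 1)
    arith = solve-∀

  sz-∷ᵇ : ∀ b n → sz (b ∷ᵇ n) ≤ sz n + 6
  sz-∷ᵇ b n = begin
    sz (b ∷ᵇ n)           ≡⟨ sz-len (b ∷ᵇ n) ⟩
    6 * len (b ∷ᵇ n) + 1  ≤⟨ +-monoˡ-≤ 1 (*-monoʳ-≤ 6 (lemma n)) ⟩
    6 * suc (len n) + 1   ≡⟨ arith (len n) ⟩
    6 * len n + 1 + 6     ≡⟨ cong (_+ 6) (sym (sz-len n)) ⟩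
    sz n + 6              ∎
    where
    open ≤-Reasoning
    lemma : ∀ n → len (b ∷ᵇ n) ≤ suc (len n)
    lemma zero    rewrite digits-single b = s≤s z≤n
    lemma (suc n) rewrite digits-cons b n = ≤-refl
    arith : ∀ l → 6 * suc l + 1 ≡ 6 * l + 1 + 6
    arith = solve-∀

  sz-half : ∀ n → sz (half n) ≤ sz n
  sz-half n = sz-mono (m/n≤m n 2)

  sz-bool : ∀ (b : Bool) → sz b ≤ 3
  sz-bool false = s≤s z≤n
  sz-bool true  = ≤-refl

  private
    nonempty : ∀ n {A : Set} {a b : A} → caseList (digits n) a (λ _ _ → b) ≡ b
    nonempty n with digits n | len>0 n
    ... | d ∷ ds | _ = refl

  module _ {Γ : Set} {{_ : Enc Γ}} where

    digits∘ : {f : Γ → ℕ} → PolyTime f → PolyTime (λ γ → digits (f γ))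
    digits∘ {f} p = recode {f = f} {g = λ γ → digits (f γ)} (λ _ → refl) p

    -- The encoding of a bit is also that of the pair of its value and its complement, so a
    -- projection reads it.
    isOne∘ : {f : Γ → Bit} → PolyTime f → PolyTime (λ γ → isOne (f γ))
    isOne∘ {f} p = fst∘ (recode {C = Bool × Bool} {g = λ γ → isOne (f γ) , flip (isOne (f γ))} (λ γ → lemma (f γ)) p)
      where
      flip : Bool → Bool
      flip b = if b then false else true
      lemma : (b : Bit) → enc b ≡ enc (isOne b , flip (isOne b))
      lemma zero       = refl
      lemma (suc zero) = refl

  module _ {Γ : Set} {{_ : Enc Γ}} where

    private
      bitOf∘ : {f : Γ → Bool} → PolyTime f → PolyTime (λ γ → bitOf (f γ))
      bitOf∘ {f} p = ext (λ γ → lemma (f γ)) (if∘ p (const∘ (suc zero)) (const∘ zero))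
        where
        lemma : ∀ b → (if b then suc zero else zero) ≡ bitOf b
        lemma false = refl
        lemma true  = refl

      isZeroᵈ : List Bit → Bool
      isZeroᵈ ds = caseList ds true λ d ds → caseList ds (if isOne d then false else true) λ _ _ → false

      isZeroᵈ∘ : {f : Γ → List Bit} → PolyTime f → PolyTime (λ γ → isZeroᵈ (f γ))
      isZeroᵈ∘ p = case∘ p (const∘ true) (case∘ (snd∘ id∘)
        (if∘ (isOne∘ (snd∘ (fst∘ id∘))) (const∘ false) (const∘ true)) (const∘ false))

      isZeroᵈ-digits : ∀ n → isZeroᵈ (digits n) ≡ (n ≡ᵇ 0)
      isZeroᵈ-digits n = subst (λ n → isZeroᵈ (digits n) ≡ (n ≡ᵇ 0)) (sym (odd∷half n)) (go (odd n) (half n))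
        where
        go : ∀ b m → isZeroᵈ (digits (b ∷ᵇ m)) ≡ ((b ∷ᵇ m) ≡ᵇ 0)
        go false zero    = cong isZeroᵈ (digits-single false)
        go true  zero    = cong isZeroᵈ (digits-single true)
        go false (suc m) rewrite digits-cons false m = nonempty (suc m)
        go true  (suc m) rewrite digits-cons true m  = nonempty (suc m)

    opaque
      isZero∘ : {f : Γ → ℕ} → PolyTime f → PolyTime (λ γ → f γ ≡ᵇ 0)
      isZero∘ {f} p = ext (λ γ → isZeroᵈ-digits (f γ)) (isZeroᵈ∘ (digits∘ p))

    opaque
      -- The test for 0 prevents a leading zero.
      _∷ᵇ∘_ : {b : Γ → Bool} {n : Γ → ℕ} → PolyTime b → PolyTime n → PolyTime (λ γ → b γ ∷ᵇ n γ)
      _∷ᵇ∘_ {b} {n} p q = recode (λ γ → cong encList (lemma (b γ) (n γ))) (if∘ (isZero∘ q) (bitOf∘ p ∷∘ []∘) (bitOf∘ p ∷∘ digits∘ q))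
        where
        lemma : ∀ b n → (if n ≡ᵇ 0 then bitOf b ∷ [] else bitOf b ∷ digits n) ≡ digits (b ∷ᵇ n)
        lemma b zero    = sym (digits-single b)
        lemma b (suc n) = sym (digits-cons b n)

    opaque
      odd∘ : {n : Γ → ℕ} → PolyTime n → PolyTime (λ γ → odd (n γ))
      odd∘ {n} p = ext (λ γ → lemma (n γ)) (isOne∘ (case∘ (digits∘ p) (const∘ zero) (snd∘ (fst∘ id∘))))
        where
        isOne-bitOf : ∀ b → isOne (bitOf b) ≡ b
        isOne-bitOf false = refl
        isOne-bitOf true  = refl
        go : ∀ b m → isOne (caseList (digits (b ∷ᵇ m)) zero (λ d _ → d)) ≡ odd (b ∷ᵇ m)
        go b zero    rewrite digits-single b = trans (isOne-bitOf b) (sym (odd-∷ᵇ b 0))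
        go b (suc m) rewrite digits-cons b m = trans (isOne-bitOf b) (sym (odd-∷ᵇ b (suc m)))
        lemma : ∀ n → isOne (caseList (digits n) zero (λ d _ → d)) ≡ odd n
        lemma n = subst (λ n → isOne (caseList (digits n) zero (λ d _ → d)) ≡ odd n) (sym (odd∷half n)) (go (odd n) (half n))

    opaque
      -- Removing the only digit has to leave the digits of 0, which are not the empty list.
      half∘ : {n : Γ → ℕ} → PolyTime n → PolyTime (λ γ → half (n γ))
      half∘ {n} p = recode (λ γ → cong encList (lemma (n γ)))
        (case∘ (digits∘ p) []∘ (case∘ (snd∘ id∘) (const∘ (zero ∷ [])) (snd∘ (fst∘ (fst∘ id∘)))))
        where
        tailᵈ : List Bit → List Bit
        tailᵈ ds = caseList ds [] λ d ds → caseList ds (zero ∷ []) λ _ _ → ds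
        go : ∀ b m → tailᵈ (digits (b ∷ᵇ m)) ≡ digits (half (b ∷ᵇ m))
        go b zero    rewrite digits-single b | half-∷ᵇ b 0 = sym (digits-bit zero)
        go b (suc m) rewrite digits-cons b m | half-∷ᵇ b (suc m) = nonempty (suc m)
        lemma : ∀ n → tailᵈ (digits n) ≡ digits (half n)
        lemma n = subst (λ n → tailᵈ (digits n) ≡ digits (half n)) (sym (odd∷half n)) (go (odd n) (half n))

  private
    xor maj : Bool → Bool → Bool → Bool
    xor a b c = if a then (if b then c else (if c then false else true)) else (if b then (if c then false else true) else c)
    maj a b c = if a then (if b then true else c) else (if b then c else false)

    full-adder : ∀ a b c → bool a + bool b + bool c ≡ xor a b c ∷ᵇ bool (maj a b c)
    full-adder false false false = refl
    full-adder false false true  = refl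
    full-adder false true  false = refl
    full-adder false true  true  = refl
    full-adder true  false false = refl
    full-adder true  false true  = refl
    full-adder true  true  false = refl
    full-adder true  true  true  = refl

    Adder : Set
    Adder = ((ℕ × ℕ) × Bool) × List Bool

    add-step : Adder → Adder
    add-step (((x , y) , c) , out) =
      ((half x , half y) , maj (odd x) (odd y) c) , xor (odd x) (odd y) c ∷ out

    rebuild : ℕ → List Bool → ℕ
    rebuild = foldl (λ n b → b ∷ᵇ n)

    pending : ((ℕ × ℕ) × Bool) → ℕ
    pending ((x , y) , c) = x + y + bool c

    -- One column of written addition: the amount still to be added loses its last binary digit to
    -- the output.
    pending-step : ∀ x y c → x + y + bool c ≡ xor (odd x) (odd y) c ∷ᵇ (half x + half y + bool (maj (odd x) (odd y) c))
    pending-step x y c = begin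
      x + y + bool c
        ≡⟨ cong₂ (λ x y → x + y + bool c) (odd∷half x) (odd∷half y) ⟩
      (bool (odd x) + half x * 2) + (bool (odd y) + half y * 2) + bool c
        ≡⟨ arith (bool (odd x)) (half x) (bool (odd y)) (half y) (bool c) ⟩
      (bool (odd x) + bool (odd y) + bool c) + (half x + half y) * 2
        ≡⟨ cong (_+ (half x + half y) * 2) (full-adder (odd x) (odd y) c) ⟩
      (bool s + bool m * 2) + (half x + half y) * 2
        ≡⟨ arith′ (bool s) (bool m) (half x + half y) ⟩
      bool s + (half x + half y + bool m) * 2 ∎
      where
      open ≡-Reasoning
      s = xor (odd x) (odd y) c
      m = maj (odd x) (odd y) c
      arith : ∀ a b c d e → (a + b * 2) + (c + d * 2) + e ≡ (a + c + e) + (b + d) * 2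
      arith = solve-∀
      arith′ : ∀ a b c → (a + b * 2) + c * 2 ≡ a + (c + b) * 2
      arith′ = solve-∀

    -- The invariant is that the pending sum, followed by the digits already put out, forms the
    -- result. The list is only a clock, long enough for the pending sum to reach 0.
    add-run : ∀ {X : Set} (l : List X) st out → pending st < 2 ^ length l →
              rebuild 0 (proj₂ (foldl (λ s _ → add-step s) (st , out) l)) ≡ rebuild (pending st) out
    add-run []      st out lt = cong (λ z → rebuild z out) (sym (n<1⇒n≡0 lt))
    add-run (_ ∷ l) ((x , y) , c) out lt = trans
      (add-run l ((half x , half y) , m) (b ∷ out) (*-cancelʳ-< 2 (half x + half y + bool m) (2 ^ length l) (≤-<-trans (n≤b∷ᵇn b (half x + half y + bool m))
         (subst₂ _<_ (pending-step x y c) (*-comm 2 (2 ^ length l)) lt))))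
      (cong (λ z → rebuild z out) (sym (pending-step x y c)))
      where
      b = xor (odd x) (odd y) c
      m = maj (odd x) (odd y) c

    -- Both summands are below 2 to the total number of digits, so one tick more than that number
    -- suffices.
    ripple : ℕ × ℕ → ℕ
    ripple (x , y) = rebuild 0 (proj₂ (foldl (λ s _ → add-step s) (((x , y) , false) , []) (zero ∷ (digits x ++ digits y))))

    ripple-correct : ∀ x y → ripple (x , y) ≡ x + y
    ripple-correct x y = trans (add-run (zero ∷ (digits x ++ digits y)) ((x , y) , false) [] lt) (+-identityʳ (x + y))
      where
      open ≤-Reasoning
      lt : x + y + 0 < 2 ^ suc (length (digits x ++ digits y))
      lt = begin-strict
        x + y + 0                                      ≡⟨ +-identityʳ (x + y) ⟩
        x + y                                          <⟨ +-mono-< (<2^len x) (<2^len y) ⟩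
        2 ^ len x + 2 ^ len y                          ≤⟨ +-mono-≤ (^-monoʳ-≤ 2 (m≤m+n (len x) (len y))) (^-monoʳ-≤ 2 (m≤n+m (len y) (len x))) ⟩
        2 ^ (len x + len y) + 2 ^ (len x + len y)      ≡⟨ cong (2 ^ (len x + len y) +_) (sym (+-identityʳ _)) ⟩
        2 ^ suc (len x + len y)                        ≡⟨ cong (λ l → 2 ^ suc l) (sym (length-++ (digits x))) ⟩
        2 ^ suc (length (digits x ++ digits y))        ∎

    rebuild∘ : ∀ {Γ : Set} {{_ : Enc Γ}} {f : Γ → List Bool} → PolyTime f → PolyTime (λ γ → rebuild 0 (f γ))
    rebuild∘ p = foldl∘ p (const∘ 0) (snd∘ id∘ ∷ᵇ∘ snd∘ (fst∘ id∘)) (con 6) (λ γ n b → sz-∷ᵇ b n)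

    ripple∘ : PolyTime ripple
    ripple∘ = rebuild∘ (snd∘ (foldl∘ {X = Bit} (const∘ zero ∷∘ (digits∘ (fst∘ id∘) ++∘ digits∘ (snd∘ id∘)))
      ((id∘ ,∘ const∘ false) ,∘ []∘)
      (((half∘ x ,∘ half∘ y) ,∘ if∘ (odd∘ x) (if∘ (odd∘ y) (const∘ true) c) (if∘ (odd∘ y) c (const∘ false)))
        ,∘ if∘ (odd∘ x) (if∘ (odd∘ y) c not-c) (if∘ (odd∘ y) not-c c) ∷∘ snd∘ st)
      (con 10)
      (λ { γ (((x , y) , c) , out) _ → begin
        suc (suc (suc (sz (half x) + sz (half y)) + sz (maj (odd x) (odd y) c)) + suc (sz (xor (odd x) (odd y) c) + sz out))
          ≤⟨ s≤s (+-mono-≤ (s≤s (+-mono-≤ (s≤s (+-mono-≤ (sz-half x) (sz-half y))) (sz-bool (maj (odd x) (odd y) c))))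
                           (s≤s (+-monoˡ-≤ (sz out) (sz-bool (xor (odd x) (odd y) c))))) ⟩
        suc (suc (suc (sz x + sz y) + 3) + suc (3 + sz out))
          ≤⟨ m≤m+n _ (sz c + 3) ⟩
        suc (suc (suc (sz x + sz y) + 3) + suc (3 + sz out)) + (sz c + 3)
          ≡⟨ arith (sz x) (sz y) (sz c) (sz out) ⟩
        suc (suc (suc (sz x + sz y) + sz c) + sz out) + 10 ∎ })))
      where
      open ≤-Reasoning
      Γ = ((ℕ × ℕ) × Adder) × Bit
      st : PolyTime {Γ} (λ ((_ , s) , _) → s)
      st = snd∘ (fst∘ id∘)
      x : PolyTime {Γ} (λ ((_ , (((x , _) , _) , _)) , _) → x)
      x = fst∘ (fst∘ (fst∘ st))
      y : PolyTime {Γ} (λ ((_ , (((_ , y) , _) , _)) , _) → y)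
      y = snd∘ (fst∘ (fst∘ st))
      c : PolyTime {Γ} (λ ((_ , ((_ , c) , _)) , _) → c)
      c = snd∘ (fst∘ st)
      not-c : PolyTime {Γ} (λ ((_ , ((_ , c) , _)) , _) → if c then false else true)
      not-c = if∘ c (const∘ false) (const∘ true)
      arith : ∀ x y c o → suc (suc (suc (x + y) + 3) + suc (3 + o)) + (c + 3) ≡ suc (suc (suc (x + y) + c) + o) + 10
      arith = solve-∀

  module _ {Γ : Set} {{_ : Enc Γ}} where

    infixl 6 _+∘_

    opaque
      _+∘_ : {f g : Γ → ℕ} → PolyTime f → PolyTime g → PolyTime (λ γ → f γ + g γ)
      _+∘_ {f} {g} p q = ext (λ γ → ripple-correct (f γ) (g γ)) (ripple∘ ∘ᵖ (p ,∘ q))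

  private
    -- Horner's scheme, starting from the most significant digit.
    horner : ∀ y ds → foldl (λ acc d → (if isOne d then y else 0) + (false ∷ᵇ acc)) 0 (reverse ds) ≡ fromDigits ds * y
    horner y ds = trans (reverse-foldr′ ds) (go ds)
      where
      step : Bit → ℕ → ℕ
      step d acc = (if isOne d then y else 0) + (false ∷ᵇ acc)
      reverse-foldr′ : ∀ ds → foldl (λ acc d → step d acc) 0 (reverse ds) ≡ List.foldr step 0 ds
      reverse-foldr′ ds = trans (sym (reverse-foldr step 0 (reverse ds))) (cong (List.foldr step 0) (Data.List.Properties.reverse-involutive ds))
      go : ∀ ds → List.foldr step 0 ds ≡ fromDigits ds * y
      go []       = refl
      go (d ∷ ds) = trans (cong (λ z → (if isOne d then y else 0) + z * 2) (go ds)) (lemma d)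
        where
        arith : ∀ a y → a * y * 2 ≡ a * 2 * y
        arith = solve-∀
        lemma : ∀ d → (if isOne d then y else 0) + fromDigits ds * y * 2 ≡ (toℕ d + fromDigits ds * 2) * y
        lemma zero       = arith (fromDigits ds) y
        lemma (suc zero) = cong (y +_) (arith (fromDigits ds) y)

    sz-if : ∀ b y → sz (if b then y else 0) ≤ sz y
    sz-if false y = sz-mono z≤n
    sz-if true  y = ≤-refl

  module _ {Γ : Set} {{_ : Enc Γ}} where

    infixl 7 _*∘_

    opaque
      -- Doubling adds one digit, of size 6, and adding `g` at most the size of `g`: the growth is
      -- additive although the value grows exponentially.
      _*∘_ : {f g : Γ → ℕ} → PolyTime f → PolyTime g → PolyTime (λ γ → f γ * g γ)
      _*∘_ {f} {g} p q = ext (λ γ → trans (horner (g γ) (digits (f γ))) (cong (_* g γ) (fromDigits-digits (f γ))))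
        (foldl∘ (reverse∘ (digits∘ (fst∘ id∘))) (const∘ 0)
          (if∘ (isOne∘ (snd∘ id∘)) (snd∘ (fst∘ (fst∘ id∘))) (const∘ 0) +∘ (const∘ false ∷ᵇ∘ snd∘ (fst∘ id∘)))
          (var ⊕ con 6)
          (λ { (x , y) acc d → begin
            sz ((if isOne d then y else 0) + (false ∷ᵇ acc))        ≤⟨ sz-+ _ (false ∷ᵇ acc) ⟩
            sz (if isOne d then y else 0) + sz (false ∷ᵇ acc)       ≤⟨ +-mono-≤ (sz-if (isOne d) y) (sz-∷ᵇ false acc) ⟩
            sz y + (sz acc + 6)                                      ≡⟨ arith (sz y) (sz acc) ⟩
            sz acc + (sz y + 6)                                      ≤⟨ +-monoʳ-≤ (sz acc) (+-monoˡ-≤ 6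
                                                                          (≤-trans (m≤n⇒m≤1+n (m≤n+m (sz y) (sz x))) (m≤m+n _ (sz d)))) ⟩
            sz acc + (suc (sz x + sz y) + sz d + 6)                  ∎ })
        ∘ᵖ (p ,∘ q))
        where
        open ≤-Reasoning
        arith : ∀ y a → y + (a + 6) ≡ a + (y + 6)
        arith = solve-∀

  private
    Comparison : Set
    Comparison = (ℕ × ℕ) × Bool

    compare-step : Comparison → Comparison
    compare-step ((x , y) , r) = (half x , half y) ,
      (if odd x then (if odd y then r else false) else (if odd y then true else r))

    -- The flag says whether the digits seen so far allow equality of the rest.
    strictness : Bool → ℕ
    strictness r = bool (if r then false else true)

    decide : Comparison → Bool
    decide ((x , y) , r) = (x + strictness r) ≤ᵇ y

    T-≡ : ∀ {a b} → (T a → T b) → (T b → T a) → a ≡ b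
    T-≡ {false} {false} f g = refl
    T-≡ {false} {true}  f g with () ← g _
    T-≡ {true}  {false} f g with () ← f _
    T-≡ {true}  {true}  f g = refl

    ≤ᵇ-≡ : ∀ a b c d → (a ≤ b → c ≤ d) → (c ≤ d → a ≤ b) → (a ≤ᵇ b) ≡ (c ≤ᵇ d)
    ≤ᵇ-≡ a b c d f g = T-≡ (λ t → ≤⇒≤ᵇ (f (≤ᵇ⇒≤ a b t))) (λ t → ≤⇒≤ᵇ (g (≤ᵇ⇒≤ c d t)))

    -- Equal digits keep the flag and different digits override it: a larger low digit of `x` forces
    -- the higher parts to compare strictly, a smaller one permits equality.
    decide-step : ∀ x y r → decide ((x , y) , r) ≡ decide (compare-step ((x , y) , r))
    decide-step x y r = subst₂ (λ x′ y′ → decide ((x′ , y′) , r) ≡ decide (compare-step ((x , y) , r)))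
      (sym (odd∷half x)) (sym (odd∷half y)) (go (odd x) (odd y) r (half x) (half y))
      where
      halve : ∀ {m n} → m * 2 ≤ 1 + n * 2 → m ≤ n
      halve {m} {n} le = s≤s⁻¹ (*-cancelʳ-< 2 m (suc n) (s≤s le))
      double : ∀ {m n} → m ≤ n → m * 2 ≤ n * 2
      double = *-monoˡ-≤ 2
      go : ∀ a b r m n → decide ((a ∷ᵇ m , b ∷ᵇ n) , r) ≡
           decide ((m , n) , (if a then (if b then r else false) else (if b then true else r)))
      go false false true  m n rewrite +-identityʳ (m * 2) | +-identityʳ m = ≤ᵇ-≡ (m * 2) (n * 2) m n (*-cancelʳ-≤ m n 2) double
      go false false false m n rewrite +-comm (m * 2) 1 | +-comm m 1 =
        ≤ᵇ-≡ (1 + m * 2) (n * 2) (1 + m) n (*-cancelʳ-< 2 m n) (λ le → ≤-trans (n≤1+n _) (double le))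
      go false true  true  m n rewrite +-identityʳ (m * 2) | +-identityʳ m = ≤ᵇ-≡ (m * 2) (1 + n * 2) m n halve (λ le → m≤n⇒m≤1+n (double le))
      go false true  false m n rewrite +-comm (m * 2) 1 | +-identityʳ m =
        ≤ᵇ-≡ (1 + m * 2) (1 + n * 2) m n (λ le → *-cancelʳ-≤ m n 2 (s≤s⁻¹ le)) (λ le → s≤s (double le))
      go true  false true  m n rewrite +-identityʳ (m * 2) | +-comm m 1 =
        ≤ᵇ-≡ (1 + m * 2) (n * 2) (1 + m) n (*-cancelʳ-< 2 m n) (λ le → ≤-trans (n≤1+n _) (double le))
      go true  false false m n rewrite +-comm (m * 2) 1 | +-comm m 1 =
        ≤ᵇ-≡ (2 + m * 2) (n * 2) (1 + m) n (λ le → *-cancelʳ-< 2 m n (≤-trans (n≤1+n _) le)) double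
      go true  true  true  m n rewrite +-identityʳ (m * 2) | +-identityʳ m =
        ≤ᵇ-≡ (1 + m * 2) (1 + n * 2) m n (λ le → *-cancelʳ-≤ m n 2 (s≤s⁻¹ le)) (λ le → s≤s (double le))
      go true  true  false m n rewrite +-comm (m * 2) 1 | +-comm m 1 =
        ≤ᵇ-≡ (2 + m * 2) (1 + n * 2) (1 + m) n (λ le → *-cancelʳ-< 2 m n (s≤s⁻¹ le)) (λ le → s≤s (≤-trans (n≤1+n _) (double le)))

    half< : ∀ x l → x < 2 ^ suc l → half x < 2 ^ l
    half< x l lt = *-cancelʳ-< 2 (half x) (2 ^ l) (≤-<-trans (n≤b∷ᵇn (odd x) (half x))
      (subst₂ _<_ (odd∷half x) (*-comm 2 (2 ^ l)) lt))

    compare-run : ∀ {X : Set} (l : List X) x y r → x < 2 ^ length l → y < 2 ^ length l →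
                  proj₂ (foldl (λ s _ → compare-step s) ((x , y) , r) l) ≡ decide ((x , y) , r)
    compare-run []      x y r x< y< with n<1⇒n≡0 x< | n<1⇒n≡0 y<
    compare-run []      .0 .0 true  x< y< | refl | refl = refl
    compare-run []      .0 .0 false x< y< | refl | refl = refl
    compare-run (_ ∷ l) x y r x< y< = trans
      (compare-run l (half x) (half y) _ (half< x (length l) x<) (half< y (length l) y<)) (sym (decide-step x y r))

    sz-choice : ∀ (a b r : Bool) → sz (if a then (if b then r else false) else (if b then true else r)) ≤ 3
    sz-choice a b r = sz-bool (if a then (if b then r else false) else (if b then true else r))

  module _ {Γ : Set} {{_ : Enc Γ}} where

    infix 4 _≤ᵇ∘_

    opaque
      _≤ᵇ∘_ : {f g : Γ → ℕ} → PolyTime f → PolyTime g → PolyTime (λ γ → f γ ≤ᵇ g γ)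
      _≤ᵇ∘_ {f} {g} p q = ext (λ γ → correct (f γ) (g γ))
        (snd∘ (foldl∘ {X = Bit} {h = λ ((_ , s) , _) → compare-step s} (digits∘ (fst∘ id∘) ++∘ digits∘ (snd∘ id∘)) (id∘ ,∘ const∘ true)
          ((half∘ x ,∘ half∘ y) ,∘ if∘ (odd∘ x) (if∘ (odd∘ y) r (const∘ false)) (if∘ (odd∘ y) (const∘ true) r))
          (con 2) additive)
        ∘ᵖ (p ,∘ q))
        where
        open ≤-Reasoning
        Δ : Set
        Δ = ((ℕ × ℕ) × Comparison) × Bit
        x : PolyTime {Δ} (λ ((_ , ((x , _) , _)) , _) → x)
        x = fst∘ (fst∘ (snd∘ (fst∘ id∘)))
        y : PolyTime {Δ} (λ ((_ , ((_ , y) , _)) , _) → y)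
        y = snd∘ (fst∘ (snd∘ (fst∘ id∘)))
        r : PolyTime {Δ} (λ ((_ , (_ , r)) , _) → r)
        r = snd∘ (snd∘ (fst∘ id∘))
        additive : Additive {ℕ × ℕ} {Bit} {Comparison} (λ ((_ , s) , _) → compare-step s) (con 2)
        additive γ ((x , y) , r) _ = begin
          suc (suc (sz (half x) + sz (half y)) + sz (proj₂ (compare-step ((x , y) , r))))
            ≤⟨ s≤s (+-mono-≤ (s≤s (+-mono-≤ (sz-half x) (sz-half y))) (≤-trans (sz-choice (odd x) (odd y) r) (+-monoˡ-≤ 2 (size>0 (enc r))))) ⟩
          suc (suc (sz x + sz y) + (sz r + 2))
            ≡⟨ cong suc (sym (+-assoc (suc (sz x + sz y)) (sz r) 2)) ⟩
          suc (suc (sz x + sz y) + sz r) + 2 ∎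
        correct : ∀ x y → proj₂ (foldl (λ s _ → compare-step s) ((x , y) , true) (digits x ++ digits y)) ≡ (x ≤ᵇ y)
        correct x y = trans (compare-run (digits x ++ digits y) x y true
          (<-≤-trans (<2^len x) (^-monoʳ-≤ 2 (≤-trans (m≤m+n (len x) (len y)) (≤-reflexive (sym (length-++ (digits x)))))))
          (<-≤-trans (<2^len y) (^-monoʳ-≤ 2 (≤-trans (m≤n+m (len y) (len x)) (≤-reflexive (sym (length-++ (digits x))))))))
          (cong (_≤ᵇ y) (+-identityʳ x))

-- The greedy rule and its polynomial-time implementation.

module GreedyProgram where

  open Bounds
  open PolynomialTime
  open Arith
  open import Data.Bool using (Bool; true; false; if_then_else_)
  open import Data.Digit using (Bit)
  open import Data.Fin using (zero; suc)
  open import Data.List as List using (List; []; _∷_; _++_; foldl; foldr; map; length; reverse; zip)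
  open import Data.List.Properties using (++-identityʳ)
  open import Data.Nat
  open import Data.Nat.Properties
  open import Data.Nat.Tactic.RingSolver using (solve-∀)
  open import Data.Product using (_×_; _,_; proj₁; proj₂)
  open import Data.Unit using (tt)
  open import Relation.Binary.PropositionalEquality
  open PolynomialTime.PolyTime

  sz-if : ∀ {A : Set} {{_ : Enc A}} b {x y : A} {n} → sz x ≤ n → sz y ≤ n → sz (if b then x else y) ≤ n
  sz-if true  x≤ y≤ = x≤
  sz-if false x≤ y≤ = y≤

  sz-reverse : ∀ {A : Set} {{_ : Enc A}} (xs : List A) → sz (reverse xs) ≡ sz xs
  sz-reverse xs = +-cancelʳ-≡ 1 (sz (reverse xs)) (sz xs) (go xs [])
    where
    go : ∀ xs ys → sz (foldl (λ ys x → x ∷ ys) ys xs) + 1 ≡ sz xs + sz ys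
    go []       ys = +-comm (sz ys) 1
    go (x ∷ xs) ys = trans (go xs (x ∷ ys)) (arith (sz x) (sz xs) (sz ys))
      where
      arith : ∀ a b c → b + suc (a + c) ≡ suc (a + b) + c
      arith = solve-∀

  module _ {Γ X Y : Set} {{_ : Enc Γ}} {{_ : Enc X}} {{_ : Enc Y}} where

    private
      zip-step : (List Y × List (X × Y)) → X → List Y × List (X × Y)
      zip-step (ys , out) x = caseList ys (ys , out) (λ y ys → ys , (x , y) ∷ out)

      zip-run : ∀ xs ys out → reverse (proj₂ (foldl zip-step (ys , out) xs)) ≡ reverse out ++ zip xs ys
      zip-run []       ys       out = sym (++-identityʳ _)
      zip-run (x ∷ xs) []       out = trans (zip-run xs [] out) (cong (reverse out ++_) (zip-[] xs))
        where
        zip-[] : ∀ xs → zip xs [] ≡ []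
        zip-[] []       = refl
        zip-[] (x ∷ xs) = refl
      zip-run (x ∷ xs) (y ∷ ys) out = trans (zip-run xs ys ((x , y) ∷ out))
        (trans (cong (_++ zip xs ys) (Data.List.Properties.unfold-reverse (x , y) out)) (Data.List.Properties.++-assoc (reverse out) _ _))

    zip∘ : {xs : Γ → List X} {ys : Γ → List Y} → PolyTime xs → PolyTime ys → PolyTime (λ γ → zip (xs γ) (ys γ))
    zip∘ {xs} {ys} p q = ext (λ γ → zip-run (xs γ) (ys γ) [])
      (reverse∘ (snd∘ (foldl∘ {h = λ ((_ , t) , x) → zip-step t x} p (q ,∘ []∘)
        (case∘ (fst∘ (snd∘ (fst∘ id∘))) (snd∘ (fst∘ id∘))
          (snd∘ id∘ ,∘ (snd∘ (fst∘ (fst∘ id∘)) ,∘ snd∘ (fst∘ id∘)) ∷∘ snd∘ (snd∘ (fst∘ (fst∘ (fst∘ id∘))))))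
        (var ⊕ con 1) additive)))
      where
      additive : Additive {Γ} {X} {List Y × List (X × Y)} (λ ((_ , t) , x) → zip-step t x) (var ⊕ con 1)
      additive γ ([]     , out) x = m≤m+n _ _
      additive γ (y ∷ ys , out) x = ≤-trans (≤-reflexive (arith (sz x) (sz y) (sz ys) (sz out)))
        (+-monoʳ-≤ (sz (y ∷ ys , out)) (+-monoˡ-≤ 1 (m≤n+m (sz x) (sz γ))))
        where
        arith : ∀ x y ys o → suc (ys + suc (suc (x + y) + o)) ≡ suc (suc (y + ys) + o) + (x + 1)
        arith = solve-∀

  module _ {Γ X : Set} {{_ : Enc Γ}} {{_ : Enc X}} where

    length∘ : {xs : Γ → List X} → PolyTime xs → PolyTime (λ γ → length (xs γ))
    length∘ {xs} p = ext (λ γ → trans (go (xs γ) 0) (+-identityʳ _))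
      (foldl∘ {h = λ ((_ , n) , _) → 1 + n} p (const∘ 0) (const∘ 1 +∘ snd∘ (fst∘ id∘)) (con (sz 1))
        (λ γ n x → ≤-trans (sz-+ 1 n) (≤-reflexive (+-comm (sz 1) (sz n)))))
      where
      go : ∀ (xs : List X) n → foldl (λ n _ → 1 + n) n xs ≡ length xs + n
      go []       n = refl
      go (x ∷ xs) n = trans (go xs (suc n)) (+-suc (length xs) n)

  module _ {X : Set} where

    label-step : List X × List ℕ → List X × List ℕ
    label-step (xs , out) = caseList xs (xs , out) (λ _ xs → xs , length xs ∷ out)

    -- The positions 0, 1, 2, ... of the list: the lengths of its proper tails, each put in front of
    -- the longer ones.
    labels : List X → List ℕ
    labels xs = proj₂ (foldl (λ s _ → label-step s) (xs , []) xs)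

  module _ {X : Set} {{_ : Enc X}} where

    private
      -- A step adds the encoding of a length. That this is bounded uses the invariant that the
      -- remaining list never exceeds the original one in size.
      labelsᵖ : PolyTime (labels {X})
      labelsᵖ = snd∘ (foldl-inv∘ {Γ = List X} {X = X} {T = List X × List ℕ} {h = λ ((_ , s) , _) → label-step s} id∘ (id∘ ,∘ []∘)
        (case∘ (fst∘ (snd∘ (fst∘ id∘))) (snd∘ (fst∘ id∘)) (snd∘ id∘ ,∘ length-rest ∷∘ snd∘ (snd∘ (fst∘ (fst∘ (fst∘ id∘))))))
        (λ xs (rest , _) → sz rest ≤ sz xs) (growth len′ ⊕ con 0) (λ _ → ≤-refl)
        (λ { xs ([] , out) x le → le ; xs (r ∷ rest , out) x le → ≤-trans (m≤n⇒m≤1+n (m≤n+m _ (sz r))) le })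
        additive)
        where
        opaque
          len′ : PolyTime {List X} length
          len′ = length∘ id∘
        length-rest : PolyTime {(((List X × (List X × List ℕ)) × X) × X) × List X} (λ (_ , xs) → length xs)
        length-rest = len′ ∘ᵖ snd∘ id∘
        additive : ∀ xs (t : List X × List ℕ) (x : X) → sz (proj₁ t) ≤ sz xs → sz (label-step t) ≤ sz t + (growth len′ ⊕ con 0) at (sz xs + sz x)
        additive xs ([] , out)       x le = m≤m+n _ _
        additive xs (r ∷ rest , out) x le = begin
          suc (sz rest + suc (sz (length rest) + sz out))
            ≤⟨ s≤s (+-monoʳ-≤ (sz rest) (s≤s (+-monoˡ-≤ (sz out) (≤-trans (growth≤ len′ rest)
                 (at-mono (growth len′) (≤-trans (≤-trans (m≤n⇒m≤1+n (m≤n+m _ (sz r))) le) (m≤m+n (sz xs) (sz x)))))))) ⟩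
          suc (sz rest + suc (G + sz out))
            ≤⟨ m≤n+m _ (sz r) ⟩
          sz r + suc (sz rest + suc (G + sz out))
            ≡⟨ arith (sz r) (sz rest) (sz out) G ⟩
          suc (suc (sz r + sz rest) + sz out) + (G + 0) ∎
          where
          open ≤-Reasoning
          G = growth len′ at (sz xs + sz x)
          arith : ∀ a b c g → a + suc (b + suc (g + c)) ≡ suc (suc (a + b) + c) + (g + 0)
          arith = solve-∀

    labels∘ : ∀ {Γ : Set} {{_ : Enc Γ}} {xs : Γ → List X} → PolyTime xs → PolyTime (λ γ → labels (xs γ))
    labels∘ p = labelsᵖ ∘ᵖ p

  module _ {Γ : Set} {{_ : Enc Γ}} where

    infix 4 _≡ᵇ∘_

    _≡ᵇ∘_ : {f g : Γ → ℕ} → PolyTime f → PolyTime g → PolyTime (λ γ → f γ ≡ᵇ g γ)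
    _≡ᵇ∘_ {f} {g} p q = ext (λ γ → lemma (f γ) (g γ)) (if∘ (p ≤ᵇ∘ q) (q ≤ᵇ∘ p) (const∘ false))
      where
      lemma : ∀ m n → (if m ≤ᵇ n then n ≤ᵇ m else false) ≡ (m ≡ᵇ n)
      lemma zero          zero          = refl
      lemma zero          (suc n)       = refl
      lemma (suc m)       zero          = refl
      lemma (suc zero)    (suc zero)    = refl
      lemma (suc zero)    (suc (suc n)) = refl
      lemma (suc (suc m)) (suc zero)    = refl
      lemma (suc (suc m)) (suc (suc n)) = lemma (suc m) (suc n)

    _⊔∘_ : {f g : Γ → ℕ} → PolyTime f → PolyTime g → PolyTime (λ γ → f γ ⊔ g γ)
    _⊔∘_ {f} {g} p q = ext (λ γ → lemma (f γ) (g γ)) (if∘ (p ≤ᵇ∘ q) q p)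
      where
      lemma : ∀ m n → (if m ≤ᵇ n then n else m) ≡ m ⊔ n
      lemma m n with m ≤ᵇ n in eq
      ... | true  = sym (m≤n⇒m⊔n≡n (≤ᵇ⇒≤ m n (subst Data.Bool.T (sym eq) tt)))
      ... | false = sym (m≥n⇒m⊔n≡m (≰⇒≥ (λ le → subst Data.Bool.T eq (≤⇒≤ᵇ le))))

  -- The type of jobs is a parameter: the program uses numbers and bit masks, the analysis elements
  -- of finite types, and a naturality argument connects the two runs.
  module Greedy {Job : Set} (vm cost′ : Job → ℕ) (W : List Job → Job → ℕ) (a : ℕ) where

    load-step : ℕ → Job → ℕ → ℕ
    load-step v e L = if vm e ≡ᵇ v then (L ⊔ a * cost′ e) + cost′ e else L

    -- Events are listed from the latest to the earliest.
    load : ℕ → List Job → ℕ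
    load v es = foldr (load-step v) 0 es

    ready : List Job → Job → ℕ
    ready es x = load (vm x) es ⊔ a * cost′ x

    -- Cross-multiplication compares the densities without division.
    beats : List Job → Job → Job → Bool
    beats es x y =
      if ready es x ≤ᵇ ready es y
      then (if ready es y ≤ᵇ ready es x then W es y * cost′ x ≤ᵇ W es x * cost′ y else true)
      else false

    -- A list of at most one job stands for an optional job.
    better : List Job → List Job → Job → List Job
    better es o x = if W es x ≡ᵇ 0 then o else caseList o (x ∷ []) (λ y _ → if beats es x y then x ∷ [] else o)

    best : List Job → List Job → List Job
    best J es = foldl (better es) [] J

    -- The list `l` is a clock. A list as long as the universe suffices, since every chosen job
    -- covers a new element of it; a round without a candidate changes nothing.
    events : {A : Set} → List Job → List A → List Job
    events J l = foldl (λ es _ → best J es ++ es) [] l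

  Job : Set
  Job = ((ℕ × ℕ) × List Bit) × ℕ

  machineOf setOf costOf : Job → ℕ
  machineOf (((v , S) , mask) , c) = v
  setOf     (((v , S) , mask) , c) = S
  costOf    (((v , S) , mask) , c) = c

  maskOf : Job → List Bit
  maskOf (((v , S) , mask) , c) = mask

  erase : List Bit → List ℕ → List ℕ
  erase mask us = map (λ (b , u) → if isOne b then 0 else u) (zip mask us)

  weight : List Bit → List ℕ → ℕ
  weight mask us = foldr (λ (b , u) t → (if isOne b then u else 0) + t) 0 (zip mask us)

  -- Covered elements get weight 0, so one list records both weights and coverage.
  residuals : List ℕ → List Job → List ℕ
  residuals ws es = foldr (λ e us → erase (maskOf e) us) ws es

  W : List ℕ → List Job → Job → ℕ
  W ws es x = weight (maskOf x) (residuals ws es)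

  Input : Set
  Input = (List ℕ × List Job) × ℕ

  weightsOf : Input → List ℕ
  weightsOf ((ws , J) , a) = ws

  jobsOf : Input → List Job
  jobsOf ((ws , J) , a) = J

  module G (γ : Input) = Greedy machineOf costOf (W (weightsOf γ)) (proj₂ γ)

  module _ {Γ : Set} {{_ : Enc Γ}} where

    machineOf∘ : {f : Γ → Job} → PolyTime f → PolyTime (λ γ → machineOf (f γ))
    machineOf∘ p = fst∘ (fst∘ (fst∘ p))

    setOf∘ : {f : Γ → Job} → PolyTime f → PolyTime (λ γ → setOf (f γ))
    setOf∘ p = snd∘ (fst∘ (fst∘ p))

    maskOf∘ : {f : Γ → Job} → PolyTime f → PolyTime (λ γ → maskOf (f γ))
    maskOf∘ p = snd∘ (fst∘ p)

    costOf∘ : {f : Γ → Job} → PolyTime f → PolyTime (λ γ → costOf (f γ))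
    costOf∘ p = snd∘ p

    weight∘ : {f : Γ → List Bit} {g : Γ → List ℕ} → PolyTime f → PolyTime g → PolyTime (λ γ → weight (f γ) (g γ))
    weight∘ p q = foldr∘ {h = λ ((_ , t) , (b , u)) → (if isOne b then u else 0) + t} (zip∘ p q) (const∘ 0)
      (if∘ (isOne∘ (fst∘ (snd∘ id∘))) (snd∘ (snd∘ id∘)) (const∘ 0) +∘ snd∘ (fst∘ id∘)) var
      (λ γ t (b , u) → ≤-trans (sz-+ (if isOne b then u else 0) t) (≤-trans
        (+-monoˡ-≤ (sz t) (≤-trans (sz-if {ℕ} (isOne b) ≤-refl (sz-mono {0} {u} z≤n))
          (≤-trans (m≤n⇒m≤1+n (m≤n+m (sz u) (sz b))) (m≤n+m _ (sz γ)))))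
        (≤-reflexive (+-comm _ (sz t)))))

    erase∘ : {f : Γ → List Bit} {g : Γ → List ℕ} → PolyTime f → PolyTime g → PolyTime (λ γ → erase (f γ) (g γ))
    erase∘ p q = map∘ {f = λ (_ , (b , u)) → if isOne b then 0 else u}
      (if∘ (isOne∘ (fst∘ (snd∘ id∘))) (const∘ 0) (snd∘ (snd∘ id∘))) (zip∘ p q)

  module _ {Γ : Set} {{_ : Enc Γ}} where

    residuals∘ : {f : Γ → List ℕ} {g : Γ → List Job} → PolyTime f → PolyTime g → PolyTime (λ γ → residuals (f γ) (g γ))
    residuals∘ p q = foldr∘ {h = λ ((_ , us) , e) → erase (maskOf e) us} q p (erase∘ (maskOf∘ (snd∘ id∘)) (snd∘ (fst∘ id∘)))
      (con 0) (λ γ us e → ≤-trans (sz-erase (maskOf e) us) (m≤m+n _ 0))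
      where
      sz-erase : ∀ mask us → sz (erase mask us) ≤ sz us
      sz-erase []         us       = size>0 (enc us)
      sz-erase (b ∷ mask) []       = ≤-refl
      sz-erase (b ∷ mask) (u ∷ us) = s≤s (+-mono-≤ (sz-if {ℕ} (isOne b) (sz-mono {0} {u} z≤n) ≤-refl) (sz-erase mask us))

    W∘ : {f : Γ → List ℕ} {g : Γ → List Job} {h : Γ → Job} → PolyTime f → PolyTime g → PolyTime h →
         PolyTime (λ γ → W (f γ) (g γ) (h γ))
    W∘ p q r = weight∘ (maskOf∘ r) (residuals∘ p q)

  private
    loadᵖ : PolyTime {((Input × ℕ) × List Job)} (λ ((γ , v) , es) → G.load γ v es)
    loadᵖ = foldr∘ {h = λ ((((γ , v) , _) , L) , e) → G.load-step γ v e L} (snd∘ id∘) (const∘ 0)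
      (if∘ (machineOf∘ e ≡ᵇ∘ v) (L ⊔∘ a*c +∘ costOf∘ e) L)
      (growth a*c ⊙ (con 2 ⊕ (con (sz 0) ⊕ var)) ⊕ var) load-additive
      where
      Δ : Set
      Δ = (((Input × ℕ) × List Job) × ℕ) × Job
      L : PolyTime {Δ} (λ ((_ , L) , _) → L)
      L = snd∘ (fst∘ id∘)
      e : PolyTime {Δ} proj₂
      e = snd∘ id∘
      v : PolyTime {Δ} (λ ((((_ , v) , _) , _) , _) → v)
      v = snd∘ (fst∘ (fst∘ (fst∘ id∘)))
      -- Sealed, so that its growth bound is handled as a symbol and not unfolded.
      opaque
       a*c : PolyTime {Δ} (λ ((((γ , _) , _) , _) , e) → proj₂ γ * costOf e)
       a*c = snd∘ (fst∘ (fst∘ (fst∘ (fst∘ id∘)))) *∘ costOf∘ e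
      load-additive : Additive {(Input × ℕ) × List Job} {Job} {ℕ} (λ ((((γ , v) , _) , L) , e) → G.load-step γ v e L)
                   (growth a*c ⊙ (con 2 ⊕ (con (sz 0) ⊕ var)) ⊕ var)
      load-additive δ@((γ , v) , es) L e = sz-if {ℕ} (machineOf e ≡ᵇ v)
        (begin
          sz ((L ⊔ x) + c)               ≤⟨ sz-+ (L ⊔ x) c ⟩
          sz (L ⊔ x) + sz c              ≤⟨ +-monoˡ-≤ (sz c) (≤-trans (sz-mono (m⊔n≤m+n L x)) (sz-+ L x)) ⟩
          -- The product does not involve the accumulator; putting 0 in its place makes the
          -- increment independent of the load.
          sz L + sz x + sz c             ≤⟨ +-mono-≤ (+-monoʳ-≤ (sz L) (≤-trans (growth≤ a*c ((δ , 0) , e))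
                                              (at-mono (growth a*c) (≤-reflexive (arith (sz δ) (sz 0) (sz e))))))
                                              (≤-trans (m≤n⇒m≤1+n (m≤n+m (sz c) _)) (m≤n+m (sz e) (sz δ))) ⟩
          sz L + growth a*c at (2 + (sz 0 + (sz δ + sz e))) + (sz δ + sz e)   ≡⟨ +-assoc (sz L) _ _ ⟩
          sz L + (growth a*c at (2 + (sz 0 + (sz δ + sz e))) + (sz δ + sz e)) ∎)
        (m≤m+n (sz L) _)
        where
        open ≤-Reasoning
        x = proj₂ γ * costOf e
        c = costOf e
        arith : ∀ d z e → suc (suc (d + z) + e) ≡ 2 + (z + (d + e))
        arith = solve-∀

    readyᵖ : PolyTime {(Input × List Job) × Job} (λ ((γ , es) , x) → G.ready γ es x)
    readyᵖ = (loadᵖ ∘ᵖ ((fst∘ (fst∘ id∘) ,∘ machineOf∘ (snd∘ id∘)) ,∘ snd∘ (fst∘ id∘)))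
             ⊔∘ (snd∘ (fst∘ (fst∘ id∘)) *∘ costOf∘ (snd∘ id∘))

    beatsᵖ : PolyTime {(Input × List Job) × (Job × Job)} (λ ((γ , es) , (x , y)) → G.beats γ es x y)
    beatsᵖ = if∘ (rx ≤ᵇ∘ ry) (if∘ (ry ≤ᵇ∘ rx) (W∘ ws es y *∘ costOf∘ x ≤ᵇ∘ W∘ ws es x *∘ costOf∘ y) (const∘ true)) (const∘ false)
      where
      Δ : Set
      Δ = (Input × List Job) × (Job × Job)
      es : PolyTime {Δ} (λ ((_ , es) , _) → es)
      es = snd∘ (fst∘ id∘)
      ws : PolyTime {Δ} (λ ((γ , _) , _) → weightsOf γ)
      ws = fst∘ (fst∘ (fst∘ (fst∘ id∘)))
      x : PolyTime {Δ} (λ (_ , (x , _)) → x)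
      x = fst∘ (snd∘ id∘)
      y : PolyTime {Δ} (λ (_ , (_ , y)) → y)
      y = snd∘ (snd∘ id∘)
      rx : PolyTime {Δ} (λ ((γ , es) , (x , _)) → G.ready γ es x)
      rx = readyᵖ ∘ᵖ (fst∘ id∘ ,∘ x)
      ry : PolyTime {Δ} (λ ((γ , es) , (_ , y)) → G.ready γ es y)
      ry = readyᵖ ∘ᵖ (fst∘ id∘ ,∘ y)

    bestᵖ : PolyTime {Input × List Job} (λ (γ , es) → G.best γ (jobsOf γ) es)
    bestᵖ = foldl∘ {h = λ (((γ , es) , o) , x) → G.better γ es o x} (snd∘ (fst∘ (fst∘ id∘))) []∘
      (if∘ (W∘ (fst∘ (fst∘ (fst∘ (fst∘ (fst∘ id∘))))) (snd∘ (fst∘ (fst∘ id∘))) (snd∘ id∘) ≡ᵇ∘ const∘ 0) o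
        (case∘ o (x ∷∘ []∘) (if∘ (beatsᵖ ∘ᵖ (fst∘ (fst∘ (fst∘ (fst∘ id∘))) ,∘ (snd∘ (fst∘ (fst∘ id∘)) ,∘ snd∘ (fst∘ id∘))))
          (snd∘ (fst∘ (fst∘ id∘)) ∷∘ []∘) (snd∘ (fst∘ (fst∘ (fst∘ id∘)))))))
      (con 2 ⊕ var) best-additive
      where
      Δ : Set
      Δ = ((Input × List Job) × List Job) × Job
      o : PolyTime {Δ} (λ ((_ , o) , _) → o)
      o = snd∘ (fst∘ id∘)
      x : PolyTime {Δ} (λ (_ , x) → x)
      x = snd∘ id∘
      best-additive : Additive {Input × List Job} {Job} {List Job} (λ (((γ , es) , o) , x) → G.better γ es o x) (con 2 ⊕ var)
      best-additive (γ , es) o x = sz-if {List Job} (W (weightsOf γ) es x ≡ᵇ 0) (m≤m+n (sz o) _) (go o)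
        where
        single : ∀ n → sz (x ∷ []) ≤ n + (2 + (sz (γ , es) + sz x))
        single n = ≤-trans (≤-reflexive (cong suc (+-comm (sz x) 1))) (≤-trans (+-monoʳ-≤ 2 (m≤n+m (sz x) (sz (γ , es)))) (m≤n+m _ n))
        go : ∀ o → sz (caseList o (x ∷ []) (λ y _ → if G.beats γ es x y then x ∷ [] else o)) ≤ sz o + (2 + (sz (γ , es) + sz x))
        go []       = single 1
        go (y ∷ o)  = sz-if {List Job} (G.beats γ es x y) (single (sz (y ∷ o))) (m≤m+n _ _)

    -- This makes the outer loop additive: a round adds at most one job of the given list.
    sz-best : ∀ γ es → sz (G.best γ (jobsOf γ) es) ≤ sz (jobsOf γ)
    sz-best γ es = go (jobsOf γ) [] (size>0 (enc (jobsOf γ))) ≤-refl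
      where
      go : ∀ J o {n} → sz o ≤ n → sz J ≤ n → sz (foldl (G.better γ es) o J) ≤ n
      go []      o     o≤ J≤ = o≤
      go (x ∷ J) o {n} o≤ J≤ = go J _ (sz-if {List Job} (W (weightsOf γ) es x ≡ᵇ 0) o≤ (choose o o≤)) (≤-trans (m≤n⇒m≤1+n (m≤n+m _ (sz x))) J≤)
        where
        x≤ : sz (x ∷ []) ≤ n
        x≤ = ≤-trans (s≤s (+-monoʳ-≤ (sz x) (size>0 (enc J)))) J≤
        choose : ∀ o → sz o ≤ n → sz (caseList o (x ∷ []) (λ y _ → if G.beats γ es x y then x ∷ [] else o)) ≤ n
        choose []      o≤ = x≤
        choose (y ∷ o) o≤ = sz-if {List Job} (G.beats γ es x y) x≤ o≤

  eventsᵖ : PolyTime {Input} (λ γ → G.events γ (jobsOf γ) (weightsOf γ))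
  eventsᵖ = foldl∘ {h = λ ((γ , es) , _) → G.best γ (jobsOf γ) es ++ es} (fst∘ (fst∘ id∘)) []∘
    (bestᵖ ∘ᵖ fst∘ id∘ ++∘ snd∘ (fst∘ id∘)) var
    (λ γ es x → begin
      sz (G.best γ (jobsOf γ) es ++ es)        ≤⟨ n≤1+n _ ⟩
      suc (sz (G.best γ (jobsOf γ) es ++ es))  ≡⟨ sz-++ (G.best γ (jobsOf γ) es) es ⟩
      sz (G.best γ (jobsOf γ) es) + sz es      ≤⟨ +-monoˡ-≤ (sz es) (≤-trans (sz-best γ es) (jobs≤ γ x)) ⟩
      sz γ + sz x + sz es                      ≡⟨ +-comm _ (sz es) ⟩
      sz es + (sz γ + sz x)                    ∎)
    where
    open ≤-Reasoning
    jobs≤ : ∀ γ x → sz (jobsOf γ) ≤ sz γ + sz x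
    jobs≤ ((ws , J) , a) x = ≤-trans (≤-trans (m≤n⇒m≤1+n (m≤n+m (sz J) (sz ws))) (m≤n⇒m≤1+n (m≤m+n _ (sz a)))) (m≤m+n _ (sz x))

-- The two algorithms on strings: parsing, list scheduling, printing.

module Algorithms where

  open Bounds
  open Digits
  open PolynomialTime
  open Arith
  open GreedyProgram
  open import Defs using (Token; bit; end; [[; ]])
  open Trees using (b0; b1)
  open import Data.Bool using (if_then_else_)
  open import Data.Digit using (Bit)
  open import Data.Fin using (zero; suc)
  open import Data.List as List using (List; []; _∷_; _++_; foldl; foldr; map; reverse; zip; concatMap)
  open import Data.Nat
  open import Data.Nat.Properties
  open import Data.Nat.Tactic.RingSolver using (solve-∀)
  open import Data.Product using (_×_; _,_; proj₁; proj₂)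
  open import Data.Unit using (⊤; tt)
  open import Relation.Binary.PropositionalEquality
  open PolynomialTime.PolyTime

  -- The parser keeps the digits of the current number, most significant first,
  -- the numbers of the current list, the finished inner lists, the finished
  -- outer lists, and the nesting depth.
  Inner Outer Parser : Set
  Inner  = List (List Bit × List ℕ)
  Outer  = List (List ℕ × Inner)
  Parser = ((List Bit × List ℕ) × Inner) × (Outer × List ⊤)

  value : List Bit → ℕ
  value = foldl (λ n b → isOne b ∷ᵇ n) 0

  on-bit : Bit → Parser → Parser
  on-bit b (((ds , ns) , inner) , out) = ((b ∷ ds , ns) , inner) , out

  on-end on-open on-close : Parser → Parser
  on-end (((ds , ns) , inner) , out) = (([] , value ds ∷ ns) , inner) , out
  on-open (cur , (outer , depth)) = cur , (outer , tt ∷ depth)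
  on-close s@(((ds , ns) , inner) , (outer , depth)) =
    -- At depth 1 the bracket ends an outer list. Deeper it ends an inner one, of which both the
    -- digits and the numbers are kept: masks are digits without `end`, cost rows are numbers.
    caseList depth s λ _ rest → caseList rest
      ((([] , []) , []) , ((reverse ns , reverse inner) ∷ outer , rest))
      λ _ _ → (([] , []) , (reverse ds , reverse ns) ∷ inner) , (outer , rest)

  parse-step : Parser → Token → Parser
  parse-step s t =
    caseList (tokenRank t) (on-bit zero s) λ _ r → caseList r (on-bit (suc zero) s) λ _ r →
    caseList r (on-end s) λ _ r → caseList r (on-open s) λ _ _ → on-close s

  Parsed : Set
  Parsed = (List ℕ × List (List Bit)) × List (List ℕ)

  -- Outer lists are stacked as they are finished, so the costs come first and the weights last. The
  -- defaults concern only strings that encode no instance.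
  collect : Outer → Parsed
  collect outer =
    caseList outer (([] , []) , []) λ rows outer → caseList outer (([] , []) , []) λ sets outer →
    caseList outer (([] , []) , []) λ weights _ →
    (proj₁ weights , map proj₁ (proj₂ sets)) , map proj₂ (proj₂ rows)

  initial : Parser
  initial = (([] , []) , []) , ([] , [])

  parse : List Token → Parsed
  parse ts = collect (proj₁ (proj₂ (foldl parse-step initial ts)))

  private
    value∘ : ∀ {Γ : Set} {{_ : Enc Γ}} {f : Γ → List Bit} → PolyTime f → PolyTime (λ γ → value (f γ))
    value∘ p = foldl∘ p (const∘ 0) (isOne∘ (snd∘ id∘) ∷ᵇ∘ snd∘ (fst∘ id∘)) (con 6) (λ γ n b → sz-∷ᵇ (isOne b) n)

    sz-bit : (b : Bit) → sz b ≡ 5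
    sz-bit zero       = refl
    sz-bit (suc zero) = refl

    sz-value : ∀ ds → sz (value ds) ≤ sz ds + sz 0
    sz-value ds = go ds 0
      where
      go : ∀ ds n → sz (foldl (λ n b → isOne b ∷ᵇ n) n ds) ≤ sz ds + sz n
      go []       n = n≤1+n _
      go (d ∷ ds) n = ≤-trans (go ds (isOne d ∷ᵇ n)) (≤-trans (+-monoʳ-≤ (sz ds) (sz-∷ᵇ (isOne d) n))
        (≤-reflexive (trans (arith (sz ds) (sz n)) (cong (λ k → suc (k + sz ds) + sz n) (sym (sz-bit d))))))
        where
        arith : ∀ a n → a + (n + 6) ≡ suc (5 + a) + n
        arith = solve-∀

    module _ {Γ : Set} {{_ : Enc Γ}} where

      ds∘ : {s : Γ → Parser} → PolyTime s → PolyTime (λ γ → proj₁ (proj₁ (proj₁ (s γ))))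
      ds∘ p = fst∘ (fst∘ (fst∘ p))
      ns∘ : {s : Γ → Parser} → PolyTime s → PolyTime (λ γ → proj₂ (proj₁ (proj₁ (s γ))))
      ns∘ p = snd∘ (fst∘ (fst∘ p))
      inner∘ : {s : Γ → Parser} → PolyTime s → PolyTime (λ γ → proj₂ (proj₁ (s γ)))
      inner∘ p = snd∘ (fst∘ p)
      outer∘ : {s : Γ → Parser} → PolyTime s → PolyTime (λ γ → proj₁ (proj₂ (s γ)))
      outer∘ p = fst∘ (snd∘ p)
      depth∘ : {s : Γ → Parser} → PolyTime s → PolyTime (λ γ → proj₂ (proj₂ (s γ)))
      depth∘ p = snd∘ (snd∘ p)

    on-bitᵖ : ∀ b → PolyTime (on-bit b)
    on-bitᵖ b = ((const∘ b ∷∘ ds∘ id∘ ,∘ ns∘ id∘) ,∘ inner∘ id∘) ,∘ snd∘ id∘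

    on-endᵖ : PolyTime on-end
    on-endᵖ = (([]∘ ,∘ value∘ (ds∘ id∘) ∷∘ ns∘ id∘) ,∘ inner∘ id∘) ,∘ snd∘ id∘

    on-openᵖ : PolyTime on-open
    on-openᵖ = fst∘ id∘ ,∘ (outer∘ id∘ ,∘ const∘ tt ∷∘ depth∘ id∘)

    on-closeᵖ : PolyTime on-close
    on-closeᵖ = case∘ (depth∘ id∘) id∘ (case∘ (snd∘ id∘)
      ((([]∘ ,∘ []∘) ,∘ []∘) ,∘ ((reverse∘ (ns∘ s) ,∘ reverse∘ (inner∘ s)) ∷∘ outer∘ s ,∘ snd∘ id∘))
      ((([]∘ ,∘ []∘) ,∘ (reverse∘ (ds∘ s′) ,∘ reverse∘ (ns∘ s′)) ∷∘ inner∘ s′) ,∘ (outer∘ s′ ,∘ snd∘ (fst∘ (fst∘ id∘)))))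
      where
      s : PolyTime {(Parser × ⊤) × List ⊤} (λ ((s , _) , _) → s)
      s = fst∘ (fst∘ id∘)
      s′ : PolyTime {(((Parser × ⊤) × List ⊤) × ⊤) × List ⊤} (λ ((((s , _) , _) , _) , _) → s)
      s′ = fst∘ (fst∘ (fst∘ (fst∘ id∘)))

    parse-stepᵖ : PolyTime {Parser × Token} (λ (s , t) → parse-step s t)
    parse-stepᵖ = case∘ (retype {f = tokenRank} (λ _ → refl) ∘ᵖ snd∘ id∘) (on-bitᵖ zero ∘ᵖ fst∘ id∘)
      (case∘ (snd∘ id∘) (on-bitᵖ (suc zero) ∘ᵖ fst∘ (fst∘ (fst∘ id∘)))
      (case∘ (snd∘ id∘) (on-endᵖ ∘ᵖ fst∘ (fst∘ (fst∘ (fst∘ (fst∘ id∘)))))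
      (case∘ (snd∘ id∘) (on-openᵖ ∘ᵖ fst∘ (fst∘ (fst∘ (fst∘ (fst∘ (fst∘ (fst∘ id∘)))))))
      (on-closeᵖ ∘ᵖ fst∘ (fst∘ (fst∘ (fst∘ (fst∘ (fst∘ (fst∘ (fst∘ (fst∘ id∘))))))))))))

    -- The largest increment is that of `on-end`: the number that replaces the digits may need the
    -- size of 0 in addition to theirs.
    grow : ℕ
    grow = sz 0 + 12

    sz-on-bit : ∀ b s → sz (on-bit b s) ≤ sz s + grow
    sz-on-bit b (((ds , ns) , inner) , out) = ≤-trans (≤-reflexive (trans (cong (λ k → suc (suc (suc (suc (k + sz ds) + sz ns) + sz inner) + sz out)) (sz-bit b))
      (arith (sz ds) (sz ns) (sz inner) (sz out)))) (+-monoʳ-≤ (sz (((ds , ns) , inner) , out)) (≤-trans (m≤m+n 6 6) (m≤n+m 12 (sz 0))))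
      where
      arith : ∀ a b c d → suc (suc (suc (suc (5 + a) + b) + c) + d) ≡ suc (suc (suc (a + b) + c) + d) + 6
      arith = solve-∀

    sz-on-end : ∀ s → sz (on-end s) ≤ sz s + grow
    sz-on-end (((ds , ns) , inner) , out) = begin
      suc (suc (suc (1 + suc (sz (value ds) + sz ns)) + sz inner) + sz out)
        ≤⟨ s≤s (+-monoˡ-≤ (sz out) (s≤s (+-monoˡ-≤ (sz inner) (s≤s (s≤s (s≤s (+-monoˡ-≤ (sz ns) (sz-value ds)))))))) ⟩
      suc (suc (suc (1 + suc (sz ds + sz 0 + sz ns)) + sz inner) + sz out)
        ≤⟨ m≤m+n _ 10 ⟩
      suc (suc (suc (1 + suc (sz ds + sz 0 + sz ns)) + sz inner) + sz out) + 10
        ≡⟨ arith (sz ds) (sz ns) (sz inner) (sz out) (sz 0) ⟩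
      suc (suc (suc (sz ds + sz ns) + sz inner) + sz out) + (sz 0 + 12) ∎
      where
      open ≤-Reasoning
      arith : ∀ a b c d z → suc (suc (suc (1 + suc (a + z + b)) + c) + d) + 10 ≡ suc (suc (suc (a + b) + c) + d) + (z + 12)
      arith = solve-∀

    sz-on-open : ∀ s → sz (on-open s) ≤ sz s + grow
    sz-on-open (cur , (outer , depth)) = ≤-trans (≤-reflexive (arith (sz cur) (sz outer) (sz depth)))
      (+-monoʳ-≤ (sz (cur , (outer , depth))) (≤-trans (m≤m+n 2 10) (m≤n+m 12 (sz 0))))
      where
      arith : ∀ a b c → suc (a + suc (b + suc (1 + c))) ≡ suc (a + suc (b + c)) + 2
      arith = solve-∀

    sz-on-close : ∀ s → sz (on-close s) ≤ sz s + grow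
    sz-on-close (((ds , ns) , inner) , (outer , []))              = m≤m+n _ grow
    sz-on-close (((ds , ns) , inner) , (outer , _ ∷ []))
      rewrite sz-reverse ns | sz-reverse inner = ≤-trans (m≤m+n _ (sz ds))
        (≤-trans (≤-reflexive (arith (sz ds) (sz ns) (sz inner) (sz outer)))
          (+-monoʳ-≤ (sz (((ds , ns) , inner) , (outer , tt ∷ []))) (≤-trans (m≤m+n 3 9) (m≤n+m 12 (sz 0)))))
      where
      arith : ∀ a b c d → suc (5 + suc (suc (suc (b + c) + d) + 1)) + a ≡ suc (suc (suc (a + b) + c) + suc (d + 3)) + 3
      arith = solve-∀
    sz-on-close (((ds , ns) , inner) , (outer , _ ∷ _ ∷ rest))
      rewrite sz-reverse ds | sz-reverse ns = ≤-trans (≤-reflexive (arith (sz ds) (sz ns) (sz inner) (sz outer) (sz rest)))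
          (+-monoʳ-≤ (sz (((ds , ns) , inner) , (outer , tt ∷ tt ∷ rest))) (≤-trans (m≤m+n 2 10) (m≤n+m 12 (sz 0))))
      where
      arith : ∀ a b c d e → suc (suc (3 + suc (suc (a + b) + c)) + suc (d + suc (1 + e)))
                          ≡ suc (suc (suc (a + b) + c) + suc (d + suc (1 + suc (1 + e)))) + 2
      arith = solve-∀

    sz-parse-step : ∀ s t → sz (parse-step s t) ≤ sz s + grow
    sz-parse-step s b0  = sz-on-bit zero s
    sz-parse-step s b1  = sz-on-bit (suc zero) s
    sz-parse-step s end = sz-on-end s
    sz-parse-step s [[  = sz-on-open s
    sz-parse-step s ]]  = sz-on-close s

    collectᵖ : PolyTime collect
    collectᵖ = case∘ id∘ (const∘ _) (case∘ (snd∘ id∘) (const∘ _) (case∘ (snd∘ id∘) (const∘ _)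
      ((fst∘ (snd∘ (fst∘ id∘)) ,∘ map∘ {f = λ (_ , x) → proj₁ x} (fst∘ (snd∘ id∘)) (snd∘ (snd∘ (fst∘ (fst∘ (fst∘ id∘)))))) ,∘
       map∘ {f = λ (_ , x) → proj₂ x} (snd∘ (snd∘ id∘)) (snd∘ (snd∘ (fst∘ (fst∘ (fst∘ (fst∘ (fst∘ id∘))))))))))

  opaque
    parseᵖ : PolyTime parse
    parseᵖ = collectᵖ ∘ᵖ fst∘ (snd∘ (foldl∘ {h = λ ((_ , s) , t) → parse-step s t} id∘ (const∘ initial)
      (parse-stepᵖ ∘ᵖ (snd∘ (fst∘ id∘) ,∘ snd∘ id∘)) (con grow) (λ _ s t → sz-parse-step s t)))

  jobs : List (List Bit) → List (List ℕ) → List Job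
  jobs sets rows = concatMap (λ (v , row) → map (λ ((S , mask) , c) → ((v , S) , mask) , c) (zip (zip (labels sets) sets) row))
                             (zip (labels rows) rows)

  print : List (ℕ × ℕ) → List ℕ → List Token
  print placed ms = [[ ∷ concatMap (λ i → [[ ∷ concatMap (λ (j , S) → if j ≡ᵇ i then map bit (digits S) ++ end ∷ [] else []) placed ++ ]] ∷ []) ms ++ ]] ∷ []

  loadOn : List (ℕ × (ℕ × ℕ)) → ℕ → ℕ
  loadOn pl i = foldr (λ (j , (_ , c)) t → if j ≡ᵇ i then c + t else t) 0 pl

  least-step : List (ℕ × (ℕ × ℕ)) → List ℕ → ℕ → List ℕ
  least-step pl o i = caseList o (i ∷ []) λ j _ → if loadOn pl j ≤ᵇ loadOn pl i then o else i ∷ []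

  leastLoaded : List ℕ → List (ℕ × (ℕ × ℕ)) → List ℕ
  leastLoaded ms pl = foldl (least-step pl) [] ms

  place-step : List ℕ → List (ℕ × (ℕ × ℕ)) → Job → List (ℕ × (ℕ × ℕ))
  place-step ms pl e = map (λ i → i , (setOf e , costOf e)) (leastLoaded ms pl) ++ pl

  -- Events are listed from the latest to the earliest, so `foldr` assigns the earliest first.
  place : List ℕ → List Job → List (ℕ × (ℕ × ℕ))
  place ms es = foldr (λ e pl → place-step ms pl e) [] es

  private
    bits∘ : ∀ {Γ : Set} {{_ : Enc Γ}} {f : Γ → ℕ} → PolyTime f → PolyTime (λ γ → map bit (digits (f γ)) ++ end ∷ [])
    bits∘ p = map∘ {X = Bit} {f = λ (_ , b) → bit b} (recode {A = Bit} {f = λ b → if isOne b then b1 else b0} {g = λ b → bit b} (λ { zero → refl ; (suc zero) → refl })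
      (if∘ (isOne∘ id∘) (const∘ b1) (const∘ b0)) ∘ᵖ snd∘ id∘) (digits∘ p) ++∘ const∘ (end ∷ [])

  opaque
    jobsᵖ : PolyTime {List (List Bit) × List (List ℕ)} (λ (sets , rows) → jobs sets rows)
    jobsᵖ = concatMap∘ {X = ℕ × List ℕ} {Y = Job} {f = λ ((sets , _) , (v , row)) → map (λ ((S , mask) , c) → ((v , S) , mask) , c) (zip (zip (labels sets) sets) row)}
      (map∘ {X = (ℕ × List Bit) × ℕ} {Y = Job} {f = λ ((_ , (v , row)) , ((S , mask) , c)) → ((v , S) , mask) , c}
        (((fst∘ (snd∘ (fst∘ id∘)) ,∘ fst∘ (fst∘ (snd∘ id∘))) ,∘ snd∘ (fst∘ (snd∘ id∘))) ,∘ snd∘ (snd∘ id∘))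
        (zip∘ (zip∘ (labels∘ (fst∘ (fst∘ id∘))) (fst∘ (fst∘ id∘))) (snd∘ (snd∘ id∘))))
      (zip∘ (labels∘ (snd∘ id∘)) (snd∘ id∘))

    printᵖ : PolyTime {List (ℕ × ℕ) × List ℕ} (λ (placed , ms) → print placed ms)
    printᵖ = const∘ [[ ∷∘ (concatMap∘ {X = ℕ} {f = λ ((placed , _) , i) → [[ ∷ concatMap (λ (j , S) → if j ≡ᵇ i then map bit (digits S) ++ end ∷ [] else []) placed ++ ]] ∷ []}
      (const∘ [[ ∷∘ (concatMap∘ {X = ℕ × ℕ} {f = λ ((_ , i) , (j , S)) → if j ≡ᵇ i then map bit (digits S) ++ end ∷ [] else []}
        (if∘ (fst∘ (snd∘ id∘) ≡ᵇ∘ snd∘ (fst∘ id∘)) (bits∘ (snd∘ (snd∘ id∘))) []∘) (fst∘ (fst∘ id∘)) ++∘ const∘ (]] ∷ [])))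
      (snd∘ id∘) ++∘ const∘ (]] ∷ []))

    loadOnᵖ : PolyTime {List (ℕ × (ℕ × ℕ)) × ℕ} (λ (pl , i) → loadOn pl i)
    loadOnᵖ = foldr∘ {h = λ (((_ , i) , t) , (j , (_ , c))) → if j ≡ᵇ i then c + t else t} (fst∘ id∘) (const∘ 0)
      (if∘ (fst∘ (snd∘ id∘) ≡ᵇ∘ snd∘ (fst∘ (fst∘ id∘))) (snd∘ (snd∘ (snd∘ id∘)) +∘ snd∘ (fst∘ id∘)) (snd∘ (fst∘ id∘))) var
      (λ γ t (j , (S , c)) → sz-if {ℕ} (j ≡ᵇ proj₂ γ)
        (≤-trans (sz-+ c t) (≤-trans (≤-reflexive (+-comm (sz c) (sz t))) (+-monoʳ-≤ (sz t)
          (≤-trans (≤-trans (m≤n⇒m≤1+n (m≤n+m (sz c) (sz S))) (m≤n⇒m≤1+n (m≤n+m _ (sz j)))) (m≤n+m _ (sz γ))))))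
        (m≤m+n (sz t) _))

    leastLoadedᵖ : PolyTime {List ℕ × List (ℕ × (ℕ × ℕ))} (λ (ms , pl) → leastLoaded ms pl)
    leastLoadedᵖ = foldl∘ {h = λ (((_ , pl) , o) , i) → least-step pl o i} (fst∘ id∘) []∘
      (case∘ (snd∘ (fst∘ id∘)) (snd∘ id∘ ∷∘ []∘)
        (if∘ (loadOnᵖ ∘ᵖ (snd∘ (fst∘ (fst∘ (fst∘ (fst∘ id∘)))) ,∘ snd∘ (fst∘ id∘)) ≤ᵇ∘
              loadOnᵖ ∘ᵖ (snd∘ (fst∘ (fst∘ (fst∘ (fst∘ id∘)))) ,∘ snd∘ (fst∘ (fst∘ id∘))))
             (snd∘ (fst∘ (fst∘ (fst∘ id∘)))) (snd∘ (fst∘ (fst∘ id∘)) ∷∘ []∘)))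
      (con 2 ⊕ var) (λ (ms , pl) o i → additive ms pl o i)
      where
      additive : ∀ (ms : List ℕ) pl o (i : ℕ) → sz (least-step pl o i) ≤ sz o + (2 + (sz (ms , pl) + sz i))
      additive ms pl o i = go o
        where
        single : ∀ n → sz (i ∷ []) ≤ n + (2 + (sz (ms , pl) + sz i))
        single n = ≤-trans (≤-reflexive (cong suc (+-comm (sz i) 1))) (≤-trans (+-monoʳ-≤ 2 (m≤n+m (sz i) (sz (ms , pl)))) (m≤n+m _ n))
        go : ∀ o → sz (least-step pl o i) ≤ sz o + (2 + (sz (ms , pl) + sz i))
        go []      = single 1
        go (j ∷ o) = sz-if {List ℕ} (loadOn pl j ≤ᵇ loadOn pl i) (m≤m+n _ _) (single (sz (j ∷ o)))

  private
    sz-leastLoaded : ∀ ms pl → sz (leastLoaded ms pl) ≤ sz ms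
    sz-leastLoaded ms pl = go ms [] (size>0′ ms) ≤-refl
      where
      size>0′ : ∀ (xs : List ℕ) → 1 ≤ sz xs
      size>0′ []       = ≤-refl
      size>0′ (x ∷ xs) = s≤s z≤n
      go : ∀ ms o {n} → sz o ≤ n → sz ms ≤ n → sz (foldl (least-step pl) o ms) ≤ n
      go []       o     o≤ ms≤ = o≤
      go (i ∷ ms) o {n} o≤ ms≤ = go ms _ (choose o o≤) (≤-trans (m≤n⇒m≤1+n (m≤n+m _ (sz i))) ms≤)
        where
        i≤ : sz (i ∷ []) ≤ n
        i≤ = ≤-trans (s≤s (+-monoʳ-≤ (sz i) (size>0′ ms))) ms≤
        choose : ∀ o → sz o ≤ n → sz (least-step pl o i) ≤ n
        choose []      o≤ = i≤
        choose (j ∷ o) o≤ = sz-if {List ℕ} (loadOn pl j ≤ᵇ loadOn pl i) o≤ i≤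

    opaque
      entriesᵖ : PolyTime {List ℕ × Job} (λ (is , e) → map (λ i → i , (setOf e , costOf e)) is)
      entriesᵖ = map∘ {f = λ ((_ , e) , i) → i , (setOf e , costOf e)} (snd∘ id∘ ,∘ (setOf∘ (snd∘ (fst∘ id∘)) ,∘ costOf∘ (snd∘ (fst∘ id∘)))) (fst∘ id∘)

  opaque
    placeᵖ : PolyTime {List ℕ × List Job} (λ (ms , es) → place ms es)
    placeᵖ = foldr∘ {h = λ (((ms , _) , pl) , e) → place-step ms pl e} (snd∘ id∘) []∘
      (entriesᵖ ∘ᵖ (leastLoadedᵖ ∘ᵖ (fst∘ (fst∘ (fst∘ id∘)) ,∘ snd∘ (fst∘ id∘)) ,∘ snd∘ id∘) ++∘ snd∘ (fst∘ id∘))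
      (growth entriesᵖ ⊙ var)
      (λ (ms , es) pl e → begin
        sz (place-step ms pl e)                                  ≤⟨ n≤1+n _ ⟩
        suc (sz (place-step ms pl e))                            ≡⟨ sz-++ (map (λ i → i , (setOf e , costOf e)) (leastLoaded ms pl)) pl ⟩
        sz (map (λ i → i , (setOf e , costOf e)) (leastLoaded ms pl)) + sz pl
          ≤⟨ +-monoˡ-≤ (sz pl) (≤-trans (growth≤ entriesᵖ (leastLoaded ms pl , e)) (at-mono (growth entriesᵖ)
               (s≤s (+-monoˡ-≤ (sz e) (≤-trans (sz-leastLoaded ms pl) (m≤m+n (sz ms) (sz es))))))) ⟩
        growth entriesᵖ at (sz (ms , es) + sz e) + sz pl          ≡⟨ +-comm _ (sz pl) ⟩
        sz pl + growth entriesᵖ at (sz (ms , es) + sz e)          ∎)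
      where open ≤-Reasoning

  unrelated : List Token → List Token
  unrelated ts = print (map (λ e → machineOf e , setOf e) (reverse (G.events γ (jobsOf γ) (weightsOf γ)))) (labels rows)
    where
    sets = proj₂ (proj₁ (parse ts))
    rows = proj₂ (parse ts)
    γ : Input
    γ = (proj₁ (proj₁ (parse ts)) , jobs sets rows) , 3

  -- The single row of costs of the virtual machine, which identical machines share.
  firstRow : List (List ℕ) → List (List ℕ)
  firstRow rows = caseList rows [] λ row _ → row ∷ []

  -- The constant a for m identical machines, 3 m - 1.
  delay : List (List ℕ) → ℕ
  delay rows = caseList rows 0 λ _ rest → foldl (λ t _ → 3 + t) 2 rest

  identical : List Token → List Token
  identical ts = print (map (λ (i , (S , _)) → i , S) (reverse (place (labels rows) (G.events γ (jobsOf γ) (weightsOf γ))))) (labels rows)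
    where
    sets = proj₂ (proj₁ (parse ts))
    rows = proj₂ (parse ts)
    γ : Input
    γ = (proj₁ (proj₁ (parse ts)) , jobs sets (firstRow rows)) , delay rows

  private
    firstRowᵖ : PolyTime firstRow
    firstRowᵖ = case∘ id∘ []∘ (snd∘ (fst∘ id∘) ∷∘ []∘)

    delayᵖ : PolyTime delay
    delayᵖ = case∘ id∘ (const∘ 0) (foldl∘ {h = λ ((_ , t) , _) → 3 + t} (snd∘ id∘) (const∘ 2) (const∘ 3 +∘ snd∘ (fst∘ id∘)) (con (sz 3))
      (λ γ t x → ≤-trans (sz-+ 3 t) (≤-reflexive (+-comm (sz 3) (sz t)))))

    opaque
      eventsᵖ′ : PolyTime {Input} (λ γ → G.events γ (jobsOf γ) (weightsOf γ))
      eventsᵖ′ = eventsᵖ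

  unrelatedᵖ : PolyTime unrelated
  unrelatedᵖ = let∘ {b = λ (_ , ((ws , sets) , rows)) → print (map (λ e → machineOf e , setOf e)
      (reverse (G.events ((ws , jobs sets rows) , 3) (jobs sets rows) ws))) (labels rows)} parseᵖ
    (printᵖ ∘ᵖ (map∘ {f = λ (_ , e) → machineOf e , setOf e} (machineOf∘ (snd∘ id∘) ,∘ setOf∘ (snd∘ id∘))
      (reverse∘ (eventsᵖ′ ∘ᵖ ((fst∘ (fst∘ (snd∘ id∘)) ,∘ jobsᵖ ∘ᵖ (snd∘ (fst∘ (snd∘ id∘)) ,∘ snd∘ (snd∘ id∘))) ,∘ const∘ 3)))
      ,∘ labels∘ (snd∘ (snd∘ id∘))))

  identicalᵖ : PolyTime identical
  identicalᵖ = let∘ {b = λ (_ , ((ws , sets) , rows)) → print (map (λ (i , (S , _)) → i , S)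
      (reverse (place (labels rows) (G.events ((ws , jobs sets (firstRow rows)) , delay rows) (jobs sets (firstRow rows)) ws)))) (labels rows)} parseᵖ
    (printᵖ ∘ᵖ (map∘ {f = λ (_ , (i , (S , _))) → i , S} (fst∘ (snd∘ id∘) ,∘ fst∘ (snd∘ (snd∘ id∘)))
      (reverse∘ (placeᵖ ∘ᵖ (labels∘ (snd∘ (snd∘ id∘)) ,∘
        eventsᵖ′ ∘ᵖ ((fst∘ (fst∘ (snd∘ id∘)) ,∘ jobsᵖ ∘ᵖ (snd∘ (fst∘ (snd∘ id∘)) ,∘ firstRowᵖ ∘ᵖ snd∘ (snd∘ id∘))) ,∘ delayᵖ ∘ᵖ snd∘ (snd∘ id∘)))))
      ,∘ labels∘ (snd∘ (snd∘ id∘))))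

-- Finite sums with indicator terms.

module Sums where

  open import Data.List using (List; []; _∷_; map; _++_; length; downFrom)
  open import Data.List.Membership.Propositional using (_∈_)
  open import Data.List.Relation.Unary.Any using (here; there)
  open import Data.Nat
  open import Data.Nat.ListAction using (sum)
  open import Data.Nat.Properties
  open import Data.Nat.Tactic.RingSolver using (solve-∀)
  open import Relation.Binary.PropositionalEquality
  open import Relation.Nullary using (Dec; yes; no; ¬_; contradiction)
  open import Relation.Nullary.Decidable using (_×-dec_)
  open import Data.Product using (_×_; _,_; ∃-syntax)

  infixl 5 _when_

  -- The Iverson bracket, taken over a decision so that a case split reduces it.
  _when_ : ∀ {p} {P : Set p} → ℕ → Dec P → ℕ
  x when (yes _) = x
  x when (no _)  = 0

  when-≤ : ∀ {p} {P : Set p} x (d : Dec P) → x when d ≤ x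
  when-≤ x (yes _) = ≤-refl
  when-≤ x (no _)  = z≤n

  when-yes : ∀ {p} {P : Set p} x (d : Dec P) → P → x when d ≡ x
  when-yes x (yes _) p = refl
  when-yes x (no ¬p) p = contradiction p ¬p

  when-no : ∀ {p} {P : Set p} x (d : Dec P) → ¬ P → x when d ≡ 0
  when-no x (yes p) ¬p = contradiction p ¬p
  when-no x (no _)  ¬p = refl

  when-mono : ∀ {p} {P : Set p} {x y} (d : Dec P) → (P → x ≤ y) → x when d ≤ y when d
  when-mono (yes p) f = f p
  when-mono (no _)  f = z≤n

  *-when : ∀ {p} {P : Set p} m x (d : Dec P) → m * (x when d) ≡ m * x when d
  *-when m x (yes _) = refl
  *-when m x (no _)  = *-zeroʳ m

  ∑ : {A : Set} → List A → (A → ℕ) → ℕ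
  ∑ xs f = sum (map f xs)

  module _ {A : Set} where

    ∑-mono : ∀ (xs : List A) {f g} → (∀ {x} → x ∈ xs → f x ≤ g x) → ∑ xs f ≤ ∑ xs g
    ∑-mono []       h = z≤n
    ∑-mono (x ∷ xs) h = +-mono-≤ (h (here refl)) (∑-mono xs (λ p → h (there p)))

    ∑-cong : ∀ (xs : List A) {f g} → (∀ x → f x ≡ g x) → ∑ xs f ≡ ∑ xs g
    ∑-cong []       h = refl
    ∑-cong (x ∷ xs) h = cong₂ _+_ (h x) (∑-cong xs h)

    ∑-+ : ∀ (xs : List A) f g → ∑ xs (λ x → f x + g x) ≡ ∑ xs f + ∑ xs g
    ∑-+ []       f g = refl
    ∑-+ (x ∷ xs) f g = trans (cong (f x + g x +_) (∑-+ xs f g)) (arith (f x) (g x) (∑ xs f) (∑ xs g))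
      where
      arith : ∀ a b c d → a + b + (c + d) ≡ a + c + (b + d)
      arith = solve-∀

    ∑-* : ∀ (xs : List A) m f → ∑ xs (λ x → m * f x) ≡ m * ∑ xs f
    ∑-* []       m f = sym (*-zeroʳ m)
    ∑-* (x ∷ xs) m f = trans (cong (m * f x +_) (∑-* xs m f)) (sym (*-distribˡ-+ m (f x) _))

    ∑-zero : ∀ (xs : List A) → ∑ xs (λ _ → 0) ≡ 0
    ∑-zero []       = refl
    ∑-zero (x ∷ xs) = ∑-zero xs

    ∑-∈ : ∀ {xs : List A} {x} f → x ∈ xs → f x ≤ ∑ xs f
    ∑-∈ f (here refl) = m≤m+n _ _
    ∑-∈ f (there p)   = ≤-trans (∑-∈ f p) (m≤n+m _ _)

    ∑-++ : ∀ (xs ys : List A) f → ∑ (xs ++ ys) f ≡ ∑ xs f + ∑ ys f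
    ∑-++ []       ys f = refl
    ∑-++ (x ∷ xs) ys f = trans (cong (f x +_) (∑-++ xs ys f)) (sym (+-assoc (f x) _ _))

    ∑-map : ∀ {B : Set} (g : B → A) (xs : List B) f → ∑ (map g xs) f ≡ ∑ xs (λ x → f (g x))
    ∑-map g []       f = refl
    ∑-map g (x ∷ xs) f = cong (f (g x) +_) (∑-map g xs f)

    ∑-when : ∀ {p} {P : Set p} (xs : List A) f (d : Dec P) → ∑ xs (λ x → f x when d) ≡ ∑ xs f when d
    ∑-when xs f (yes _) = refl
    ∑-when xs f (no _)  = ∑-zero xs

  ∑-swap : ∀ {A B : Set} (xs : List A) (ys : List B) (f : A → B → ℕ) → ∑ xs (λ x → ∑ ys (f x)) ≡ ∑ ys (λ y → ∑ xs (λ x → f x y))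
  ∑-swap []       ys f = sym (∑-zero ys)
  ∑-swap (x ∷ xs) ys f = trans (cong (∑ ys (f x) +_) (∑-swap xs ys f)) (sym (∑-+ ys (f x) _))

  ∑-pos : ∀ {A : Set} (xs : List A) f → 0 < ∑ xs f → ∃[ x ] x ∈ xs × 0 < f x
  ∑-pos (x ∷ xs) f pos with f x in eq
  ... | suc _ = x , here refl , subst (0 <_) (sym eq) z<s
  ... | zero  = let y , p , q = ∑-pos xs f pos in y , there p , q

  ∑-mono-< : ∀ {A : Set} {xs : List A} {f g x} → (∀ {x} → x ∈ xs → f x ≤ g x) → x ∈ xs → f x < g x → ∑ xs f < ∑ xs g
  ∑-mono-< h (here refl) lt = +-mono-<-≤ lt (∑-mono _ (λ p → h (there p)))
  ∑-mono-< h (there p)   lt = +-mono-≤-< (h (here refl)) (∑-mono-< (λ p → h (there p)) p lt)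

  ∑-const : ∀ {A : Set} (xs : List A) m → ∑ xs (λ _ → m) ≡ m * length xs
  ∑-const []       m = sym (*-zeroʳ m)
  ∑-const (x ∷ xs) m = trans (cong (m +_) (∑-const xs m)) (sym (*-suc m (length xs)))

  ∑-downFrom-+ : ∀ T d f r → (∀ t → T ≤ t → f t ≡ r) → ∑ (downFrom (d + T)) f ≡ d * r + ∑ (downFrom T) f
  ∑-downFrom-+ T zero    f r h = refl
  ∑-downFrom-+ T (suc d) f r h = trans (cong₂ _+_ (h (d + T) (m≤n+m T d)) (∑-downFrom-+ T d f r h)) (sym (+-assoc r (d * r) _))

  ∑-before : ∀ T m y → ∑ (downFrom T) (λ t → y when (t <? m)) ≤ y * m
  ∑-before T m y = ≤-trans (≤-trans (go T) (*-monoʳ-≤ y (m⊓n≤n T m))) ≤-refl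
    where
    go : ∀ T → ∑ (downFrom T) (λ t → y when (t <? m)) ≤ y * (T ⊓ m)
    go zero    = z≤n
    go (suc T) with T <? m
    ... | yes T<m = begin
      y + ∑ (downFrom T) _   ≤⟨ +-monoʳ-≤ y (≤-trans (go T) (*-monoʳ-≤ y (m⊓n≤m T m))) ⟩
      y + y * T              ≡⟨ sym (*-suc y T) ⟩
      y * suc T              ≡⟨ cong (y *_) (sym (m≤n⇒m⊓n≡m T<m)) ⟩
      y * (suc T ⊓ m)        ∎
      where open ≤-Reasoning
    ... | no  _   = ≤-trans (go T) (*-monoʳ-≤ y (⊓-monoˡ-≤ m (n≤1+n T)))

  -- At most `l` summands, each below `s + l`. This bounds the moment of a processing interval by
  -- its length times its end.
  ∑-during : ∀ T s l → ∑ (downFrom T) (λ t → t when ((s ≤? t) ×-dec (t <? s + l))) ≤ l * (s + l)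
  ∑-during T s l = ≤-trans (go T) (*-monoˡ-≤ (s + l) (m⊓n≤n (T ∸ s) l))
    where
    go : ∀ T → ∑ (downFrom T) (λ t → t when ((s ≤? t) ×-dec (t <? s + l))) ≤ ((T ∸ s) ⊓ l) * (s + l)
    go zero    = z≤n
    go (suc T) with s ≤? T | T <? s + l
    ... | yes s≤T | yes T<s+l = begin
      T + ∑ (downFrom T) _                 ≤⟨ +-mono-≤ (<⇒≤ T<s+l) (≤-trans (go T) (*-monoˡ-≤ (s + l) (m⊓n≤m (T ∸ s) l))) ⟩
      suc (T ∸ s) * (s + l)                ≡⟨ cong (_* (s + l)) (trans (sym (+-∸-assoc 1 s≤T)) (sym (m≤n⇒m⊓n≡m lt))) ⟩
      ((suc T ∸ s) ⊓ l) * (s + l)          ∎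
      where
      open ≤-Reasoning
      lt : suc T ∸ s ≤ l
      lt = ≤-trans (∸-monoˡ-≤ s T<s+l) (≤-reflexive (m+n∸m≡n s l))
    ... | yes _ | no _  = ≤-trans (go T) (*-monoˡ-≤ (s + l) (⊓-monoˡ-≤ l (∸-monoˡ-≤ s (n≤1+n T))))
    ... | no _  | yes _ = ≤-trans (go T) (*-monoˡ-≤ (s + l) (⊓-monoˡ-≤ l (∸-monoˡ-≤ s (n≤1+n T))))
    ... | no _  | no _  = ≤-trans (go T) (*-monoˡ-≤ (s + l) (⊓-monoˡ-≤ l (∸-monoˡ-≤ s (n≤1+n T))))

-- Comparison of a greedy run with an arbitrary schedule.

module Analysis where

  open GreedyProgram using (module Greedy)
  open Sums
  open import Data.Bool using (Bool; true; false; if_then_else_; T)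
  open import Data.Bool.Properties using (T-≡)
  open import Data.Fin using (Fin; toℕ)
  open import Data.List using (List; []; _∷_; map; _++_; allFin; foldl; cartesianProduct; downFrom; length)
  open import Data.List.Properties using (length-tabulate; length-downFrom)
  open import Data.Nat.ListAction using (product)
  open import Data.List.Membership.Propositional using (_∈_)
  open import Data.List.Membership.Propositional.Properties using (∈-map⁺; ∈-cartesianProduct⁺; ∈-allFin; ∈-downFrom⁻)
  open import Data.List.Relation.Unary.All using ([]; _∷_; universal)
  open import Data.List.Relation.Unary.All.Properties using (map⁺)
  open import Data.List.Relation.Unary.Any using (here; there)
  open import Data.Nat
  open import Data.Nat.Divisibility using (_∣_; quotient)
  open import Data.Nat.ListAction.Properties using (∈⇒∣product; product≢0)
  open import Data.Nat.Properties
  open import Data.Nat.Tactic.RingSolver using (solve-∀)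
  open import Data.Product using (_×_; _,_; proj₁; proj₂; ∃-syntax)
  open import Data.Sum using (_⊎_; inj₁; inj₂)
  open import Data.Empty using (⊥)
  open import Data.Unit using (⊤; tt)
  open import Function using (Equivalence)
  open import Relation.Binary.PropositionalEquality
  open import Relation.Nullary using (Dec; yes; no; contradiction)
  open import Relation.Nullary.Decidable using (_×-dec_)

  module Virtual {n k mv : ℕ} (w : Fin n → ℕ) (cov : Fin k → Fin n → Bool)
                 (c : Fin k → Fin mv → ℕ) (c≥1 : ∀ S v → 1 ≤ c S v) (a : ℕ) where

    Job : Set
    Job = Fin mv × Fin k

    vm cost : Job → ℕ
    vm (v , S)   = toℕ v
    cost (v , S) = c S v

    covers : Job → Fin n → Bool
    covers (v , S) = cov S

    resid : List Job → Fin n → ℕ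
    resid []       u = w u
    resid (e ∷ es) u = if covers e u then 0 else resid es u

    part : (Fin n → ℕ) → Job → Fin n → ℕ
    part f x u = if covers x u then f u else 0

    W : List Job → Job → ℕ
    W es x = ∑ (allFin n) (part (resid es) x)

    open Greedy vm cost W a public

    allJobs : List Job
    allJobs = cartesianProduct (allFin mv) (allFin k)

    ∈-allJobs : ∀ x → x ∈ allJobs
    ∈-allJobs (v , S) = ∈-cartesianProduct⁺ (∈-allFin v) (∈-allFin S)

    cost≥1 : ∀ x → 1 ≤ cost x
    cost≥1 (v , S) = c≥1 S v

    Prefer : List Job → Job → Job → Set
    Prefer es x y = ready es x < ready es y ⊎ (ready es x ≡ ready es y × W es y * cost x ≤ W es x * cost y)

    Chosen : List Job → Job → Set
    Chosen es e = 0 < W es e × (∀ x → 0 < W es x → Prefer es e x)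

    data Trace : List Job → Set where
      []  : Trace []
      _∷_ : ∀ {e es} → Chosen es e → Trace es → Trace (e ∷ es)

    Exhausted : List Job → Set
    Exhausted es = ∀ x → W es x ≡ 0

    private
      -- Cross-multiplied densities compose because the cost in the middle is positive and can be
      -- cancelled.
      prefer-trans : ∀ {es x y z} → Prefer es x y → Prefer es y z → Prefer es x z
      prefer-trans (inj₁ p) (inj₁ q)       = inj₁ (<-trans p q)
      prefer-trans (inj₁ p) (inj₂ (e , _)) = inj₁ (<-≤-trans p (≤-reflexive e))
      prefer-trans (inj₂ (e , _)) (inj₁ q) = inj₁ (≤-<-trans (≤-reflexive e) q)
      prefer-trans {es} {x} {y} {z} (inj₂ (e , p)) (inj₂ (e′ , q)) = inj₂ (trans e e′ ,
        *-cancelʳ-≤ _ _ (cost y) {{>-nonZero (cost≥1 y)}} (begin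
          W es z * cost x * cost y   ≡⟨ arith (W es z) (cost x) (cost y) ⟩
          W es z * cost y * cost x   ≤⟨ *-monoˡ-≤ (cost x) q ⟩
          W es y * cost z * cost x   ≡⟨ arith (W es y) (cost z) (cost x) ⟩
          W es y * cost x * cost z   ≤⟨ *-monoˡ-≤ (cost z) p ⟩
          W es x * cost y * cost z   ≡⟨ arith (W es x) (cost y) (cost z) ⟩
          W es x * cost z * cost y   ∎))
        where
        open ≤-Reasoning
        arith : ∀ a b c → a * b * c ≡ a * c * b
        arith = solve-∀

      prefer-refl : ∀ es x → Prefer es x x
      prefer-refl es x = inj₂ (refl , ≤-refl)

      ≤ᵇ-true : ∀ {m n} → (m ≤ᵇ n) ≡ true → m ≤ n
      ≤ᵇ-true {m} {n} eq = ≤ᵇ⇒≤ m n (subst T (sym eq) tt)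

      ≤ᵇ-false : ∀ {m n} → (m ≤ᵇ n) ≡ false → n < m
      ≤ᵇ-false {m} {n} eq = ≰⇒> (λ le → subst T eq (≤⇒≤ᵇ le))

      beats-spec : ∀ es x y → (beats es x y ≡ true × Prefer es x y) ⊎ (beats es x y ≡ false × Prefer es y x)
      beats-spec es x y with ready es x ≤ᵇ ready es y in eq
      ... | false = inj₂ (refl , inj₁ (≤ᵇ-false eq))
      ... | true with ready es y ≤ᵇ ready es x in eq′
      ...   | false = inj₁ (refl , inj₁ (≤ᵇ-false eq′))
      ...   | true with W es y * cost x ≤ᵇ W es x * cost y in eq″
      ...     | true  = inj₁ (refl , inj₂ (≤-antisym (≤ᵇ-true eq) (≤ᵇ-true eq′) , ≤ᵇ-true eq″))
      ...     | false = inj₂ (refl , inj₂ (≤-antisym (≤ᵇ-true eq′) (≤ᵇ-true eq) , <⇒≤ (≤ᵇ-false eq″)))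

      -- P holds for the jobs that have been considered so far.
      Best : List Job → (Job → Set) → List Job → Set
      Best es P []          = ∀ x → P x → W es x ≡ 0
      Best es P (y ∷ [])    = 0 < W es y × (∀ x → P x → 0 < W es x → Prefer es y x)
      Best es P (_ ∷ _ ∷ _) = ⊥

      ≡ᵇ-true : ∀ {m} → (m ≡ᵇ 0) ≡ true → m ≡ 0
      ≡ᵇ-true {m} eq = ≡ᵇ⇒≡ m 0 (subst T (sym eq) tt)

      ≡ᵇ-false : ∀ {m} → (m ≡ᵇ 0) ≡ false → 0 < m
      ≡ᵇ-false {suc m} eq = z<s

      best-step : ∀ es P o x → Best es P o → Best es (λ z → P z ⊎ z ≡ x) (better es o x)
      best-step es P o x h with W es x ≡ᵇ 0 in eq
      best-step es P [] x h | true = λ { z (inj₁ p) → h z p ; z (inj₂ refl) → ≡ᵇ-true eq }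
      best-step es P (y ∷ []) x (pos , h) | true = pos ,
        λ { z (inj₁ p) z> → h z p z> ; z (inj₂ refl) z> → contradiction (≡ᵇ-true eq) (λ e → <⇒≢ z> (sym e)) }
      best-step es P [] x h | false = ≡ᵇ-false eq ,
        λ { z (inj₁ p) z> → contradiction (h z p) (λ e → <⇒≢ z> (sym e)) ; z (inj₂ refl) z> → prefer-refl es x }
      best-step es P (y ∷ []) x (pos , h) | false with beats-spec es x y
      ... | inj₁ (b , p) rewrite b = ≡ᵇ-false eq ,
        λ { z (inj₁ q) z> → prefer-trans {es} {x} {y} {z} p (h z q z>) ; z (inj₂ refl) z> → prefer-refl es x }
      ... | inj₂ (b , p) rewrite b = pos , λ { z (inj₁ q) z> → h z q z> ; z (inj₂ refl) z> → p }

      best-weaken : ∀ es {P Q : Job → Set} o → (∀ {x} → Q x → P x) → Best es P o → Best es Q o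
      best-weaken es []       i h         = λ x q → h x (i q)
      best-weaken es (y ∷ []) i (pos , h) = pos , λ x q → h x (i q)

      best-foldl : ∀ es P J o → Best es P o → Best es (λ z → P z ⊎ z ∈ J) (foldl (better es) o J)
      best-foldl es P []      o h = best-weaken es o (λ { (inj₁ p) → p ; (inj₂ ()) }) h
      best-foldl es P (x ∷ J) o h = best-weaken es (foldl (better es) o (x ∷ J))
        (λ { (inj₁ p) → inj₁ (inj₁ p) ; (inj₂ (here refl)) → inj₁ (inj₂ refl) ; (inj₂ (there p)) → inj₂ p })
        (best-foldl es _ J (better es o x) (best-step es P o x h))

    best-cases : ∀ es → (best allJobs es ≡ [] × Exhausted es) ⊎ (∃[ e ] best allJobs es ≡ e ∷ [] × Chosen es e)
    best-cases es with best allJobs es | best-foldl es (λ _ → ⊥) allJobs [] (λ x ())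
    ... | []     | h         = inj₁ (refl , λ x → h x (inj₂ (∈-allJobs x)))
    ... | e ∷ [] | (pos , h) = inj₂ (e , refl , pos , λ x → h x (inj₂ (∈-allJobs x)))

    resid-∷ : ∀ e es u → resid (e ∷ es) u ≤ resid es u
    resid-∷ e es u with covers e u
    ... | true  = z≤n
    ... | false = ≤-refl

    part-mono : ∀ {f g} x u → f u ≤ g u → part f x u ≤ part g x u
    part-mono x u le with covers x u
    ... | true  = le
    ... | false = z≤n

    W-∷ : ∀ e es x → W (e ∷ es) x ≤ W es x
    W-∷ e es x = ∑-mono (allFin n) λ {u} _ → part-mono {resid (e ∷ es)} {resid es} x u (resid-∷ e es u)

    private
      -- The potential that bounds the number of rounds: a chosen job has positive weight and so
      -- takes at least one element.
      alive : List Job → ℕ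
      alive es = ∑ (allFin n) (λ u → 1 when (0 <? resid es u))

      alive-∷ : ∀ e es → 0 < W es e → alive (e ∷ es) < alive es
      alive-∷ e es pos with ∑-pos (allFin n) (part (resid es) e) pos
      ... | u , u∈ , u> = ∑-mono-< (λ {u} _ → mono u) u∈ (strict u u>)
        where
        mono : ∀ u → (1 when (0 <? resid (e ∷ es) u)) ≤ (1 when (0 <? resid es u))
        mono u with 0 <? resid (e ∷ es) u
        ... | yes p = ≤-reflexive (sym (when-yes 1 (0 <? resid es u) (<-≤-trans p (resid-∷ e es u))))
        ... | no _  = z≤n
        strict : ∀ u → 0 < part (resid es) e u → (1 when (0 <? resid (e ∷ es) u)) < (1 when (0 <? resid es u))
        strict u u> with covers e u
        ... | true = ≤-reflexive (sym (when-yes 1 (0 <? resid es u) u>))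

      alive-0 : ∀ es → alive es ≤ 0 → Exhausted es
      alive-0 es le x with 0 <? W es x
      ... | no ¬p = n≤0⇒n≡0 (≮⇒≥ ¬p)
      ... | yes p with ∑-pos (allFin n) (part (resid es) x) p
      ...   | u , u∈ , u> = contradiction (≤-trans (≤-reflexive (sym (when-yes 1 (0 <? resid es u) (pos u u>)))) (≤-trans (∑-∈ _ u∈) le)) (λ ())
        where
        pos : ∀ u → 0 < part (resid es) x u → 0 < resid es u
        pos u u> with covers x u
        ... | true = u>

    module _ {A : Set} where

      private
        go : ∀ (l : List A) es → Trace es → Exhausted es ⊎ alive es ≤ length l →
             Trace (foldl (λ es _ → best allJobs es ++ es) es l) × Exhausted (foldl (λ es _ → best allJobs es ++ es) es l)
        go []      es tr (inj₁ ex) = tr , ex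
        go []      es tr (inj₂ le) = tr , alive-0 es le
        go (_ ∷ l) es tr h with best allJobs es | best-cases es
        ... | _ | inj₁ (refl , ex)    = go l es tr (inj₁ ex)
        ... | _ | inj₂ (e , refl , ch) = go l (e ∷ es) (ch ∷ tr) (inj₂ (bound h))
          where
          bound : Exhausted es ⊎ alive es ≤ suc (length l) → alive (e ∷ es) ≤ length l
          bound (inj₁ ex) = contradiction (ex e) (λ eq → <⇒≢ (proj₁ ch) (sym eq))
          bound (inj₂ le) = s≤s⁻¹ (≤-trans (alive-∷ e es (proj₁ ch)) le)

      events-trace : ∀ (l : List A) → n ≤ length l → Trace (events allJobs l) × Exhausted (events allJobs l)
      events-trace l n≤ = go l [] [] (inj₂ (≤-trans (≤-trans (∑-mono (allFin n) λ {u} _ → when-≤ 1 (0 <? w u))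
        (≤-reflexive (trans (∑-const (allFin n) 1) (trans (+-identityʳ _) (length-tabulate {n = n} (λ u → u)))))) n≤))

    finish : List Job → Job → ℕ
    finish es e = ready es e + cost e

    load-same : ∀ e es v → vm e ≡ v → load v (e ∷ es) ≡ finish es e
    load-same e es v refl rewrite Equivalence.to T-≡ (≡⇒≡ᵇ (vm e) (vm e) refl) = refl

    load-other : ∀ e es v → vm e ≢ v → load v (e ∷ es) ≡ load v es
    load-other e es v ne with vm e ≡ᵇ v in eq
    ... | false = refl
    ... | true  = contradiction (≡ᵇ⇒≡ (vm e) v (subst T (sym eq) tt)) ne

    load-mono : ∀ e es v → load v es ≤ load v (e ∷ es)
    load-mono e es v with vm e ≡ᵇ v
    ... | true  = ≤-trans (m≤m⊔n _ (a * cost e)) (m≤m+n _ (cost e))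
    ... | false = ≤-refl

    ready-mono : ∀ e es x → ready es x ≤ ready (e ∷ es) x
    ready-mono e es x = ⊔-monoˡ-≤ (a * cost x) (load-mono e es (vm x))

    b : ℕ
    b = suc a

    prefer-ready : ∀ {es x y} → Prefer es x y → ready es x ≤ ready es y
    prefer-ready (inj₁ p)       = <⇒≤ p
    prefer-ready (inj₂ (e , _)) = ≤-reflexive e

    -- Let s be the start of `e`. Since a * cost e ≤ s and t < s + cost e, also a * t ≤ b * s, and b
    -- * cost x ≤ t then gives a * cost x ≤ s. So `x` could have started by s as well, and `e` was
    -- preferred for its density.
    running : ∀ {es e} → Chosen es e → ∀ x t → vm e ≡ vm x → b * cost x ≤ t → t < finish es e →
              W es x * cost e ≤ W es e * cost x
    running {es} {e} (_ , h) x t same bx≤t t<f with 0 <? W es x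
    ... | no ¬p rewrite n≤0⇒n≡0 (≮⇒≥ ¬p) = z≤n
    ... | yes p with h x p
    ...   | inj₂ (_ , q) = q
    ...   | inj₁ lt = contradiction lt (≤⇒≯ (⊔-lub (≤-trans (≤-reflexive (cong (λ v → load v es) (sym same))) (m≤m⊔n _ _)) ax≤s))
      where
      s = ready es e
      ax≤s : a * cost x ≤ s
      ax≤s = *-cancelˡ-≤ b (begin
        b * (a * cost x)     ≡⟨ arith b a (cost x) ⟩
        a * (b * cost x)     ≤⟨ *-monoʳ-≤ a (≤-trans bx≤t (<⇒≤ t<f)) ⟩
        a * (s + cost e)     ≡⟨ *-distribˡ-+ a s (cost e) ⟩
        a * s + a * cost e   ≤⟨ +-monoʳ-≤ (a * s) (m≤n⊔m (load (vm e) es) (a * cost e)) ⟩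
        a * s + s            ≡⟨ +-comm (a * s) s ⟩
        b * s                ∎)
        where
        open ≤-Reasoning
        arith : ∀ b a c → b * (a * c) ≡ a * (b * c)
        arith = solve-∀

    D : ℕ
    D = product (map cost allJobs)

    D>0 : 0 < D
    D>0 = >-nonZero⁻¹ D {{product≢0 (map⁺ (universal (λ x → >-nonZero (cost≥1 x)) allJobs))}}

    quot : Job → ℕ
    quot x = quotient (∈⇒∣product (∈-map⁺ cost (∈-allJobs x)))

    quot-cost : ∀ x → D ≡ quot x * cost x
    quot-cost x = _∣_.equality (∈⇒∣product (∈-map⁺ cost (∈-allJobs x)))

    Record : Set
    Record = Job × (ℕ × ℕ)

    -- Start and gained weight of an event depend on the events before it. Storing them turns
    -- statements about a run into sums over a plain list.
    hist : List Job → List Record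
    hist []       = []
    hist (e ∷ es) = (e , (ready es e , W es e)) ∷ hist es

    Running : ℕ → ℕ → ℕ → Set
    Running s l t = s ≤ t × t < s + l

    running? : ∀ s l t → Dec (Running s l t)
    running? s l t = (s ≤? t) ×-dec (t <? s + l)

    -- Densities are multiplied by D to make them natural numbers.
    rate : ℕ → List Job → ℕ → ℕ
    rate v es t = ∑ (hist es) λ (e , (s , r)) → (quot e * r when (vm e ≟ v)) when running? s (cost e) t

    -- This is `running` scaled by `D`: the event, being in progress at time t, contributes its own
    -- density to the rate.
    dense : ∀ {es e} → Chosen es e → ∀ x t → vm e ≡ vm x → b * cost x ≤ t → ready es e ≤ t → t < finish es e →
            D * W es x ≤ cost x * rate (vm x) (e ∷ es) t
    dense {es} {e} ch x t same bx≤t s≤t t<f = begin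
      D * W es x                       ≡⟨ cong (_* W es x) (quot-cost e) ⟩
      quot e * cost e * W es x         ≡⟨ arith (quot e) (cost e) (W es x) ⟩
      quot e * (W es x * cost e)       ≤⟨ *-monoʳ-≤ (quot e) (running {es} {e} ch x t same bx≤t t<f) ⟩
      quot e * (W es e * cost x)       ≡⟨ arith′ (quot e) (W es e) (cost x) ⟩
      cost x * (quot e * W es e)       ≤⟨ *-monoʳ-≤ (cost x) (≤-trans (≤-reflexive (sym active)) (m≤m+n _ (rate (vm x) es t))) ⟩
      cost x * rate (vm x) (e ∷ es) t  ∎
      where
      open ≤-Reasoning
      arith : ∀ a b c → a * b * c ≡ a * (c * b)
      arith = solve-∀
      arith′ : ∀ a b c → a * (b * c) ≡ c * (a * b)
      arith′ = solve-∀
      active : ((quot e * W es e when (vm e ≟ vm x)) when running? (ready es e) (cost e) t) ≡ quot e * W es e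
      active = trans (when-yes _ (running? (ready es e) (cost e) t) (s≤t , t<f)) (when-yes _ (vm e ≟ vm x) same)

    rate-∷ : ∀ v e es t → rate v es t ≤ rate v (e ∷ es) t
    rate-∷ v e es t = m≤n+m _ _

    -- `κ` stamps an event with the time from which its elements count as taken: `ready` on several
    -- machines, `finish` on a single one.
    Latest : (List Job → Job → ℕ) → List Job → ℕ → Set
    Latest κ []       T = ⊤
    Latest κ (e ∷ es) T = κ es e ≤ T

    data Sorted (κ : List Job → Job → ℕ) : List Job → Set where
      []  : Sorted κ []
      _∷_ : ∀ {e es} → Latest κ es (κ es e) → Sorted κ es → Sorted κ (e ∷ es)

    -- The later job had no less weight in the earlier round, so it was a candidate there and lost;
    -- its possible start was not smaller then and only increases afterwards.
    start-sorted : ∀ {es} → Trace es → Sorted ready es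
    start-sorted []        = []
    start-sorted (ch ∷ tr) = latest ch tr ∷ start-sorted tr
      where
      latest : ∀ {e es} → Chosen es e → Trace es → Latest ready es (ready es e)
      latest ch []        = tt
      latest {e} {e′ ∷ es} ch (ch′ ∷ tr) = ≤-trans (prefer-ready {es} {e′} {e} (proj₂ ch′ e (<-≤-trans (proj₁ ch) (W-∷ e′ es e)))) (ready-mono e′ es e)

    latest-trans : ∀ {κ} es {s t} → Latest κ es s → s ≤ t → Latest κ es t
    latest-trans []       l s≤t = tt
    latest-trans (e ∷ es) l s≤t = ≤-trans l s≤t

    -- Stamps being sorted, the first listed event that is stamped by `t` determines what is untaken
    -- at time `t`.
    rem : (List Job → Job → ℕ) → List Job → ℕ → Fin n → ℕ
    rem κ []       t u = w u
    rem κ (e ∷ es) t u = if κ es e ≤ᵇ t then resid (e ∷ es) u else rem κ es t u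

    rem-≤ : ∀ κ e es t u → κ es e ≤ t → rem κ (e ∷ es) t u ≡ resid (e ∷ es) u
    rem-≤ κ e es t u le rewrite Equivalence.to T-≡ (≤⇒≤ᵇ le) = refl

    rem-> : ∀ κ e es t u → t < κ es e → rem κ (e ∷ es) t u ≡ rem κ es t u
    rem-> κ e es t u lt with κ es e ≤ᵇ t in eq
    ... | true  = contradiction (≤ᵇ-true eq) (<⇒≱ lt)
    ... | false = refl

    rem-latest : ∀ κ es t u → Latest κ es t → rem κ es t u ≡ resid es u
    rem-latest κ []       t u l = refl
    rem-latest κ (e ∷ es) t u l = rem-≤ κ e es t u l

    resid≤w : ∀ es u → resid es u ≤ w u
    resid≤w []       u = ≤-refl
    resid≤w (e ∷ es) u = ≤-trans (resid-∷ e es u) (resid≤w es u)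

    rem≤w : ∀ κ es t u → rem κ es t u ≤ w u
    rem≤w κ []       t u = ≤-refl
    rem≤w κ (e ∷ es) t u with κ es e ≤ᵇ t
    ... | true  = resid≤w (e ∷ es) u
    ... | false = rem≤w κ es t u

    -- The events are complete up to time `t`: whatever could still be chosen starts later. An
    -- exhausted run satisfies this for all times, and removing the latest event preserves it for
    -- the times before its start.
    Idle : List Job → ℕ → Set
    Idle es t = ∀ x → 0 < W es x → t < ready es x

    idle-before : ∀ {es e t} → Chosen es e → t < ready es e → Idle es t
    idle-before {es} {e} ch lt x x> = <-≤-trans lt (prefer-ready {es} {e} {x} (proj₂ ch x x>))

    Rated : (List Job → Job → ℕ) → List Job → ℕ → Job → Set
    Rated κ es t x = D * ∑ (allFin n) (part (rem κ es t) x) ≤ cost x * rate (vm x) es t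

    private
      part-cong : ∀ {f g : Fin n → ℕ} x → (∀ u → f u ≡ g u) → ∑ (allFin n) (part f x) ≡ ∑ (allFin n) (part g x)
      part-cong {f} {g} x eq = ∑-cong (allFin n) λ u → cong (λ z → if covers x u then z else 0) (eq u)

      a*≤t : ∀ x {t} → b * cost x ≤ t → a * cost x ≤ t
      a*≤t x le = ≤-trans (m≤n+m (a * cost x) (cost x)) le

      -- The latest event on the machine of `x` is still in progress at time t. Events chosen after
      -- it, on other machines, only lower the weight of `x`.
      busy : ∀ {es} → Trace es → ∀ x t → b * cost x ≤ t → Sorted ready es → Latest ready es t → t < load (vm x) es →
             D * W es x ≤ cost x * rate (vm x) es t
      busy {e ∷ es} (ch ∷ tr) x t bx≤t (l ∷ so) s≤t t<L = go (vm e ≟ vm x)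
        where
        open ≤-Reasoning
        go : Dec (vm e ≡ vm x) → D * W (e ∷ es) x ≤ cost x * rate (vm x) (e ∷ es) t
        go (yes same) = ≤-trans (*-monoʳ-≤ D (W-∷ e es x)) (dense {es} {e} ch x t same bx≤t s≤t (subst (t <_) (load-same e es (vm x) same) t<L))
        go (no other) = begin
          D * W (e ∷ es) x                ≤⟨ *-monoʳ-≤ D (W-∷ e es x) ⟩
          D * W es x                      ≤⟨ busy tr x t bx≤t so (latest-trans {ready} es l s≤t) (subst (t <_) (load-other e es (vm x) other) t<L) ⟩
          cost x * rate (vm x) es t       ≤⟨ *-monoʳ-≤ (cost x) (rate-∷ (vm x) e es t) ⟩
          cost x * rate (vm x) (e ∷ es) t ∎

      -- A job with weight left starts after t. Its delay a * cost x is over by then, so the load of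
      -- its machine must be the cause.
      busy-or-done : ∀ es x t → b * cost x ≤ t → Idle es t → W es x ≡ 0 ⊎ t < load (vm x) es
      busy-or-done es x t bx≤t idle with 0 <? W es x
      ... | no ¬p = inj₁ (n≤0⇒n≡0 (≮⇒≥ ¬p))
      ... | yes p with ≤-total (load (vm x) es) (a * cost x)
      ...   | inj₁ le = contradiction (subst (t <_) (m≤n⇒m⊔n≡n le) (idle x p)) (≤⇒≯ (a*≤t x bx≤t))
      ...   | inj₂ le = inj₂ (subst (t <_) (m≥n⇒m⊔n≡m le) (idle x p))

      rated-zero : ∀ {m} D c r → m ≡ 0 → D * m ≤ c * r
      rated-zero D c r refl = ≤-trans (≤-reflexive (*-zeroʳ D)) z≤n

      rated-∷ : ∀ κ e es t x → t < κ es e → Rated κ es t x → Rated κ (e ∷ es) t x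
      rated-∷ κ e es t x lt r = begin
        D * ∑ (allFin n) (part (rem κ (e ∷ es) t) x)  ≡⟨ cong (D *_) (part-cong x (λ u → rem-> κ e es t u lt)) ⟩
        D * ∑ (allFin n) (part (rem κ es t) x)        ≤⟨ r ⟩
        cost x * rate (vm x) es t                     ≤⟨ *-monoʳ-≤ (cost x) (rate-∷ (vm x) e es t) ⟩
        cost x * rate (vm x) (e ∷ es) t               ∎
        where open ≤-Reasoning

      rated-latest : ∀ κ es t x → Latest κ es t → D * W es x ≤ cost x * rate (vm x) es t → Rated κ es t x
      rated-latest κ es t x l h = ≤-trans (≤-reflexive (cong (D *_) (part-cong x (λ u → rem-latest κ es t u l)))) h

    -- Events that start after t are peeled off until the latest one has started by t; then `busy`
    -- applies.
    rated-start : ∀ {es} → Trace es → ∀ t x → b * cost x ≤ t → Idle es t → Rated ready es t x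
    rated-start [] t x bx≤t idle with busy-or-done [] x t bx≤t idle
    ... | inj₁ eq = rated-zero D (cost x) 0 eq
    ... | inj₂ ()
    rated-start {e ∷ es} (ch ∷ tr) t x bx≤t idle = go (ready es e ≤? t)
      where
      now : ready es e ≤ t → W (e ∷ es) x ≡ 0 ⊎ t < load (vm x) (e ∷ es) → Rated ready (e ∷ es) t x
      now s≤t (inj₁ eq)  = rated-latest ready (e ∷ es) t x s≤t (rated-zero D (cost x) (rate (vm x) (e ∷ es) t) eq)
      now s≤t (inj₂ t<L) = rated-latest ready (e ∷ es) t x s≤t (busy (ch ∷ tr) x t bx≤t (start-sorted (ch ∷ tr)) s≤t t<L)
      go : Dec (ready es e ≤ t) → Rated ready (e ∷ es) t x
      go (no s≰t)  = rated-∷ ready e es t x (≰⇒> s≰t) (rated-start tr t x bx≤t (idle-before {es} {e} ch (≰⇒> s≰t)))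
      go (yes s≤t) = now s≤t (busy-or-done (e ∷ es) x t bx≤t idle)

    module _ (single : ∀ x y → vm x ≡ vm y) where

      latest-finish : ∀ es e → Latest finish es (ready es e)
      latest-finish []        e = tt
      latest-finish (e′ ∷ es) e = ≤-trans (≤-reflexive (sym (load-same e′ es (vm e) (single e′ e)))) (m≤m⊔n _ _)

      finish-sorted : ∀ es → Sorted finish es
      finish-sorted []       = []
      finish-sorted (e ∷ es) = latest-trans {finish} es (latest-finish es e) (m≤m+n _ (cost e)) ∷ finish-sorted es

      -- On a single machine only the latest event can be in progress at time t, and `dense` bounds
      -- the weight before its choice. So its own elements may count as untaken until it finishes.
      rated-finish : ∀ {es} → Trace es → ∀ t x → b * cost x ≤ t → Idle es t → Rated finish es t x
      rated-finish [] t x bx≤t idle with busy-or-done [] x t bx≤t idle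
      ... | inj₁ eq = rated-zero D (cost x) 0 eq
      ... | inj₂ ()
      rated-finish {e ∷ es} (ch ∷ tr) t x bx≤t idle = go (finish es e ≤? t) (ready es e ≤? t)
        where
        now : finish es e ≤ t → W (e ∷ es) x ≡ 0 ⊎ t < load (vm x) (e ∷ es) → Rated finish (e ∷ es) t x
        now f≤t (inj₁ eq)  = rated-latest finish (e ∷ es) t x f≤t (rated-zero D (cost x) (rate (vm x) (e ∷ es) t) eq)
        now f≤t (inj₂ t<L) = contradiction f≤t (<⇒≱ (subst (t <_) (load-same e es (vm x) (single e x)) t<L))
        go : Dec (finish es e ≤ t) → Dec (ready es e ≤ t) → Rated finish (e ∷ es) t x
        go (yes f≤t) _         = now f≤t (busy-or-done (e ∷ es) x t bx≤t idle)
        go (no f≰t)  (no s≰t)  = rated-∷ finish e es t x (≰⇒> f≰t) (rated-finish tr t x bx≤t (idle-before {es} {e} ch (≰⇒> s≰t)))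
        go (no f≰t)  (yes s≤t) = ≤-trans
          (≤-reflexive (cong (D *_) (part-cong x (λ u → trans (rem-> finish e es t u (≰⇒> f≰t))
                                                              (rem-latest finish es t u (latest-trans {finish} es (latest-finish es e) s≤t))))))
          (dense {es} {e} ch x t (single e x) bx≤t s≤t (≰⇒> f≰t))

    -- Only the event that covers `u` first has a nonzero term, so this is the weight of `u` times
    -- the stamp of that event.
    φ : (List Job → Job → ℕ) → List Job → Fin n → ℕ
    φ κ []       u = 0
    φ κ (e ∷ es) u = part (resid es) e u * κ es e + φ κ es u

    -- Layer-cake summation: weight times stamp is the untaken weight summed over time. After the
    -- latest stamp the untaken weight is constant; induction over the events treats the times
    -- before it.
    φ-rem : ∀ κ {es} → Sorted κ es → ∀ T u → Latest κ es T →
            φ κ es u + resid es u * T ≤ ∑ (downFrom T) (λ t → rem κ es t u)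
    φ-rem κ {[]} [] T u l = ≤-reflexive (sym (trans (∑-const (downFrom T) (w u)) (cong (w u *_) (length-downFrom T))))
    φ-rem κ {e ∷ es} (l ∷ so) T u K≤T = begin
      part (resid es) e u * K + φ κ es u + r * T
        ≡⟨ cong (λ T → part (resid es) e u * K + φ κ es u + r * T) (sym T≡) ⟩
      part (resid es) e u * K + φ κ es u + r * (d + K)
        ≡⟨ arith (part (resid es) e u) K (φ κ es u) r d ⟩
      d * r + (φ κ es u + (part (resid es) e u + r) * K)
        ≡⟨ cong (λ z → d * r + (φ κ es u + z * K)) split ⟩
      d * r + (φ κ es u + resid es u * K)
        ≤⟨ +-monoʳ-≤ (d * r) (φ-rem κ so K u l) ⟩
      d * r + ∑ (downFrom K) (λ t → rem κ es t u)
        ≤⟨ +-monoʳ-≤ (d * r) (∑-mono (downFrom K) λ {t} t∈ → ≤-reflexive (sym (rem-> κ e es t u (∈-downFrom⁻ t∈)))) ⟩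
      d * r + ∑ (downFrom K) (λ t → rem κ (e ∷ es) t u)
        ≡⟨ sym (∑-downFrom-+ K d (λ t → rem κ (e ∷ es) t u) r (λ t → rem-≤ κ e es t u)) ⟩
      ∑ (downFrom (d + K)) (λ t → rem κ (e ∷ es) t u)
        ≡⟨ cong (λ T → ∑ (downFrom T) (λ t → rem κ (e ∷ es) t u)) T≡ ⟩
      ∑ (downFrom T) (λ t → rem κ (e ∷ es) t u) ∎
      where
      open ≤-Reasoning
      K = κ es e
      d = T ∸ K
      r = resid (e ∷ es) u
      T≡ : d + K ≡ T
      T≡ = m∸n+n≡m K≤T
      split : part (resid es) e u + r ≡ resid es u
      split with covers e u
      ... | true  = +-identityʳ _
      ... | false = refl
      arith : ∀ p k f r d → p * k + f + r * (d + k) ≡ d * r + (f + (p + r) * k)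
      arith = solve-∀

    horizon : (List Job → Job → ℕ) → List Job → ℕ
    horizon κ []       = 0
    horizon κ (e ∷ es) = κ es e

    latest-horizon : ∀ κ es → Latest κ es (horizon κ es)
    latest-horizon κ []       = tt
    latest-horizon κ (e ∷ es) = ≤-refl

    total : List Job → ℕ
    total es = ∑ (allFin n) (φ finish es)

    private
      total-hist : ∀ es → ∑ (hist es) (λ (e , (s , r)) → r * (s + cost e)) ≡ total es
      total-hist []       = sym (∑-zero (allFin n))
      total-hist (e ∷ es) = trans
        (cong₂ _+_ (trans (*-comm (W es e) f) (trans (sym (∑-* (allFin n) f (part (resid es) e)))
                          (∑-cong (allFin n) (λ u → *-comm f (part (resid es) e u))))) (total-hist es))
        (sym (∑-+ (allFin n) (λ u → part (resid es) e u * f) (φ finish es)))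
        where f = finish es e

    -- What the comparison needs of another schedule. By `capacity` the jobs that it has finished by
    -- t / b on one virtual machine cost at most t / q together.
    record Rival (q : ℕ) : Set₁ where
      field
        Slot     : Set
        slots    : List Slot
        job      : Slot → Job
        fin      : Slot → ℕ
        slot     : Fin n → Slot
        slot∈    : ∀ u → slot u ∈ slots
        slot-cov : ∀ u → covers (job (slot u)) u ≡ true
        long     : ∀ x → cost (job x) ≤ fin x
        capacity : ∀ v t → q * ∑ slots (λ x → (cost (job x) when (v ≟ vm (job x))) when (b * fin x ≤? t)) ≤ t

      rivalCost : ℕ
      rivalCost = ∑ (allFin n) (λ u → w u * fin (slot u))

    module _ {q : ℕ} (rival : Rival q) where
      open Rival rival

      private
        -- Exchanging the sums, an event in progress is charged by the due slots of its machine, and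
        -- `capacity` bounds their total cost by t / q.
        late : ∀ es t → q * ∑ slots (λ x → (cost (job x) * rate (vm (job x)) es t) when (b * fin x ≤? t))
               ≤ ∑ (hist es) (λ (e , (s , r)) → quot e * r * (t when running? s (cost e) t))
        late es t = begin
          q * ∑ slots (λ x → (cost (job x) * rate (vm (job x)) es t) when (b * fin x ≤? t))
            ≡⟨ cong (q *_) (∑-cong slots λ x → trans (cong (_when (b * fin x ≤? t)) (sym (∑-* (hist es) (cost (job x)) _)))
                                                (sym (∑-when (hist es) _ (b * fin x ≤? t)))) ⟩
          q * ∑ slots (λ x → ∑ (hist es) (λ h → load-of x h when (b * fin x ≤? t)))
            ≡⟨ cong (q *_) (∑-swap slots (hist es) _) ⟩
          q * ∑ (hist es) (λ h → ∑ slots (λ x → load-of x h when (b * fin x ≤? t)))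
            ≡⟨ sym (∑-* (hist es) q _) ⟩
          ∑ (hist es) (λ h → q * ∑ slots (λ x → load-of x h when (b * fin x ≤? t)))
            ≤⟨ ∑-mono (hist es) (λ {h} _ → event h) ⟩
          ∑ (hist es) (λ (e , (s , r)) → quot e * r * (t when running? s (cost e) t)) ∎
          where
          open ≤-Reasoning
          load-of : Slot → Record → ℕ
          load-of x (e , (s , r)) = cost (job x) * ((quot e * r when (vm e ≟ vm (job x))) when running? s (cost e) t)
          event : ∀ h → q * ∑ slots (λ x → load-of x h when (b * fin x ≤? t)) ≤
                  quot (proj₁ h) * proj₂ (proj₂ h) * (t when running? (proj₁ (proj₂ h)) (cost (proj₁ h)) t)
          event (e , (s , r)) = go (running? s (cost e) t)
            where
            y = quot e * r
            pull : ∀ {P Q : Set} c (d : Dec P) (d′ : Dec Q) → (c * (y when d)) when d′ ≡ y * ((c when d) when d′)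
            pull c (yes _) (yes _) = *-comm c y
            pull c (yes _) (no _)  = sym (*-zeroʳ y)
            pull c (no _)  (yes _) = trans (*-zeroʳ c) (sym (*-zeroʳ y))
            pull c (no _)  (no _)  = sym (*-zeroʳ y)
            none : ∀ {P : Set} c (d : Dec P) → (c * 0) when d ≡ 0
            none c (yes _) = *-zeroʳ c
            none c (no _)  = refl
            arith : ∀ q y s → q * (y * s) ≡ y * (q * s)
            arith = solve-∀
            go : ∀ {R : Set} (d : Dec R) → q * ∑ slots (λ x → (cost (job x) * ((y when (vm e ≟ vm (job x))) when d)) when (b * fin x ≤? t)) ≤ y * (t when d)
            go (no _) = ≤-trans (≤-reflexive (trans (cong (q *_) (trans (∑-cong slots λ x → none (cost (job x)) (b * fin x ≤? t)) (∑-zero slots))) (*-zeroʳ q))) z≤n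
            go (yes _) = begin
              q * ∑ slots (λ x → (cost (job x) * (y when (vm e ≟ vm (job x)))) when (b * fin x ≤? t))
                ≡⟨ cong (q *_) (trans (∑-cong slots λ x → pull (cost (job x)) (vm e ≟ vm (job x)) (b * fin x ≤? t)) (∑-* slots y _)) ⟩
              q * (y * ∑ slots (λ x → (cost (job x) when (vm e ≟ vm (job x))) when (b * fin x ≤? t)))
                ≡⟨ arith q y _ ⟩
              y * (q * ∑ slots (λ x → (cost (job x) when (vm e ≟ vm (job x))) when (b * fin x ≤? t)))
                ≤⟨ *-monoʳ-≤ y (capacity (vm e) t) ⟩
              y * t ∎

        -- An event is charged at its density during its processing, at times before its finish.
        -- Density times cost is its weight, so the charge is at most weight times finish time.
        work : ∀ es T → ∑ (downFrom T) (λ t → ∑ (hist es) (λ (e , (s , r)) → quot e * r * (t when running? s (cost e) t))) ≤ D * total es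
        work es T = begin
          ∑ (downFrom T) (λ t → ∑ (hist es) (λ (e , (s , r)) → quot e * r * (t when running? s (cost e) t)))
            ≡⟨ ∑-swap (downFrom T) (hist es) (λ t (e , (s , r)) → quot e * r * (t when running? s (cost e) t)) ⟩
          ∑ (hist es) (λ (e , (s , r)) → ∑ (downFrom T) (λ t → quot e * r * (t when running? s (cost e) t)))
            ≤⟨ ∑-mono (hist es) (λ {h} _ → event h) ⟩
          ∑ (hist es) (λ (e , (s , r)) → D * (r * (s + cost e)))
            ≡⟨ ∑-* (hist es) D _ ⟩
          D * ∑ (hist es) (λ (e , (s , r)) → r * (s + cost e))
            ≡⟨ cong (D *_) (total-hist es) ⟩
          D * total es ∎
          where
          open ≤-Reasoning
          arith : ∀ q r c f → q * r * (c * f) ≡ q * c * (r * f)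
          arith = solve-∀
          event : ∀ (h : Record) → ∑ (downFrom T) (λ t → quot (proj₁ h) * proj₂ (proj₂ h) * (t when running? (proj₁ (proj₂ h)) (cost (proj₁ h)) t))
                  ≤ D * (proj₂ (proj₂ h) * (proj₁ (proj₂ h) + cost (proj₁ h)))
          event (e , (s , r)) = begin
            ∑ (downFrom T) (λ t → quot e * r * (t when running? s (cost e) t))   ≡⟨ ∑-* (downFrom T) (quot e * r) _ ⟩
            quot e * r * ∑ (downFrom T) (λ t → t when running? s (cost e) t)     ≤⟨ *-monoʳ-≤ (quot e * r) (∑-during T s (cost e)) ⟩
            quot e * r * (cost e * (s + cost e))                                 ≡⟨ arith (quot e) r (cost e) (s + cost e) ⟩
            quot e * cost e * (r * (s + cost e))                                 ≡⟨ cong (_* (r * (s + cost e))) (sym (quot-cost e)) ⟩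
            D * (r * (s + cost e))                                               ∎

        -- A union bound: every due element lies in the job of its own slot, which is due as well.
        due : ∀ κ es t → ∑ (allFin n) (λ u → rem κ es t u when (b * fin (slot u) ≤? t)) ≤
              ∑ slots (λ x → ∑ (allFin n) (part (rem κ es t) (job x)) when (b * fin x ≤? t))
        due κ es t = begin
          ∑ (allFin n) (λ u → rem κ es t u when (b * fin (slot u) ≤? t))
            ≤⟨ ∑-mono (allFin n) (λ {u} _ → ≤-trans (≤-reflexive (cong (_when (b * fin (slot u) ≤? t)) (sym (own u))))
                 (∑-∈ (λ x → part (rem κ es t) (job x) u when (b * fin x ≤? t)) (slot∈ u))) ⟩
          ∑ (allFin n) (λ u → ∑ slots (λ x → part (rem κ es t) (job x) u when (b * fin x ≤? t)))
            ≡⟨ ∑-swap (allFin n) slots _ ⟩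
          ∑ slots (λ x → ∑ (allFin n) (λ u → part (rem κ es t) (job x) u when (b * fin x ≤? t)))
            ≡⟨ ∑-cong slots (λ x → ∑-when (allFin n) _ (b * fin x ≤? t)) ⟩
          ∑ slots (λ x → ∑ (allFin n) (part (rem κ es t) (job x)) when (b * fin x ≤? t)) ∎
          where
          open ≤-Reasoning
          own : ∀ u → part (rem κ es t) (job (slot u)) u ≡ rem κ es t u
          own u rewrite slot-cov u = refl

      -- At each time the untaken weight is split by whether the rival has finished the slot of the
      -- element by t / b. The unfinished part sums to at most b times the rival cost; the rest is
      -- bounded through `due`, the rating, `late` and `work`.
      balance : ∀ κ {es} → Sorted κ es → (∀ t x → b * cost x ≤ t → Rated κ es t x) →
                q * ∑ (allFin n) (φ κ es) ≤ total es + q * (b * rivalCost)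
      balance κ {es} so rated = *-cancelˡ-≤ D {{>-nonZero D>0}} (begin
        D * (q * ∑ (allFin n) (φ κ es))
          ≤⟨ *-monoʳ-≤ D (*-monoʳ-≤ q (∑-mono (allFin n) λ {u} _ → ≤-trans (m≤m+n _ _) (φ-rem κ so H u (latest-horizon κ es)))) ⟩
        D * (q * ∑ (allFin n) (λ u → ∑ (downFrom H) (λ t → rem κ es t u)))
          ≤⟨ *-monoʳ-≤ D (*-monoʳ-≤ q (∑-mono (allFin n) λ {u} _ → ∑-mono (downFrom H) λ {t} _ → split u t)) ⟩
        D * (q * ∑ (allFin n) (λ u → ∑ (downFrom H) (λ t → (rem κ es t u when (b * fin (slot u) ≤? t)) + (w u when (t <? b * fin (slot u))))))
          ≡⟨ cong (λ z → D * (q * z)) (trans (∑-cong (allFin n) λ u → ∑-+ (downFrom H) _ _) (∑-+ (allFin n) _ _)) ⟩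
        D * (q * (∑ (allFin n) (λ u → ∑ (downFrom H) (λ t → rem κ es t u when (b * fin (slot u) ≤? t)))
                + ∑ (allFin n) (λ u → ∑ (downFrom H) (λ t → w u when (t <? b * fin (slot u))))))
          ≤⟨ *-monoʳ-≤ D (*-monoʳ-≤ q (+-mono-≤ (≤-reflexive (∑-swap (allFin n) (downFrom H) _)) early)) ⟩
        D * (q * (∑ (downFrom H) (λ t → ∑ (allFin n) (λ u → rem κ es t u when (b * fin (slot u) ≤? t))) + b * rivalCost))
          ≡⟨ arith D q _ (b * rivalCost) ⟩
        q * (D * ∑ (downFrom H) (λ t → ∑ (allFin n) (λ u → rem κ es t u when (b * fin (slot u) ≤? t)))) + D * (q * (b * rivalCost))
          ≤⟨ +-monoˡ-≤ _ main ⟩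
        D * total es + D * (q * (b * rivalCost))
          ≡⟨ sym (*-distribˡ-+ D (total es) _) ⟩
        D * (total es + q * (b * rivalCost)) ∎)
        where
        open ≤-Reasoning
        H = horizon κ es
        arith : ∀ D q a r → D * (q * (a + r)) ≡ q * (D * a) + D * (q * r)
        arith = solve-∀
        split : ∀ u t → rem κ es t u ≤ (rem κ es t u when (b * fin (slot u) ≤? t)) + (w u when (t <? b * fin (slot u)))
        split u t with b * fin (slot u) ≤? t | t <? b * fin (slot u)
        ... | yes _ | _     = m≤m+n _ _
        ... | no _  | yes _ = rem≤w κ es t u
        ... | no ¬p | no ¬q = contradiction (≮⇒≥ ¬q) ¬p
        early : ∑ (allFin n) (λ u → ∑ (downFrom H) (λ t → w u when (t <? b * fin (slot u)))) ≤ b * rivalCost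
        early = begin
          ∑ (allFin n) (λ u → ∑ (downFrom H) (λ t → w u when (t <? b * fin (slot u))))
            ≤⟨ ∑-mono (allFin n) (λ {u} _ → ∑-before H (b * fin (slot u)) (w u)) ⟩
          ∑ (allFin n) (λ u → w u * (b * fin (slot u)))
            ≡⟨ ∑-cong (allFin n) (λ u → swap (w u) b (fin (slot u))) ⟩
          ∑ (allFin n) (λ u → b * (w u * fin (slot u)))
            ≡⟨ ∑-* (allFin n) b _ ⟩
          b * rivalCost ∎
          where
          swap : ∀ w b f → w * (b * f) ≡ b * (w * f)
          swap = solve-∀
        main : q * (D * ∑ (downFrom H) (λ t → ∑ (allFin n) (λ u → rem κ es t u when (b * fin (slot u) ≤? t)))) ≤ D * total es
        main = begin
          q * (D * ∑ (downFrom H) (λ t → ∑ (allFin n) (λ u → rem κ es t u when (b * fin (slot u) ≤? t))))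
            ≤⟨ *-monoʳ-≤ q (*-monoʳ-≤ D (∑-mono (downFrom H) λ {t} _ → due κ es t)) ⟩
          q * (D * ∑ (downFrom H) (λ t → ∑ slots (λ x → ∑ (allFin n) (part (rem κ es t) (job x)) when (b * fin x ≤? t))))
            ≡⟨ cong (q *_) (trans (sym (∑-* (downFrom H) D _)) (∑-cong (downFrom H) λ t → trans (sym (∑-* slots D _))
                 (∑-cong slots λ x → *-when D _ (b * fin x ≤? t)))) ⟩
          q * ∑ (downFrom H) (λ t → ∑ slots (λ x → (D * ∑ (allFin n) (part (rem κ es t) (job x))) when (b * fin x ≤? t)))
            ≤⟨ *-monoʳ-≤ q (∑-mono (downFrom H) λ {t} _ → ∑-mono slots λ {x} _ → when-mono (b * fin x ≤? t)
                 (λ le → rated t (job x) (≤-trans (*-monoʳ-≤ b (long x)) le))) ⟩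
          q * ∑ (downFrom H) (λ t → ∑ slots (λ x → (cost (job x) * rate (vm (job x)) es t) when (b * fin x ≤? t)))
            ≡⟨ sym (∑-* (downFrom H) q _) ⟩
          ∑ (downFrom H) (λ t → q * ∑ slots (λ x → (cost (job x) * rate (vm (job x)) es t) when (b * fin x ≤? t)))
            ≤⟨ ∑-mono (downFrom H) (λ {t} _ → late es t) ⟩
          ∑ (downFrom H) (λ t → ∑ (hist es) (λ (e , (s , r)) → quot e * r * (t when running? s (cost e) t)))
            ≤⟨ work es H ⟩
          D * total es ∎

    exhausted-idle : ∀ es t → Exhausted es → Idle es t
    exhausted-idle es t ex x x> = contradiction (ex x) (λ eq → <⇒≢ x> (sym eq))

-- Schedules, their covering times, and the existence of a cheapest one.

module Schedules where

  open import Defs hiding (_≤ℝ_; _<ℝ_)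
  open Sums
  open import Data.Fin as Fin using (Fin; toℕ)
  import Data.Fin.Properties as Fin
  open import Data.Fin.Subset using () renaming (_∈_ to _∈ˢ_)
  open import Data.Fin.Subset.Properties using (_∈?_)
  open import Data.List as List using (List; []; _∷_; _++_; map; filter; concatMap; allFin; length; lookup; take; cartesianProduct)
  open import Data.List.Extrema.Nat using (argmin; min≤v⁺; argmin-sel; f[argmin]≤f[xs])
  open import Data.List.Membership.Propositional using (_∈_; lose)
  open import Data.List.Membership.Propositional.Properties
    using (∈-map⁺; ∈-map⁻; ∈-filter⁺; ∈-filter⁻; ∈-concatMap⁺; ∈-allFin; ∈-lookup; ∈-cartesianProduct⁺)
  open import Data.List.Properties using (map-++; filter-++; filter-accept; filter-reject; map-tabulate; map-∘; map-concatMap; map-id; concatMap-cong; ++-identityʳ; length-map)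
  open import Data.List.Relation.Binary.Disjoint.Propositional using (Disjoint)
  open import Data.List.Relation.Unary.All as All using (All; []; _∷_)
  import Data.List.Relation.Unary.All.Properties as All
  open import Data.List.Relation.Unary.AllPairs as AllPairs using (AllPairs; []; _∷_)
  import Data.List.Relation.Unary.AllPairs.Properties as AllPairs
  open import Data.List.Relation.Unary.Any using (here; there)
  open import Data.List.Relation.Unary.Unique.Propositional using (Unique)
  open import Data.List.Relation.Unary.Unique.Propositional.Properties using (concat⁺; allFin⁺)
  open import Data.Nat
  open import Data.Nat.ListAction using (sum)
  open import Data.Nat.ListAction.Properties using (sum-++)
  open import Data.Nat.Properties
  open import Data.Product using (Σ-syntax; ∃-syntax; _×_; _,_; proj₁; proj₂)
  open import Data.Sum using (inj₁; inj₂)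
  open import Function using (id; _∘_)
  open import Relation.Binary.PropositionalEquality
  open import Relation.Nullary using (Dec; yes; no; contradiction; ¬?)
  open import Relation.Nullary.Decidable using (map′)

  position : ∀ {A : Set} (xs : List A) y zs → ∃[ i ] lookup (xs ++ y ∷ zs) i ≡ y × take (suc (toℕ i)) (xs ++ y ∷ zs) ≡ xs ++ y ∷ []
  position []       y zs = Fin.zero , refl , refl
  position (x ∷ xs) y zs = let i , p , q = position xs y zs in Fin.suc i , p , cong (x ∷_) q

  lookup-injective : ∀ {A : Set} {xs : List A} → Unique xs → ∀ i j → lookup xs i ≡ lookup xs j → i ≡ j
  lookup-injective (x∉ ∷ u) Fin.zero    Fin.zero    eq = refl
  lookup-injective (x∉ ∷ u) Fin.zero    (Fin.suc j) eq = contradiction eq (All.lookup x∉ (∈-lookup j))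
  lookup-injective (x∉ ∷ u) (Fin.suc i) Fin.zero    eq = contradiction (sym eq) (All.lookup x∉ (∈-lookup i))
  lookup-injective (x∉ ∷ u) (Fin.suc i) (Fin.suc j) eq = cong Fin.suc (lookup-injective u i j eq)

  ∑-allFin-suc : ∀ n (f : Fin (suc n) → ℕ) → ∑ (allFin (suc n)) f ≡ f Fin.zero + ∑ (allFin n) (λ i → f (Fin.suc i))
  ∑-allFin-suc n f = cong (f Fin.zero +_) (trans (cong (λ xs → ∑ xs f) (sym (map-tabulate id Fin.suc))) (∑-map Fin.suc (allFin n) f))

  -- The items that finish by t / b form a prefix, whose total cost is the finish time of its last
  -- item. `p` is the cost of the items already passed.
  ∑-prefix : ∀ {A : Set} b t (g : A → ℕ) (l : List A) p → b * p ≤ t →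
             b * (p + ∑ (allFin (length l)) (λ i → g (lookup l i) when (b * (p + sum (map g (take (suc (toℕ i)) l))) ≤? t))) ≤ t
  ∑-prefix b t g []      p le = ≤-trans (≤-reflexive (cong (b *_) (+-identityʳ p))) le
  ∑-prefix b t g (x ∷ l) p le = ≤-trans (≤-reflexive (cong (λ z → b * (p + z)) (∑-allFin-suc (length l) _))) (go (b * (p + (g x + 0)) ≤? t))
    where
    rest = ∑ (allFin (length l)) (λ i → g (lookup l i) when (b * (p + (g x + sum (map g (take (suc (toℕ i)) l)))) ≤? t))
    rest≡ : rest ≡ ∑ (allFin (length l)) (λ i → g (lookup l i) when (b * (p + g x + sum (map g (take (suc (toℕ i)) l))) ≤? t))
    rest≡ = ∑-cong (allFin (length l)) (λ i → cong (λ z → g (lookup l i) when (b * z ≤? t)) (sym (+-assoc p (g x) _)))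
    go : (d : Dec (b * (p + (g x + 0)) ≤ t)) → b * (p + ((g x when d) + rest)) ≤ t
    go (yes le′) = ≤-trans (≤-reflexive (cong (b *_) (trans (sym (+-assoc p (g x) rest)) (cong (p + g x +_) rest≡))))
      (∑-prefix b t g l (p + g x) (≤-trans (≤-reflexive (cong (λ z → b * (p + z)) (sym (+-identityʳ (g x))))) le′))
    go (no ¬le) = ≤-trans (≤-reflexive (cong (λ z → b * (p + z)) (trans (∑-cong (allFin (length l)) λ i → when-no (g (lookup l i)) (b * (p + (g x + sum (map g (take (suc (toℕ i)) l)))) ≤? t) (λ le″ → ¬le (≤-trans
        (*-monoʳ-≤ b (+-monoʳ-≤ p (+-monoʳ-≤ (g x) z≤n))) le″))) (∑-zero (allFin (length l)))))) (≤-trans (≤-reflexive (cong (b *_) (+-identityʳ p))) le)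

  when-⇔ : ∀ {P Q : Set} x (d : Dec P) (d′ : Dec Q) → (P → Q) → (Q → P) → x when d ≡ x when d′
  when-⇔ x (yes p) d′ f g = sym (when-yes x d′ (f p))
  when-⇔ x (no ¬p) d′ f g = sym (when-no x d′ (λ q → ¬p (g q)))

  ∑-one : ∀ m v {y} (f : Fin m → ℕ) → (∀ j → f j ≤ y) → ∑ (allFin m) (λ j → f j when (v ≟ toℕ j)) ≤ y
  ∑-one zero    v       f h = z≤n
  ∑-one (suc m) zero    f h = ≤-trans (≤-reflexive (trans (∑-allFin-suc m (λ j → f j when (zero ≟ toℕ j))) (trans (cong (f Fin.zero +_) (∑-zero (allFin m))) (+-identityʳ _)))) (h Fin.zero)
  ∑-one (suc m) (suc v) f h = ≤-trans (≤-reflexive (trans (∑-allFin-suc m (λ j → f j when (suc v ≟ toℕ j))) (∑-cong (allFin m) λ j →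
    when-⇔ (f (Fin.suc j)) (suc v ≟ suc (toℕ j)) (v ≟ toℕ j) suc-injective (cong suc)))) (∑-one m v (f ∘ Fin.suc) (h ∘ Fin.suc))

  module _ (I : Instance) where
    open Instance I

    Cost : Set
    Cost = Σ[ σ ∈ Schedule I ] Feasible I σ

    costOf : Cost → ℕ
    costOf (σ , f) = cost I σ f

    module _ (σ : Schedule I) where
      open Schedule σ

      ∈-slots : ∀ s → s ∈ slots I σ
      ∈-slots (j , i) = ∈-concatMap⁺ _ (lose (∈-allFin j) (∈-map⁺ (j ,_) (∈-allFin i)))

      ct-≤ : ∀ (f : Feasible I σ) u s → u ∈ˢ sets (setAt I σ s) → ct I σ f u ≤ ft I σ s
      ct-≤ f u s p = min≤v⁺ _ _ (inj₂ (lose (∈-map⁺ (ft I σ) (∈-filter⁺ (λ s → u ∈? sets (setAt I σ s)) (∈-slots s) p)) ≤-refl))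

      ct-attained : ∀ (f : Feasible I σ) u → ∃[ s ] u ∈ˢ sets (setAt I σ s) × ft I σ s ≡ ct I σ f u
      ct-attained f u with argmin-sel id (ft I σ (proj₁ (f u))) (map (ft I σ) (filter (λ s → u ∈? sets (setAt I σ s)) (slots I σ)))
      ... | inj₁ eq = proj₁ (f u) , proj₂ (f u) , sym eq
      ... | inj₂ p with ∈-map⁻ (ft I σ) p
      ...   | s , s∈ , eq = s , proj₂ (∈-filter⁻ (λ s → u ∈? sets (setAt I σ s)) {xs = slots I σ} s∈) , sym eq

      ∑-slots : ∀ f → ∑ (slots I σ) f ≡ ∑ (allFin m) (λ j → ∑ (allFin (length (on j))) (λ i → f (j , i)))
      ∑-slots f = go (allFin m)
        where
        go : ∀ js → ∑ (concatMap (λ j → map (j ,_) (allFin (length (on j)))) js) f ≡ ∑ js (λ j → ∑ (allFin (length (on j))) (λ i → f (j , i)))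
        go []       = refl
        go (j ∷ js) = trans (∑-++ (map (j ,_) (allFin (length (on j)))) _ f) (cong₂ _+_ (∑-map (j ,_) (allFin (length (on j))) f) (go js))

      cost≤ft : ∀ j i → c (setAt I σ (j , i)) j ≤ ft I σ (j , i)
      cost≤ft j i = go (on j) i
        where
        go : ∀ l i → c (lookup l i) j ≤ sum (map (λ S → c S j) (take (suc (toℕ i)) l))
        go (S ∷ l) Fin.zero    = m≤m+n _ _
        go (S ∷ l) (Fin.suc i) = ≤-trans (go l i) (m≤n+m _ (c S j))

      on-capacity : ∀ b t j → b * ∑ (allFin (length (on j))) (λ i → c (setAt I σ (j , i)) j when (b * ft I σ (j , i) ≤? t)) ≤ t
      on-capacity b t j = ∑-prefix b t (λ S → c S j) (on j) 0 (≤-trans (≤-reflexive (*-zeroʳ b)) z≤n)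

    ct-mono : ∀ {σ σ′ : Schedule I} (f : Feasible I σ) (f′ : Feasible I σ′) → (∀ s u → u ∈ˢ sets (setAt I σ s) →
              ∃[ s′ ] u ∈ˢ sets (setAt I σ′ s′) × ft I σ′ s′ ≤ ft I σ s) → cost I σ′ f′ ≤ cost I σ f
    ct-mono {σ} {σ′} f f′ h = ∑-mono (allFin n) λ {u} _ → *-monoʳ-≤ (w u) (bound u)
      where
      bound : ∀ u → ct I σ′ f′ u ≤ ct I σ f u
      bound u = let s , p , eq = ct-attained σ f u
                    s′ , p′ , le = h s u p
                in ≤-trans (ct-≤ σ′ f′ u s′ p′) (≤-trans le (≤-reflexive eq))

    -- One list of assignments in the order of time, so that using each set at most once is
    -- uniqueness in a single list and every machine gets its part by filtering.
    Placed : Set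
    Placed = List (Fin m × Fin k)

    on? : (j : Fin m) → (e : Fin m × Fin k) → Dec (proj₁ e ≡ j)
    on? j e = proj₁ e Fin.≟ j

    placedOn : Placed → Fin m → List (Fin k)
    placedOn pl j = map proj₂ (filter (on? j) pl)

    loadOf : Placed → Fin m → ℕ
    loadOf pl j = sum (map (λ S → c S j) (placedOn pl j))

    private
      same-machine : ∀ {pl : Placed} → Unique (map proj₂ pl) → ∀ {j j′ S} → (j , S) ∈ pl → (j′ , S) ∈ pl → j ≡ j′
      same-machine (x∉ ∷ u) (here refl) (here refl) = refl
      same-machine (x∉ ∷ u) (here refl) (there q)   = contradiction refl (All.lookup x∉ (∈-map⁺ proj₂ q))
      same-machine (x∉ ∷ u) (there p)   (here refl) = contradiction refl (All.lookup x∉ (∈-map⁺ proj₂ p))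
      same-machine (x∉ ∷ u) (there p)   (there q)   = same-machine u p q

      placedOn-∈ : ∀ pl {j S} → S ∈ placedOn pl j → (j , S) ∈ pl
      placedOn-∈ pl {j} p with ∈-map⁻ proj₂ p
      ... | (j′ , S) , q , refl with ∈-filter⁻ (on? j) {xs = pl} q
      ...   | q′ , refl = q′

    schedule : (pl : Placed) → Unique (map proj₂ pl) → Schedule I
    schedule pl u = record { on = placedOn pl ; once = concat⁺ unique disjoint }
      where
      unique : All Unique (map (placedOn pl) (allFin m))
      unique = All.map⁺ (All.universal (λ j → AllPairs.map⁺ (AllPairs.filter⁺ (on? j) (AllPairs.map⁻ u))) (allFin m))
      disjoint : AllPairs Disjoint (map (placedOn pl) (allFin m))
      disjoint = AllPairs.map⁺ (AllPairs.map (λ j≢j′ {_} (p , q) → j≢j′ (same-machine u (placedOn-∈ pl p) (placedOn-∈ pl q))) (allFin⁺ m))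

    placedOn-++ : ∀ xs j S ys → placedOn (xs ++ (j , S) ∷ ys) j ≡ placedOn xs j ++ S ∷ placedOn ys j
    placedOn-++ xs j S ys = trans (cong (map proj₂) (trans (filter-++ (on? j) xs _)
      (cong (filter (on? j) xs ++_) (filter-accept (on? j) refl)))) (map-++ proj₂ (filter (on? j) xs) _)

    slot-of : ∀ xs j S ys u → let σ = schedule (xs ++ (j , S) ∷ ys) u in
              ∃[ s ] setAt I σ s ≡ S × ft I σ s ≡ loadOf xs j + c S j
    slot-of xs j S ys u with position′ _ (placedOn xs j) S (placedOn ys j) (placedOn-++ xs j S ys)
      where
      position′ : ∀ l as y zs → l ≡ as ++ y ∷ zs → ∃[ i ] lookup l i ≡ y × take (suc (toℕ i)) l ≡ as ++ y ∷ []
      position′ _ as y zs refl = position as y zs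
    ... | i , eq , pre = (j , i) , eq , (begin
      sum (map (λ S → c S j) (take (suc (toℕ i)) (placedOn (xs ++ (j , S) ∷ ys) j)))  ≡⟨ cong (sum ∘ map (λ S → c S j)) pre ⟩
      sum (map (λ S → c S j) (placedOn xs j ++ S ∷ []))                                ≡⟨ cong sum (map-++ (λ S → c S j) (placedOn xs j) (S ∷ [])) ⟩
      sum (map (λ S → c S j) (placedOn xs j) ++ c S j ∷ [])                            ≡⟨ sum-++ (map (λ S → c S j) (placedOn xs j)) (c S j ∷ []) ⟩
      loadOf xs j + (c S j + 0)                                                        ≡⟨ cong (loadOf xs j +_) (+-identityʳ (c S j)) ⟩
      loadOf xs j + c S j                                                              ∎)
      where open ≡-Reasoning

    private
      entries : Schedule I → List (Fin m) → Placed
      entries σ = concatMap (λ j → map (j ,_) (Schedule.on σ j))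

      entries-sets : ∀ σ js → map proj₂ (entries σ js) ≡ concatMap (Schedule.on σ) js
      entries-sets σ js = trans (map-concatMap proj₂ (λ j → map (j ,_) (Schedule.on σ j)) js)
        (concatMap-cong (λ j → trans (sym (map-∘ (Schedule.on σ j))) (map-id (Schedule.on σ j))) js)

      module _ (σ : Schedule I) (j : Fin m) where
        open Schedule σ

        own : ∀ l → placedOn (map (j ,_) l) j ≡ l
        own []      = refl
        own (S ∷ l) = trans (cong (map proj₂) (filter-accept (on? j) refl)) (cong (S ∷_) (own l))

        other : ∀ {j′} → j′ ≢ j → ∀ l → placedOn (map (j′ ,_) l) j ≡ []
        other ne []      = refl
        other ne (S ∷ l) = trans (cong (map proj₂) (filter-reject (on? j) ne)) (other ne l)

        placedOn-app : ∀ xs ys → placedOn (xs ++ ys) j ≡ placedOn xs j ++ placedOn ys j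
        placedOn-app xs ys = trans (cong (map proj₂) (filter-++ (on? j) xs ys)) (map-++ proj₂ (filter (on? j) xs) _)

        absent : ∀ js → All (j ≢_) js → placedOn (entries σ js) j ≡ []
        absent []        _         = refl
        absent (j′ ∷ js) (ne ∷ al) = trans (placedOn-app (map (j′ ,_) (on j′)) (entries σ js))
          (cong₂ _++_ (other (λ eq → ne (sym eq)) (on j′)) (absent js al))

        present : ∀ js → Unique js → j ∈ js → placedOn (entries σ js) j ≡ on j
        present (_ ∷ js)  (ne ∷ u) (here refl) = trans (placedOn-app (map (j ,_) (on j)) (entries σ js))
          (trans (cong₂ _++_ (own (on j)) (absent js ne)) (++-identityʳ (on j)))
        present (j′ ∷ js) (ne ∷ u) (there p)   = trans (placedOn-app (map (j′ ,_) (on j′)) (entries σ js))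
          (cong₂ _++_ (other (All.lookup ne p) (on j′)) (present js u p))

      -- The search space for a cheapest schedule: a schedule uses distinct sets, so lists of at
      -- most `k` assignments suffice.
      listsUpTo : ∀ {A : Set} → List A → ℕ → List (List A)
      listsUpTo as zero    = [] ∷ []
      listsUpTo as (suc b) = [] ∷ concatMap (λ a → map (a ∷_) (listsUpTo as b)) as

      ∈-listsUpTo : ∀ {A : Set} {as : List A} → (∀ a → a ∈ as) → ∀ b l → length l ≤ b → l ∈ listsUpTo as b
      ∈-listsUpTo all zero    []      le = here refl
      ∈-listsUpTo all (suc b) []      le = here refl
      ∈-listsUpTo all (suc b) (x ∷ l) (s≤s le) = there (∈-concatMap⁺ _ (lose (all x) (∈-map⁺ (x ∷_) (∈-listsUpTo all b l le))))

      unique-short : ∀ {l : List (Fin k)} → Unique l → length l ≤ k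
      unique-short u = Fin.injective⇒≤ (λ {i} {j} → lookup-injective u i j)

      feasible? : ∀ σ → Dec (Feasible I σ)
      feasible? σ = Fin.all? λ u → map′ (λ (j , i , p) → (j , i) , p) (λ ((j , i) , p) → j , i , p)
        (Fin.any? λ j → Fin.any? λ i → u ∈? sets (setAt I σ (j , i)))

      candidate : Placed → List Cost
      candidate pl with AllPairs.allPairs? (λ x y → ¬? (x Fin.≟ y)) (map proj₂ pl)
      ... | no _  = []
      ... | yes u with feasible? (schedule pl u)
      ...   | no _  = []
      ...   | yes f = (schedule pl u , f) ∷ []

      -- The field `on` is a function, and without function extensionality schedules that agree
      -- pointwise can be compared only slot by slot.
      slot-transport : ∀ {σ σ′ : Schedule I} → (∀ j → Schedule.on σ′ j ≡ Schedule.on σ j) → ∀ s →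
                       ∃[ s′ ] setAt I σ′ s′ ≡ setAt I σ s × ft I σ′ s′ ≡ ft I σ s
      slot-transport {σ} {σ′} eq (j , i) with transport (Schedule.on σ′ j) (eq j)
        where
        transport : ∀ l → l ≡ Schedule.on σ j → ∃[ i′ ] lookup l i′ ≡ lookup (Schedule.on σ j) i ×
                    take (suc (toℕ i′)) l ≡ take (suc (toℕ i)) (Schedule.on σ j)
        transport _ refl = i , refl , refl
      ... | i′ , p , q = (j , i′) , p , cong (sum ∘ map (λ S → c S j)) q

      candidate-≤ : ∀ ((σ , f) : Cost) → ∃[ σf ] σf ∈ candidate (entries σ (allFin m)) × costOf σf ≤ costOf (σ , f)
      candidate-≤ (σ , f) with AllPairs.allPairs? (λ x y → ¬? (x Fin.≟ y)) (map proj₂ (entries σ (allFin m)))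
      ... | no ¬u = contradiction (subst Unique (sym (entries-sets σ (allFin m))) (Schedule.once σ)) ¬u
      ... | yes u with feasible? (schedule (entries σ (allFin m)) u)
      ...   | no ¬f = contradiction (λ v → let s , p = f v ; s′ , eq , _ = moved s in s′ , subst (λ S → v ∈ˢ sets S) (sym eq) p) ¬f
        where
        moved = slot-transport {σ} {schedule (entries σ (allFin m)) u} (λ j → present σ j (allFin m) (allFin⁺ m) (∈-allFin j))
      ...   | yes f′ = _ , here refl , ct-mono {σ} {schedule (entries σ (allFin m)) u} f f′ λ s v p → let s′ , eq , le = moved s in s′ , subst (λ S → v ∈ˢ sets S) (sym eq) p , ≤-reflexive le
        where
        moved = slot-transport {σ} {schedule (entries σ (allFin m)) u} (λ j → present σ j (allFin m) (allFin⁺ m) (∈-allFin j))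

      all-entries : List (Fin m × Fin k)
      all-entries = cartesianProduct (allFin m) (allFin k)

      candidates : List Cost
      candidates = concatMap candidate (listsUpTo all-entries k)

    -- Exhaustive search, as part of the proof and not of the machine: every feasible schedule is
    -- matched by a candidate of no larger cost.
    minCost-exists : Cost → ∃[ σf ] IsMinCost I (costOf σf)
    minCost-exists σf = best , (proj₁ best , proj₂ best , refl) , least
      where
      best = argmin costOf σf candidates
      least : ∀ σ f → costOf best ≤ cost I σ f
      least σ f = ≤-trans (All.lookup (f[argmin]≤f[xs] {f = costOf} σf candidates) (∈-concatMap⁺ _ (lose short p))) le
        where
        p = proj₁ (proj₂ (candidate-≤ (σ , f)))
        le = proj₂ (proj₂ (candidate-≤ (σ , f)))
        short : entries σ (allFin m) ∈ listsUpTo all-entries k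
        short = ∈-listsUpTo (λ (j , S) → ∈-cartesianProduct⁺ (∈-allFin j) (∈-allFin S)) k _
          (≤-trans (≤-reflexive (sym (length-map proj₂ (entries σ (allFin m)))))
                   (unique-short (subst Unique (sym (entries-sets σ (allFin m))) (Schedule.once σ))))

-- From greedy runs to schedules with cost ratios 8 and 6.

module Ratio where

  open import Defs hiding (_≤ℝ_; _<ℝ_)
  open Sums
  open Analysis
  open Schedules
  open import Data.Bool using (Bool; true; false)
  open import Data.Fin as Fin using (Fin; toℕ)
  import Data.Fin.Properties as Fin
  open import Data.Fin.Subset using () renaming (_∈_ to _∈ˢ_)
  open import Data.List as List using (List; []; _∷_; _++_; map; allFin; length; lookup; reverse)
  open import Data.List.Membership.Propositional using (_∈_)
  open import Data.List.Membership.Propositional.Properties using (∈-map⁻; ∈-allFin)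
  open import Data.List.Properties using (reverse-++; unfold-reverse; ++-assoc; filter-accept; filter-reject; reverse-map; length-tabulate)
  open import Data.List.Relation.Binary.Permutation.Propositional using (↭-sym)
  open import Data.List.Relation.Binary.Permutation.Propositional.Properties using (↭-reverse)
  import Data.List.Relation.Binary.Permutation.Setoid.Properties as Perm
  open import Data.List.Relation.Unary.All as All using (All; []; _∷_)
  open import Data.List.Relation.Unary.AllPairs using ([]; _∷_)
  open import Data.List.Relation.Unary.Any using (here; there)
  open import Data.List.Relation.Unary.Unique.Propositional using (Unique)
  open import Data.Nat
  open import Data.Nat.ListAction using (sum)
  open import Data.Nat.Properties
  open import Data.Nat.Tactic.RingSolver using (solve-∀)
  open import Data.Product using (∃-syntax; _×_; _,_; proj₁; proj₂)
  open import Data.Sum using (_⊎_; inj₁; inj₂)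
  open import Data.Vec as Vec using ()
  open import Data.Vec.Properties using ([]=⇒lookup; lookup⇒[]=)
  open import Relation.Binary.PropositionalEquality
  open import Relation.Nullary using (Dec; yes; no; contradiction)

  contains : (I : Instance) → Fin (Instance.k I) → Fin (Instance.n I) → Bool
  contains I S u = Vec.lookup (Instance.sets I S) u

  unique-reverse : ∀ {A : Set} {xs : List A} → Unique xs → Unique (reverse xs)
  unique-reverse {A} {xs} u = Perm.Unique-resp-↭ (setoid A) (Data.List.Relation.Binary.Permutation.Propositional.↭⇒↭ₛ (↭-sym (↭-reverse xs))) u

  module Placement (I : Instance) {mv : ℕ} (cv : Fin (Instance.k I) → Fin mv → ℕ) (cv≥1 : ∀ S v → 1 ≤ cv S v) (a : ℕ) where
    open Instance I
    module V = Virtual w (contains I) cv cv≥1 a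
    open V using (Job; Trace; Exhausted; resid; W; []; _∷_)

    -- The ratio β / α between actual and virtual finish times is 1 for unrelated machines and 4 /
    -- (3 m) for identical ones; two parameters avoid the fraction.
    data Placing (α β : ℕ) : List Job → Placed I → Set where
      []    : Placing α β [] []
      place : ∀ {es pl v S i} → α * (loadOf I pl i + c S i) ≤ β * V.finish es (v , S) → Placing α β es pl →
              Placing α β ((v , S) ∷ es) ((i , S) ∷ pl)

    private
      covered-resid : ∀ es u → (∃[ e ] e ∈ es × V.covers e u ≡ true) → resid es u ≡ 0
      covered-resid (e ∷ es) u (.e , here refl , cov) rewrite cov = refl
      covered-resid (e ∷ es) u (e′ , there p , cov) = n≤0⇒n≡0 (≤-trans (V.resid-∷ e es u) (≤-reflexive (covered-resid es u (e′ , p , cov))))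

      used-W : ∀ es e {e′} → e′ ∈ es → proj₂ e ≡ proj₂ e′ → W es e ≡ 0
      used-W es e {e′} p refl = trans (∑-cong (allFin n) zero-part) (∑-zero (allFin n))
        where
        zero-part : ∀ u → V.part (resid es) e u ≡ 0
        zero-part u with contains I (proj₂ e) u in eq
        ... | true  = covered-resid es u (e′ , p , eq)
        ... | false = refl

      -- A set that was chosen before, on whatever machine, has no weight left, whereas a chosen job
      -- has positive weight.
      trace-unique : ∀ {es} → Trace es → Unique (map proj₂ es)
      trace-unique []                  = []
      trace-unique {e ∷ es} (ch ∷ tr) = All.tabulate fresh ∷ trace-unique tr
        where
        fresh : ∀ {S} → S ∈ map proj₂ es → proj₂ e ≢ S
        fresh p eq with ∈-map⁻ proj₂ p
        ... | e′ , q , refl = contradiction (used-W es e q eq) (λ z → <⇒≢ (proj₁ ch) (sym z))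

      placing-sets : ∀ {α β es pl} → Placing α β es pl → map proj₂ pl ≡ map proj₂ es
      placing-sets []          = refl
      placing-sets (place _ p) = cong (_ ∷_) (placing-sets p)

      resid-cases : ∀ es u → resid es u ≡ 0 ⊎ resid es u ≡ w u
      resid-cases []       u = inj₂ refl
      resid-cases (e ∷ es) u with V.covers e u
      ... | true  = inj₁ refl
      ... | false = resid-cases es u

      loadOf-++ : ∀ xs ys j → loadOf I (xs ++ ys) j ≡ loadOf I xs j + loadOf I ys j
      loadOf-++ []              ys j = refl
      loadOf-++ ((i , S) ∷ xs) ys j with i Fin.≟ j
      ... | yes _ = trans (cong (c S j +_) (loadOf-++ xs ys j)) (sym (+-assoc (c S j) _ _))
      ... | no _  = loadOf-++ xs ys j

      loadOf-reverse : ∀ xs j → loadOf I (reverse xs) j ≡ loadOf I xs j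
      loadOf-reverse []       j = refl
      loadOf-reverse (x ∷ xs) j = trans (cong (λ l → loadOf I l j) (unfold-reverse x xs)) (trans (loadOf-++ (reverse xs) (x ∷ []) j)
        (trans (+-comm _ (loadOf I (x ∷ []) j)) (trans (cong (loadOf I (x ∷ []) j +_) (loadOf-reverse xs j)) (sym (loadOf-++ (x ∷ []) xs j)))))

      -- The event that covers `u` first is where its residual weight drops from `w u` to 0.
      -- Positive weights ensure that a residual of 0 comes from such a drop.
      cover : ∀ {α β es pl} → Placing α β es pl → ∀ u → resid es u ≡ 0 →
              ∃[ xs ] ∃[ i ] ∃[ S ] ∃[ ys ] pl ≡ xs ++ (i , S) ∷ ys × contains I S u ≡ true ×
                α * (w u * (loadOf I ys i + c S i)) ≤ β * V.φ V.finish es u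
      cover [] u eq = contradiction eq (λ z → <⇒≢ (w≥1 u) (sym z))
      cover {α} {β} {(v , S) ∷ es} {(i , S) ∷ pl} (place le p) u eq with resid-cases es u
      ... | inj₁ z = let xs , i′ , S′ , ys , pl≡ , cov , bd = cover p u z in
        (i , S) ∷ xs , i′ , S′ , ys , cong ((i , S) ∷_) pl≡ , cov , ≤-trans bd (*-monoʳ-≤ β (m≤n+m _ _))
      ... | inj₂ r≡w = [] , i , S , pl , refl , cov , (begin
        α * (w u * (loadOf I pl i + c S i))                   ≡⟨ arith α (w u) (loadOf I pl i + c S i) ⟩
        w u * (α * (loadOf I pl i + c S i))                   ≤⟨ *-monoʳ-≤ (w u) le ⟩
        w u * (β * V.finish es (v , S))                       ≡⟨ arith (w u) β (V.finish es (v , S)) ⟩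
        β * (w u * V.finish es (v , S))                       ≡⟨ cong (λ z → β * (z * V.finish es (v , S))) (sym part≡) ⟩
        β * (V.part (resid es) (v , S) u * V.finish es (v , S)) ≤⟨ *-monoʳ-≤ β (m≤m+n _ _) ⟩
        β * V.φ V.finish ((v , S) ∷ es) u                     ∎)
        where
        open ≤-Reasoning
        arith : ∀ a b c → a * (b * c) ≡ b * (a * c)
        arith = solve-∀
        cov : contains I S u ≡ true
        cov with contains I S u
        ... | true  = refl
        ... | false = contradiction (trans (sym eq) r≡w) (<⇒≢ (w≥1 u))
        part≡ : V.part (resid es) (v , S) u ≡ w u
        part≡ rewrite cov = r≡w

    module _ {α β es pl} (tr : Trace es) (ex : Exhausted es) (p : Placing α β es pl) (v₀ : Fin mv) where

      placed-unique : Unique (map proj₂ (reverse pl))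
      placed-unique = subst Unique (sym (reverse-map proj₂ pl)) (unique-reverse (subst Unique (sym (placing-sets p)) (trace-unique tr)))

      private
        σ = schedule I (reverse pl) placed-unique

        done : ∀ u → resid es u ≡ 0
        done u with covered u
        ... | S , S∋u = n≤0⇒n≡0 (≤-trans (≤-reflexive (sym part≡)) (≤-trans (∑-∈ (V.part (resid es) (v₀ , S)) (∈-allFin u)) (≤-reflexive (ex (v₀ , S)))))
          where
          part≡ : V.part (resid es) (v₀ , S) u ≡ resid es u
          part≡ rewrite []=⇒lookup S∋u = refl

        slot-for : ∀ u → ∃[ s ] u ∈ˢ sets (setAt I σ s) × α * (w u * ft I σ s) ≤ β * V.φ V.finish es u
        slot-for u with cover p u (done u)
        ... | xs , i , S , ys , pl≡ , cov , bd with slot (reverse pl) placed-unique reversed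
          where
          reversed : reverse pl ≡ reverse ys ++ (i , S) ∷ reverse xs
          reversed = trans (cong reverse pl≡) (trans (reverse-++ xs ((i , S) ∷ ys))
            (trans (cong (_++ reverse xs) (unfold-reverse (i , S) ys)) (++-assoc (reverse ys) _ _)))
          slot : ∀ l u → l ≡ reverse ys ++ (i , S) ∷ reverse xs → ∃[ s ] setAt I (schedule I l u) s ≡ S ×
                 ft I (schedule I l u) s ≡ loadOf I (reverse ys) i + c S i
          slot l u refl = slot-of I (reverse ys) i S (reverse xs) u
        ...   | s , s≡ , ft≡ = s , subst (λ T → u ∈ˢ sets T) (sym s≡) (lookup⇒[]= u (sets S) cov) ,
          ≤-trans (≤-reflexive (cong (λ z → α * (w u * z)) (trans ft≡ (cong (_+ c S i) (loadOf-reverse ys i))))) bd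

      placed-feasible : Feasible I σ
      placed-feasible u = let s , q , _ = slot-for u in s , q

      placed-cost : α * cost I σ placed-feasible ≤ β * V.total es
      placed-cost = begin
        α * cost I σ placed-feasible                       ≡⟨ sym (∑-* (allFin n) α _) ⟩
        ∑ (allFin n) (λ u → α * (w u * ct I σ placed-feasible u))
          ≤⟨ ∑-mono (allFin n) (λ {u} _ → let s , q , le = slot-for u in
               ≤-trans (*-monoʳ-≤ α (*-monoʳ-≤ (w u) (ct-≤ I σ placed-feasible u s q))) le) ⟩
        ∑ (allFin n) (λ u → β * V.φ V.finish es u)         ≡⟨ ∑-* (allFin n) β _ ⟩
        β * V.total es                                     ∎
        where open ≤-Reasoning

  module _ (I : Instance) where
    open Instance I

    module Unrel = Placement I c c≥1 3

    private
      module U = Unrel.V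

      -- Greedy times include enforced waiting; the schedule drops it, so its sets finish no later.
      load-bound : ∀ es j → loadOf I es j ≤ U.load (toℕ j) es
      load-bound []             j = z≤n
      load-bound ((i , S) ∷ es) j = go (i Fin.≟ j)
        where
        go : Dec (i ≡ j) → loadOf I ((i , S) ∷ es) j ≤ U.load (toℕ j) ((i , S) ∷ es)
        go (yes refl) = begin
          loadOf I ((i , S) ∷ es) i       ≡⟨ cong (λ l → sum (map (λ S → c S i) (map proj₂ l))) (filter-accept (on? I i) refl) ⟩
          c S i + loadOf I es i           ≡⟨ +-comm (c S i) _ ⟩
          loadOf I es i + c S i           ≤⟨ +-monoˡ-≤ (c S i) (≤-trans (load-bound es i) (m≤m⊔n _ _)) ⟩
          U.finish es (i , S)             ≡⟨ sym (U.load-same (i , S) es (toℕ i) refl) ⟩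
          U.load (toℕ i) ((i , S) ∷ es)   ∎
          where open ≤-Reasoning
        go (no ne) = begin
          loadOf I ((i , S) ∷ es) j       ≡⟨ cong (λ l → sum (map (λ S → c S j) (map proj₂ l))) (filter-reject (on? I j) ne) ⟩
          loadOf I es j                   ≤⟨ load-bound es j ⟩
          U.load (toℕ j) es               ≤⟨ U.load-mono (i , S) es (toℕ j) ⟩
          U.load (toℕ j) ((i , S) ∷ es)   ∎
          where open ≤-Reasoning

    unrelated-placing : ∀ es → Unrel.Placing 1 1 es es
    unrelated-placing []             = Unrel.[]
    unrelated-placing ((v , S) ∷ es) = Unrel.place
      (*-monoʳ-≤ 1 (+-monoˡ-≤ (c S v) (≤-trans (load-bound es v) (m≤m⊔n _ _)))) (unrelated-placing es)

    private
      unrelated-rival : ∀ σ → Feasible I σ → U.Rival 4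
      unrelated-rival σ f = record
        { Slot = Slot I σ ; slots = slots I σ ; job = λ s → proj₁ s , setAt I σ s ; fin = ft I σ
        ; slot = λ u → proj₁ (ct-attained I σ f u) ; slot∈ = λ u → ∈-slots I σ _
        ; slot-cov = λ u → []=⇒lookup (proj₁ (proj₂ (ct-attained I σ f u)))
        ; long = λ (j , i) → cost≤ft I σ j i
        ; capacity = capacity }
        where
        capacity : ∀ v t → 4 * ∑ (slots I σ) (λ s → (c (setAt I σ s) (proj₁ s) when (v ≟ toℕ (proj₁ s))) when (4 * ft I σ s ≤? t)) ≤ t
        capacity v t = begin
          4 * ∑ (slots I σ) (λ s → (c (setAt I σ s) (proj₁ s) when (v ≟ toℕ (proj₁ s))) when (4 * ft I σ s ≤? t))
            ≡⟨ cong (4 *_) (∑-slots I σ _) ⟩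
          4 * ∑ (allFin m) (λ j → ∑ (allFin (length (Schedule.on σ j))) (λ i → (c (setAt I σ (j , i)) j when (v ≟ toℕ j)) when (4 * ft I σ (j , i) ≤? t)))
            ≡⟨ sym (∑-* (allFin m) 4 _) ⟩
          ∑ (allFin m) (λ j → 4 * ∑ (allFin (length (Schedule.on σ j))) (λ i → (c (setAt I σ (j , i)) j when (v ≟ toℕ j)) when (4 * ft I σ (j , i) ≤? t)))
            ≡⟨ ∑-cong (allFin m) (λ j → trans (cong (4 *_) (trans (∑-cong (allFin (length (Schedule.on σ j))) (λ i → when-comm _ (v ≟ toℕ j) (4 * ft I σ (j , i) ≤? t)))
                 (∑-when (allFin (length (Schedule.on σ j))) _ (v ≟ toℕ j)))) (*-when 4 _ (v ≟ toℕ j))) ⟩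
          ∑ (allFin m) (λ j → (4 * ∑ (allFin (length (Schedule.on σ j))) (λ i → c (setAt I σ (j , i)) j when (4 * ft I σ (j , i) ≤? t))) when (v ≟ toℕ j))
            ≤⟨ ∑-one m v _ (λ j → on-capacity I σ 4 t j) ⟩
          t ∎
          where
          open ≤-Reasoning
          when-comm : ∀ {P Q : Set} x (d : Dec P) (d′ : Dec Q) → (x when d) when d′ ≡ (x when d′) when d
          when-comm x (yes _) (yes _) = refl
          when-comm x (yes _) (no _)  = refl
          when-comm x (no _)  (yes _) = refl
          when-comm x (no _)  (no _)  = refl

      rival-cost : ∀ σ (f : Feasible I σ) → ∑ (allFin n) (λ u → w u * ft I σ (proj₁ (ct-attained I σ f u))) ≡ cost I σ f
      rival-cost σ f = ∑-cong (allFin n) (λ u → cong (w u *_) (proj₂ (proj₂ (ct-attained I σ f u))))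

      -- Because f = s + c and 3 c ≤ s.
      start-finish : ∀ es u → 3 * U.φ U.finish es u ≤ 4 * U.φ U.ready es u
      start-finish []       u = z≤n
      start-finish (e ∷ es) u = begin
        3 * (p * (s + x) + U.φ U.finish es u)               ≡⟨ arith p s x (U.φ U.finish es u) ⟩
        p * (3 * s + 3 * x) + 3 * U.φ U.finish es u         ≤⟨ +-mono-≤ (*-monoʳ-≤ p (+-monoʳ-≤ (3 * s) (m≤n⊔m (U.load (U.vm e) es) (3 * x)))) (start-finish es u) ⟩
        p * (3 * s + s) + 4 * U.φ U.ready es u              ≡⟨ arith′ p s (U.φ U.ready es u) ⟩
        4 * (p * s + U.φ U.ready es u)                      ∎
        where
        open ≤-Reasoning
        p = U.part (U.resid es) e u
        s = U.ready es e
        x = U.cost e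
        arith : ∀ p s x f → 3 * (p * (s + x) + f) ≡ p * (3 * s + 3 * x) + 3 * f
        arith = solve-∀
        arith′ : ∀ p s f → p * (3 * s + s) + 4 * f ≡ 4 * (p * s + f)
        arith′ = solve-∀

    -- With F and S the weighted finish and start times, 3 F ≤ 4 S ≤ F + 16 OPT, and one F is
    -- cancelled.
    unrelated-total : ∀ {es} → U.Trace es → U.Exhausted es → ∀ σ (f : Feasible I σ) → U.total es ≤ 8 * cost I σ f
    unrelated-total {es} tr ex σ f = *-cancelˡ-≤ 2 (+-cancelˡ-≤ F _ _ (begin
      F + 2 * F                                              ≡⟨ sym (∑-* (allFin n) 3 _) ⟩
      ∑ (allFin n) (λ u → 3 * U.φ U.finish es u)              ≤⟨ ∑-mono (allFin n) (λ {u} _ → start-finish es u) ⟩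
      ∑ (allFin n) (λ u → 4 * U.φ U.ready es u)               ≡⟨ ∑-* (allFin n) 4 _ ⟩
      4 * ∑ (allFin n) (U.φ U.ready es)                       ≤⟨ U.balance (unrelated-rival σ f) U.ready (U.start-sorted tr)
                                                                  (λ t x le → U.rated-start tr t x le (U.exhausted-idle es t ex)) ⟩
      F + 4 * (4 * U.Rival.rivalCost (unrelated-rival σ f))                                         ≡⟨ cong (λ z → F + 4 * (4 * z)) (rival-cost σ f) ⟩
      F + 4 * (4 * cost I σ f)                                ≡⟨ cong (F +_) (arith (cost I σ f)) ⟩
      F + 2 * (8 * cost I σ f)                                ∎))
      where
      open ≤-Reasoning
      F = U.total es
      arith : ∀ o → 4 * (4 * o) ≡ 2 * (8 * o)
      arith = solve-∀

  module _ (I : Instance) (j₀ : Fin (Instance.m I)) (identical : Identical I) (a : ℕ) (a≡ : suc a ≡ 3 * Instance.m I) where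
    open Instance I

    c₁ : Fin k → Fin 1 → ℕ
    c₁ S _ = c S j₀

    module Ident = Placement I c₁ (λ S _ → c≥1 S j₀) a

    private
      module J = Ident.V

      single : ∀ (x y : J.Job) → J.vm x ≡ J.vm y
      single (Fin.zero , _) (Fin.zero , _) = refl

    Least : Placed I → Fin m → Set
    Least pl i = ∀ j → loadOf I pl i ≤ loadOf I pl j

    -- Events and entries are listed from the latest to the earliest.
    data ListSchedule : List J.Job → Placed I → Set where
      []     : ListSchedule [] []
      assign : ∀ {es pl v S i} → Least pl i → ListSchedule es pl → ListSchedule ((v , S) ∷ es) ((i , S) ∷ pl)

    private
      length-allFin : ∀ n → length (allFin n) ≡ n
      length-allFin n = length-tabulate {n = n} (λ i → i)

      -- The virtual machine spends one unit of time on each unit of volume, and possibly more on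
      -- waiting.
      volume : ∀ {es pl} → ListSchedule es pl → ∑ (allFin m) (loadOf I pl) ≤ J.load 0 es
      volume []                                                            = ≤-reflexive (∑-zero (allFin m))
      volume {(Fin.zero , S) ∷ es} {(i , S) ∷ pl} (assign _ ls) = begin
        ∑ (allFin m) (loadOf I ((i , S) ∷ pl))                                         ≡⟨ ∑-cong (allFin m) (λ j → load-∷ j) ⟩
        ∑ (allFin m) (λ j → (c S j₀ when (toℕ i ≟ toℕ j)) + loadOf I pl j)             ≡⟨ ∑-+ (allFin m) _ _ ⟩
        ∑ (allFin m) (λ j → c S j₀ when (toℕ i ≟ toℕ j)) + ∑ (allFin m) (loadOf I pl)  ≤⟨ +-mono-≤ (∑-one m (toℕ i) (λ _ → c S j₀) (λ _ → ≤-refl)) (volume ls) ⟩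
        c S j₀ + J.load 0 es                                                           ≡⟨ +-comm (c S j₀) _ ⟩
        J.load 0 es + c S j₀                                                           ≤⟨ +-monoˡ-≤ (c S j₀) (m≤m⊔n (J.load 0 es) (a * c S j₀)) ⟩
        J.finish es (Fin.zero , S)                                                     ∎
        where
        open ≤-Reasoning
        load-∷ : ∀ j → loadOf I ((i , S) ∷ pl) j ≡ (c S j₀ when (toℕ i ≟ toℕ j)) + loadOf I pl j
        load-∷ j = go (i Fin.≟ j)
          where
          go : Dec (i ≡ j) → loadOf I ((i , S) ∷ pl) j ≡ (c S j₀ when (toℕ i ≟ toℕ j)) + loadOf I pl j
          go (yes refl) = trans (cong (λ l → sum (map (λ S → c S i) (map proj₂ l))) (filter-accept (on? I i) refl))
            (cong (_+ loadOf I pl i) (trans (identical S i j₀) (sym (when-yes _ (toℕ i ≟ toℕ i) refl))))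
          go (no ne) = trans (cong (λ l → sum (map (λ S → c S j) (map proj₂ l))) (filter-reject (on? I j) ne))
            (cong (_+ loadOf I pl j) (sym (when-no _ (toℕ i ≟ toℕ j) (λ eq → ne (Fin.toℕ-injective eq)))))

    -- The least load is at most the average, so m times it is at most the virtual load. The delay
    -- gives 3 m x ≤ F for the cost x and the virtual finish time F, whence 3 F + F.
    identical-placing : ∀ {es pl} → ListSchedule es pl → Ident.Placing (3 * m) 4 es pl
    identical-placing [] = Ident.[]
    identical-placing {(Fin.zero , S) ∷ es} {(i , S) ∷ pl} (assign least ls) = Ident.place (begin
      3 * m * (loadOf I pl i + c S i)                ≡⟨ cong (λ z → 3 * m * (loadOf I pl i + z)) (identical S i j₀) ⟩
      3 * m * (loadOf I pl i + x)                    ≡⟨ arith m (loadOf I pl i) x ⟩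
      3 * (loadOf I pl i * m) + 3 * m * x            ≤⟨ +-mono-≤ (*-monoʳ-≤ 3 avg) (≤-reflexive (cong (_* x) (sym a≡))) ⟩
      3 * L + suc a * x                              ≤⟨ +-mono-≤ (*-monoʳ-≤ 3 (≤-trans (m≤m⊔n L (a * x)) (m≤m+n _ x)))
                                                          (≤-trans (≤-reflexive (+-comm x (a * x))) (+-monoˡ-≤ x (m≤n⊔m L (a * x)))) ⟩
      3 * F + F                                      ≡⟨ arith′ F ⟩
      4 * F                                          ∎) (identical-placing ls)
      where
      open ≤-Reasoning
      x = c S j₀
      L = J.load 0 es
      F = J.finish es (Fin.zero , S)
      avg : loadOf I pl i * m ≤ L
      avg = begin
        loadOf I pl i * m                        ≡⟨ cong (loadOf I pl i *_) (sym (length-allFin m)) ⟩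
        loadOf I pl i * length (allFin m)        ≡⟨ sym (∑-const (allFin m) _) ⟩
        ∑ (allFin m) (λ _ → loadOf I pl i)       ≤⟨ ∑-mono (allFin m) (λ {j} _ → least j) ⟩
        ∑ (allFin m) (loadOf I pl)               ≤⟨ volume ls ⟩
        L                                        ∎
      arith : ∀ m l x → 3 * m * (l + x) ≡ 3 * (l * m) + 3 * m * x
      arith = solve-∀
      arith′ : ∀ f → 3 * f + f ≡ 4 * f
      arith′ = solve-∀

    private
      -- By time t / (3 m) the m machines together have processed at most t / 3, hence the parameter
      -- 3.
      identical-rival : ∀ σ → Feasible I σ → J.Rival 3
      identical-rival σ f = record
        { Slot = Slot I σ ; slots = slots I σ ; job = λ s → Fin.zero , setAt I σ s ; fin = ft I σ
        ; slot = λ u → proj₁ (ct-attained I σ f u) ; slot∈ = λ u → ∈-slots I σ _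
        ; slot-cov = λ u → []=⇒lookup (proj₁ (proj₂ (ct-attained I σ f u)))
        ; long = λ (j , i) → ≤-trans (≤-reflexive (identical _ j₀ j)) (cost≤ft I σ j i)
        ; capacity = capacity }
        where
        instance
          m≢0 : NonZero m
          m≢0 = >-nonZero m≥1
        capacity : ∀ v t → 3 * ∑ (slots I σ) (λ s → (c (setAt I σ s) j₀ when (v ≟ 0)) when (suc a * ft I σ s ≤? t)) ≤ t
        capacity v t = *-cancelˡ-≤ m (begin
          m * (3 * ∑ (slots I σ) (λ s → (c (setAt I σ s) j₀ when (v ≟ 0)) when (suc a * ft I σ s ≤? t)))
            ≡⟨ arith m _ ⟩
          3 * m * ∑ (slots I σ) (λ s → (c (setAt I σ s) j₀ when (v ≟ 0)) when (suc a * ft I σ s ≤? t))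
            ≤⟨ *-monoʳ-≤ (3 * m) (∑-mono (slots I σ) (λ {s} _ → when-mono (suc a * ft I σ s ≤? t) (λ _ → when-≤ _ (v ≟ 0)))) ⟩
          3 * m * ∑ (slots I σ) (λ s → c (setAt I σ s) j₀ when (suc a * ft I σ s ≤? t))
            ≡⟨ cong₂ _*_ (sym a≡) (∑-cong (slots I σ) (λ s → cong (_when (suc a * ft I σ s ≤? t)) (identical _ j₀ (proj₁ s)))) ⟩
          suc a * ∑ (slots I σ) (λ s → c (setAt I σ s) (proj₁ s) when (suc a * ft I σ s ≤? t))
            ≡⟨ cong (suc a *_) (∑-slots I σ _) ⟩
          suc a * ∑ (allFin m) (λ j → ∑ (allFin (length (Schedule.on σ j))) (λ i → c (setAt I σ (j , i)) j when (suc a * ft I σ (j , i) ≤? t)))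
            ≡⟨ sym (∑-* (allFin m) (suc a) _) ⟩
          ∑ (allFin m) (λ j → suc a * ∑ (allFin (length (Schedule.on σ j))) (λ i → c (setAt I σ (j , i)) j when (suc a * ft I σ (j , i) ≤? t)))
            ≤⟨ ∑-mono (allFin m) (λ {j} _ → on-capacity I σ (suc a) t j) ⟩
          ∑ (allFin m) (λ _ → t)
            ≡⟨ trans (∑-const (allFin m) t) (cong (t *_) (length-allFin m)) ⟩
          t * m
            ≡⟨ *-comm t m ⟩
          m * t ∎)
          where
          open ≤-Reasoning
          arith : ∀ m x → m * (3 * x) ≡ 3 * m * x
          arith = solve-∀

    -- With finish stamps `balance` reads 3 F ≤ F + 9 m OPT.
    identical-total : ∀ {es} → J.Trace es → J.Exhausted es → ∀ σ (f : Feasible I σ) → 2 * J.total es ≤ 9 * m * cost I σ f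
    identical-total {es} tr ex σ f = +-cancelˡ-≤ F _ _ (begin
      3 * F                                                   ≤⟨ J.balance (identical-rival σ f) J.finish (J.finish-sorted single es)
                                                                  (λ t x le → J.rated-finish single tr t x le (J.exhausted-idle es t ex)) ⟩
      F + 3 * (suc a * J.Rival.rivalCost (identical-rival σ f))                                     ≡⟨ cong₂ (λ y z → F + 3 * (y * z)) a≡ (∑-cong (allFin n) (λ u → cong (w u *_) (proj₂ (proj₂ (ct-attained I σ f u))))) ⟩
      F + 3 * (3 * m * cost I σ f)                            ≡⟨ cong (F +_) (arith m (cost I σ f)) ⟩
      F + 9 * m * cost I σ f                                  ∎)
      where
      open ≤-Reasoning
      F = J.total es
      arith : ∀ m o → 3 * (3 * m * o) ≡ 9 * m * o
      arith = solve-∀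

-- Agreement of the string programs with the abstract greedy run and schedule.

module Correct where

  open import Defs hiding (_≤ℝ_; _<ℝ_; initial)
  open Digits
  open Arith using (isOne; _∷ᵇ_; bool)
  open GreedyProgram hiding (costOf)
  open Algorithms hiding (identical; unrelated)
  open Sums
  open Analysis
  open Schedules using (placedOn; on?; loadOf; Placed; schedule)
  open Ratio
  open import Data.Bool using (Bool; true; false; if_then_else_; T)
  open import Data.Bool.Properties using (T-≡)
  open import Data.Digit using (Bit; toDigits; fromDigits)
  open import Data.Fin as Fin using (Fin; toℕ)
  open import Data.Integer as ℤ using (∣_∣)
  open import Data.List.Membership.Propositional using (_∈_)
  open import Data.List.Membership.Propositional.Properties using (∈-allFin)
  open import Data.List.Relation.Unary.Any using (here; there)
  import Data.Fin.Properties as Fin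
  open import Data.List as List using (List; []; _∷_; _++_; _ʳ++_; map; foldl; foldr; concatMap; allFin; length; reverse; zip; upTo; cartesianProduct)
  open import Data.List.Properties using (foldl-++; ʳ++-defn; ++-identityʳ; reverse-involutive; reverse-foldr; ++-assoc; map-∘; map-cong; length-map; length-tabulate; map-tabulate; upTo-∷ʳ; map-concatMap; concatMap-map; map-++; filter-accept; filter-reject; concatMap-cong)
  open import Data.List.Relation.Unary.Unique.Propositional using (Unique)
  open import Data.Nat
  open import Data.Nat.ListAction using (sum)
  open import Data.Nat.Properties
  open import Data.Product using (∃-syntax; _×_; _,_; proj₁; proj₂)
  open import Data.Rational using (ℚ)
  open import Data.Empty using (⊥)
  open import Data.Sum using (_⊎_; inj₁; inj₂)
  open import Data.Unit using (tt)
  open import Data.Vec as Vec using ()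
  open import Function using (Equivalence; id; _∘_)
  open import Relation.Binary.PropositionalEquality
  open import Relation.Nullary using (Dec; yes; no; ¬_; contradiction)

  toBit : Bool → Bit
  toBit false = Fin.zero
  toBit true  = Fin.suc Fin.zero

  isOne-toBit : ∀ b → isOne (toBit b) ≡ b
  isOne-toBit false = refl
  isOne-toBit true  = refl

  private
    ʳ++-reverse : ∀ {A : Set} (xs : List A) → reverse (xs ʳ++ []) ≡ xs
    ʳ++-reverse xs = trans (cong reverse (trans (ʳ++-defn xs) (++-identityʳ (reverse xs)))) (reverse-involutive xs)

    run : Parser → List Token → Parser
    run = foldl parse-step

    run-++ : ∀ xs {ys s s′} → run s xs ≡ s′ → run s (xs ++ ys) ≡ run s′ ys
    run-++ xs {ys} {s} eq = trans (foldl-++ parse-step s xs ys) (cong (λ s → run s ys) eq)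

    run-bits : ∀ bs ds ns inner out → run (((ds , ns) , inner) , out) (map bit bs) ≡ (((bs ʳ++ ds , ns) , inner) , out)
    run-bits []                    ds ns inner out = refl
    run-bits (Fin.zero ∷ bs)          ds ns inner out = run-bits bs (Fin.zero ∷ ds) ns inner out
    run-bits (Fin.suc Fin.zero ∷ bs) ds ns inner out = run-bits bs (Fin.suc Fin.zero ∷ ds) ns inner out

    value-digits : ∀ bs → value (bs ʳ++ []) ≡ fromDigits bs
    value-digits bs = trans (cong value (trans (ʳ++-defn bs) (++-identityʳ (reverse bs))))
      (trans (sym (reverse-foldr (λ b n → isOne b ∷ᵇ n) 0 (reverse bs)))
      (trans (cong (foldr (λ b n → isOne b ∷ᵇ n) 0) (reverse-involutive bs)) (go bs)))
      where
      toℕ-bit : ∀ (b : Bit) → bool (isOne b) ≡ toℕ b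
      toℕ-bit Fin.zero            = refl
      toℕ-bit (Fin.suc Fin.zero) = refl
      go : ∀ bs → foldr (λ b n → isOne b ∷ᵇ n) 0 bs ≡ fromDigits bs
      go []       = refl
      go (b ∷ bs) = cong₂ (λ x y → x + y * 2) (toℕ-bit b) (go bs)

    run-number : ∀ x ns inner out → run ((([] , ns) , inner) , out) (encodeℕ x) ≡ ((([] , x ∷ ns) , inner) , out)
    run-number x ns inner out = trans (run-++ (map bit ds) (run-bits ds [] ns inner out))
      (cong (λ v → (([] , v ∷ ns) , inner) , out) (trans (value-digits ds) (proj₂ (toDigits 2 x))))
      where ds = proj₁ (toDigits 2 x)

    module _ {A : Set} where

      run-numbers : ∀ (f : A → ℕ) xs ns inner out → run ((([] , ns) , inner) , out) (concatMap (λ x → encodeℕ (f x)) xs) ≡ ((([] , map f xs ʳ++ ns) , inner) , out)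
      run-numbers f []       ns inner out = refl
      run-numbers f (x ∷ xs) ns inner out = trans (run-++ (encodeℕ (f x)) (run-number (f x) ns inner out)) (run-numbers f xs (f x ∷ ns) inner out)

      run-bools : ∀ bs ds ns inner out → run (((ds , ns) , inner) , out) (concatMap encodeBool bs) ≡ (((map toBit bs ʳ++ ds , ns) , inner) , out)
      run-bools []           ds ns inner out = refl
      run-bools (false ∷ bs) ds ns inner out = run-bools bs (Fin.zero ∷ ds) ns inner out
      run-bools (true ∷ bs)  ds ns inner out = run-bools bs (Fin.suc Fin.zero ∷ ds) ns inner out

      depth₁ : Inner → Outer → Parser
      depth₁ inner outer = (([] , []) , inner) , (outer , tt ∷ [])

      run-numberList : ∀ (f : A → ℕ) xs inner outer → run (depth₁ inner outer) (encodeList (λ x → encodeℕ (f x)) xs) ≡ depth₁ (([] , map f xs) ∷ inner) outer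
      run-numberList f xs inner outer = trans (run-++ (concatMap (λ x → encodeℕ (f x)) xs) (run-numbers f xs [] inner (outer , tt ∷ tt ∷ [])))
        (cong (λ l → depth₁ (([] , l) ∷ inner) outer) (ʳ++-reverse (map f xs)))

      run-boolList : ∀ bs inner outer → run (depth₁ inner outer) (encodeList encodeBool bs) ≡ depth₁ ((map toBit bs , []) ∷ inner) outer
      run-boolList bs inner outer = trans (run-++ (concatMap encodeBool bs) (run-bools bs [] [] inner (outer , tt ∷ tt ∷ [])))
        (cong (λ l → depth₁ ((l , []) ∷ inner) outer) (ʳ++-reverse (map toBit bs)))

      run-lists : ∀ (enc : A → List Token) (f : A → List Bit × List ℕ) →
                  (∀ x inner outer → run (depth₁ inner outer) (enc x) ≡ depth₁ (f x ∷ inner) outer) →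
                  ∀ xs inner outer → run (depth₁ inner outer) (concatMap enc xs) ≡ depth₁ (map f xs ʳ++ inner) outer
      run-lists enc f h []       inner outer = refl
      run-lists enc f h (x ∷ xs) inner outer = trans (run-++ (enc x) (h x inner outer)) (run-lists enc f h xs (f x ∷ inner) outer)

      depth₀ : Outer → Parser
      depth₀ outer = (([] , []) , []) , (outer , [])

      run-outerNumbers : ∀ (f : A → ℕ) xs outer → run (depth₀ outer) (encodeList (λ x → encodeℕ (f x)) xs) ≡ depth₀ ((map f xs , []) ∷ outer)
      run-outerNumbers f xs outer = trans (run-++ (concatMap (λ x → encodeℕ (f x)) xs) (run-numbers f xs [] [] (outer , tt ∷ [])))
        (cong (λ l → depth₀ ((l , []) ∷ outer)) (ʳ++-reverse (map f xs)))

      run-outerLists : ∀ (enc : A → List Token) (f : A → List Bit × List ℕ) →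
                  (∀ x inner outer → run (depth₁ inner outer) (enc x) ≡ depth₁ (f x ∷ inner) outer) →
                  ∀ xs outer → run (depth₀ outer) (encodeList enc xs) ≡ depth₀ (([] , map f xs) ∷ outer)
      run-outerLists enc f h xs outer = trans (run-++ (concatMap enc xs) (run-lists enc f h xs [] outer))
        (cong (λ l → depth₀ (([] , l) ∷ outer)) (ʳ++-reverse (map f xs)))

  module _ (I : Instance) where
    open Instance I

    maskBits : Fin k → List Bit
    maskBits S = map (λ u → toBit (contains I S u)) (allFin n)

    weights : List ℕ
    weights = map w (allFin n)

    masks : List (List Bit)
    masks = map maskBits (allFin k)

    costRow : Fin m → List ℕ
    costRow j = map (λ S → c S j) (allFin k)

    parse-correct : ∀ ε → parse (encodeInstance I ++ encodeℚ ε) ≡ ((weights , masks) , map costRow (allFin m))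
    parse-correct ε = trans (cong (collect ∘ proj₁ ∘ proj₂) final) result
      where
      toList-lookup : ∀ {A : Set} {n} (xs : Vec.Vec A n) → Vec.toList xs ≡ map (Vec.lookup xs) (allFin n)
      toList-lookup Vec.[]       = refl
      toList-lookup (x Vec.∷ xs) = cong (x ∷_) (trans (toList-lookup xs) (trans (map-∘ (allFin _)) (cong (map (Vec.lookup (x Vec.∷ xs))) (map-tabulate id Fin.suc))))
      outer₁ outer₂ outer₃ : Outer
      outer₁ = (weights , []) ∷ []
      outer₂ = ([] , map (λ S → map toBit (Vec.toList (sets S)) , []) (allFin k)) ∷ outer₁
      outer₃ = ([] , map (λ j → [] , costRow j) (allFin m)) ∷ outer₂
      ws = encodeList (λ u → encodeℕ (w u)) (allFin n)
      ss = encodeList (λ S → encodeList encodeBool (Vec.toList (sets S))) (allFin k)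
      cs = encodeList (λ j → encodeList (λ S → encodeℕ (c S j)) (allFin k)) (allFin m)
      p = ℤ.∣ ℚ.numerator ε ∣
      q = suc (ℚ.denominator-1 ε)
      -- The two numbers of `ε` are read outside every list, so they stay among the current numbers
      -- and the outer lists are those of the instance.
      final : run initial ((ws ++ ss ++ cs) ++ encodeℚ ε) ≡ ((([] , q ∷ p ∷ []) , []) , (outer₃ , []))
      final = trans (cong (run initial) (trans (++-assoc ws (ss ++ cs) (encodeℚ ε)) (cong (ws ++_) (++-assoc ss cs (encodeℚ ε)))))
        (trans (run-++ ws (run-outerNumbers w (allFin n) []))
        (trans (run-++ ss (run-outerLists _ (λ S → map toBit (Vec.toList (sets S)) , []) (λ S → run-boolList {Fin k} (Vec.toList (sets S))) (allFin k) outer₁))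
        (trans (run-++ cs (run-outerLists _ (λ j → [] , costRow j) (λ j → run-numberList (λ S → c S j) (allFin k)) (allFin m) outer₂))
        (trans (run-++ (encodeℕ p) (run-number p [] [] (outer₃ , []))) (run-number q (p ∷ []) [] (outer₃ , []))))))
      result : collect outer₃ ≡ ((weights , masks) , map costRow (allFin m))
      result = cong₂ (λ x y → (weights , x) , y)
        (trans (sym (map-∘ (allFin k))) (map-cong (λ S → trans (cong (map toBit) (toList-lookup (sets S))) (sym (map-∘ (allFin n)))) (allFin k)))
        (sym (map-∘ (allFin m)))

  private
    zip-map : ∀ {A B C : Set} (f : A → B) (g : A → C) xs → zip (map f xs) (map g xs) ≡ map (λ x → f x , g x) xs
    zip-map f g []       = refl
    zip-map f g (x ∷ xs) = cong ((f x , g x) ∷_) (zip-map f g xs)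

    toℕ-upTo : ∀ n → map toℕ (allFin n) ≡ upTo n
    toℕ-upTo n = trans (map-tabulate id toℕ) (go n id)
      where
      go : ∀ n (f : ℕ → ℕ) → List.tabulate {n = n} (λ i → f (toℕ i)) ≡ List.applyUpTo f n
      go zero    f = refl
      go (suc n) f = cong (f 0 ∷_) (go n (f ∘ suc))

    labels-run : ∀ {X : Set} (l rest : List X) out → length l ≡ length rest →
                 proj₂ (foldl (λ s _ → label-step s) (rest , out) l) ≡ upTo (length rest) ++ out
    labels-run []      []         out eq = refl
    labels-run (_ ∷ l) (r ∷ rest) out eq = trans (labels-run l rest (length rest ∷ out) (suc-injective eq))
      (trans (sym (++-assoc (upTo (length rest)) (length rest ∷ []) out)) (cong (_++ out) (upTo-∷ʳ (length rest))))

  labels-allFin : ∀ {X : Set} {n} (f : Fin n → X) → labels (map f (allFin n)) ≡ map toℕ (allFin n)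
  labels-allFin {n = n} f = trans (labels-run xs xs [] refl) (trans (++-identityʳ _)
    (trans (cong upTo (trans (length-map f (allFin n)) (length-tabulate {n = n} id))) (sym (toℕ-upTo n))))
    where xs = map f (allFin n)

  -- The greedy rule consults a job only through its machine, cost and weight, so it commutes with
  -- every encoding that preserves these.
  module Natural {Job₁ Job₂ : Set} (code : Job₁ → Job₂) (vm₁ cost₁ : Job₁ → ℕ) (vm₂ cost₂ : Job₂ → ℕ)
                 (W₁ : List Job₁ → Job₁ → ℕ) (W₂ : List Job₂ → Job₂ → ℕ) (a : ℕ)
                 (vm≡ : ∀ x → vm₂ (code x) ≡ vm₁ x) (cost≡ : ∀ x → cost₂ (code x) ≡ cost₁ x)
                 (W≡ : ∀ es x → W₂ (map code es) (code x) ≡ W₁ es x) where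

    module G₁ = Greedy vm₁ cost₁ W₁ a
    module G₂ = Greedy vm₂ cost₂ W₂ a

    private
      load-natural : ∀ v es → G₂.load v (map code es) ≡ G₁.load v es
      load-natural v []       = refl
      load-natural v (e ∷ es) rewrite vm≡ e | cost≡ e | load-natural v es = refl

      ready-natural : ∀ es x → G₂.ready (map code es) (code x) ≡ G₁.ready es x
      ready-natural es x rewrite vm≡ x | cost≡ x | load-natural (vm₁ x) es = refl

      beats-natural : ∀ es x y → G₂.beats (map code es) (code x) (code y) ≡ G₁.beats es x y
      beats-natural es x y rewrite ready-natural es x | ready-natural es y | W≡ es x | W≡ es y | cost≡ x | cost≡ y = refl

      if-map : ∀ b {x y : List Job₁} → (if b then map code x else map code y) ≡ map code (if b then x else y)
      if-map true  = refl
      if-map false = refl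

      better-natural : ∀ es o x → G₂.better (map code es) (map code o) (code x) ≡ map code (G₁.better es o x)
      better-natural es []      x rewrite W≡ es x = if-map (W₁ es x ≡ᵇ 0)
      better-natural es (y ∷ o) x = trans
        (cong₂ (λ r b → if r ≡ᵇ 0 then map code (y ∷ o) else (if b then code x ∷ [] else map code (y ∷ o))) (W≡ es x) (beats-natural es x y))
        (trans (cong (λ l → if W₁ es x ≡ᵇ 0 then map code (y ∷ o) else l) (if-map (G₁.beats es x y))) (if-map (W₁ es x ≡ᵇ 0)))

      best-natural : ∀ es J o → foldl (G₂.better (map code es)) (map code o) (map code J) ≡ map code (foldl (G₁.better es) o J)
      best-natural es []      o = refl
      best-natural es (x ∷ J) o = trans (cong (λ o → foldl (G₂.better (map code es)) o (map code J)) (better-natural es o x))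
        (best-natural es J (G₁.better es o x))

    events-natural : ∀ {A : Set} J (l : List A) → G₂.events (map code J) l ≡ map code (G₁.events J l)
    events-natural J l = go l []
      where
      go : ∀ l es → foldl (λ es _ → G₂.best (map code J) es ++ es) (map code es) l ≡ map code (foldl (λ es _ → G₁.best J es ++ es) es l)
      go []      es = refl
      go (_ ∷ l) es = trans (cong (λ z → foldl (λ es _ → G₂.best (map code J) es ++ es) z l)
        (trans (cong (_++ map code es) (best-natural es J [])) (sym (map-++ code (G₁.best J es) es)))) (go l (G₁.best J es ++ es))

  module Encoded (I : Instance) {mv : ℕ} (cv : Fin (Instance.k I) → Fin mv → ℕ) (cv≥1 : ∀ S v → 1 ≤ cv S v) (a : ℕ) where
    open Instance I
    module V = Virtual w (contains I) cv cv≥1 a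

    code : V.Job → Job
    code (v , S) = ((toℕ v , toℕ S) , maskBits I S) , cv S v

    private
      erase-map : ∀ (cov : Fin n → Bool) (f : Fin n → ℕ) xs →
                  erase (map (toBit ∘ cov) xs) (map f xs) ≡ map (λ u → if cov u then 0 else f u) xs
      erase-map cov f xs = trans (cong (map _) (zip-map (toBit ∘ cov) f xs)) (trans (sym (map-∘ xs))
        (map-cong (λ u → cong (λ b → if b then 0 else f u) (isOne-toBit (cov u))) xs))

      residuals-map : ∀ es → residuals (weights I) (map code es) ≡ map (V.resid es) (allFin n)
      residuals-map []             = refl
      residuals-map ((v , S) ∷ es) = trans (cong (erase (maskBits I S)) (residuals-map es)) (erase-map (contains I S) (V.resid es) (allFin n))

      weight-map : ∀ (cov : Fin n → Bool) (f : Fin n → ℕ) xs → weight (map (toBit ∘ cov) xs) (map f xs) ≡ ∑ xs (λ u → if cov u then f u else 0)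
      weight-map cov f []       = refl
      weight-map cov f (u ∷ xs) = cong₂ (λ b t → (if b then f u else 0) + t) (isOne-toBit (cov u)) (weight-map cov f xs)

      W-map : ∀ es x → W (weights I) (map code es) (code x) ≡ V.W es x
      W-map es (v , S) = trans (cong (weight (maskBits I S)) (residuals-map es)) (weight-map (contains I S) (V.resid es) (allFin n))

    events-code : ∀ J → G.events ((weights I , J) , a) (map code V.allJobs) (weights I) ≡ map code (V.events V.allJobs (weights I))
    events-code J = Natural.events-natural code V.vm V.cost machineOf GreedyProgram.costOf V.W (W (weights I)) a
      (λ _ → refl) (λ _ → refl) W-map V.allJobs (weights I)

    jobs-code : jobs (masks I) (map (λ v → map (λ S → cv S v) (allFin k)) (allFin mv)) ≡ map code V.allJobs
    jobs-code = begin
      jobs (masks I) (map row (allFin mv))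
        ≡⟨ cong (concatMap jobsOfRow) (trans (cong (λ l → zip l (map row (allFin mv))) (labels-allFin row)) (zip-map toℕ row (allFin mv))) ⟩
      concatMap jobsOfRow (map (λ v → toℕ v , row v) (allFin mv))
        ≡⟨ concatMap-map jobsOfRow (λ v → toℕ v , row v) (allFin mv) ⟩
      concatMap (λ v → jobsOfRow (toℕ v , row v)) (allFin mv)
        ≡⟨ concatMap-cong row-code (allFin mv) ⟩
      concatMap (λ v → map code (map (v ,_) (allFin k))) (allFin mv)
        ≡⟨ sym (map-concatMap code (λ v → map (v ,_) (allFin k)) (allFin mv)) ⟩
      map code (concatMap (λ v → map (v ,_) (allFin k)) (allFin mv))
        ≡⟨ cong (map code) (product-concatMap (allFin mv)) ⟩
      map code V.allJobs ∎
      where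
      open ≡-Reasoning
      row : Fin mv → List ℕ
      row v = map (λ S → cv S v) (allFin k)
      jobsOfRow : ℕ × List ℕ → List Job
      jobsOfRow (v , row) = map (λ ((S , mask) , c) → ((v , S) , mask) , c) (zip (zip (labels (masks I)) (masks I)) row)
      row-code : ∀ v → jobsOfRow (toℕ v , row v) ≡ map code (map (v ,_) (allFin k))
      row-code v = trans (cong (λ l → map _ (zip l (row v))) (trans (cong (λ l → zip l (masks I)) (labels-allFin (maskBits I))) (zip-map toℕ (maskBits I) (allFin k))))
        (trans (cong (map _) (zip-map (λ S → toℕ S , maskBits I S) (λ S → cv S v) (allFin k))) (trans (sym (map-∘ (allFin k))) (map-∘ (allFin k))))
      product-concatMap : ∀ vs → concatMap (λ v → map (v ,_) (allFin k)) vs ≡ cartesianProduct vs (allFin k)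
      product-concatMap []       = refl
      product-concatMap (v ∷ vs) = cong (map (v ,_) (allFin k) ++_) (product-concatMap vs)

  module _ (I : Instance) where
    open Instance I

    toℕ² : Fin m × Fin k → ℕ × ℕ
    toℕ² (j , S) = toℕ j , toℕ S

    print-correct : ∀ pl (u : Unique (map proj₂ pl)) → print (map toℕ² pl) (map toℕ (allFin m)) ≡ encodeSchedule (schedule I pl u)
    print-correct pl u = cong (λ l → [[ ∷ l ++ ]] ∷ []) (trans (concatMap-map _ toℕ (allFin m))
      (concatMap-cong (λ j → cong (λ l → [[ ∷ l ++ ]] ∷ []) (on-machine j pl)) (allFin m)))
      where
      on-machine : ∀ j pl → concatMap (λ (i , S) → if i ≡ᵇ toℕ j then map bit (digits S) ++ end ∷ [] else []) (map toℕ² pl)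
                   ≡ concatMap (encodeℕ ∘ toℕ) (placedOn I pl j)
      on-machine j []             = refl
      on-machine j ((i , S) ∷ pl) = go (i Fin.≟ j)
        where
        go : Dec (i ≡ j) → (if toℕ i ≡ᵇ toℕ j then map bit (digits (toℕ S)) ++ end ∷ [] else []) ++ concatMap _ (map toℕ² pl)
             ≡ concatMap (encodeℕ ∘ toℕ) (placedOn I ((i , S) ∷ pl) j)
        go (yes refl) rewrite Equivalence.to T-≡ (≡⇒≡ᵇ (toℕ i) (toℕ i) refl) =
          trans (cong₂ (λ d l → (map bit d ++ end ∷ []) ++ l) (digits-toDigits (toℕ S)) (on-machine i pl))
                (cong (concatMap (encodeℕ ∘ toℕ) ∘ map proj₂) (sym (filter-accept (on? I i) refl)))
        go (no ne) with toℕ i ≡ᵇ toℕ j in eq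
        ... | true  = contradiction (Fin.toℕ-injective (≡ᵇ⇒≡ _ _ (subst T (sym eq) tt))) ne
        ... | false = trans (on-machine j pl) (cong (concatMap (encodeℕ ∘ toℕ) ∘ map proj₂) (sym (filter-reject (on? I j) ne)))

    module _ (j₀ : Fin m) (identical : Identical I) (a : ℕ) (a≡ : suc a ≡ 3 * m) where

      open Encoded I (c₁ I j₀ identical a a≡) (λ S _ → c≥1 S j₀) a using (code)

      entry : Fin m × Fin k → ℕ × (ℕ × ℕ)
      entry (i , S) = toℕ i , (toℕ S , c S j₀)

      private
        loadOn-entry : ∀ pl j → loadOn (map entry pl) (toℕ j) ≡ loadOf I pl j
        loadOn-entry []             j = refl
        loadOn-entry ((i , S) ∷ pl) j = go (i Fin.≟ j)
          where
          go : Dec (i ≡ j) → (if toℕ i ≡ᵇ toℕ j then c S j₀ + loadOn (map entry pl) (toℕ j) else loadOn (map entry pl) (toℕ j)) ≡ loadOf I ((i , S) ∷ pl) j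
          go (yes refl) rewrite Equivalence.to T-≡ (≡⇒≡ᵇ (toℕ i) (toℕ i) refl) =
            trans (cong₂ _+_ (identical S j₀ i) (loadOn-entry pl i)) (cong (λ l → sum (map (λ S → c S i) (map proj₂ l))) (sym (filter-accept (on? I i) refl)))
          go (no ne) with toℕ i ≡ᵇ toℕ j in eq
          ... | true  = contradiction (Fin.toℕ-injective (≡ᵇ⇒≡ _ _ (subst T (sym eq) tt))) ne
          ... | false = trans (loadOn-entry pl j) (cong (λ l → sum (map (λ S → c S j) (map proj₂ l))) (sym (filter-reject (on? I j) ne)))

        -- The invariant of the search for a least loaded machine; `P` holds for the machines seen
        -- so far.
        LeastOf : Placed I → (Fin m → Set) → List ℕ → Set
        LeastOf pl P o = (o ≡ [] × (∀ j → ¬ P j)) ⊎ (∃[ i ] o ≡ toℕ i ∷ [] × (∀ j → P j → loadOf I pl i ≤ loadOf I pl j))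

        leastOf-weaken : ∀ {pl} {P Q : Fin m → Set} {o} → (∀ {j} → Q j → P j) → LeastOf pl P o → LeastOf pl Q o
        leastOf-weaken f (inj₁ (eq , h))     = inj₁ (eq , λ j q → h j (f q))
        leastOf-weaken f (inj₂ (i , eq , h)) = inj₂ (i , eq , λ j q → h j (f q))

        least-once : ∀ pl P o j → LeastOf pl P o → LeastOf pl (λ i → P i ⊎ i ≡ j) (least-step (map entry pl) o (toℕ j))
        least-once pl P .[] j (inj₁ (refl , h)) = inj₂ (j , refl , λ { i (inj₁ p) → contradiction p (h i) ; i (inj₂ refl) → ≤-refl })
        least-once pl P .(toℕ i ∷ []) j (inj₂ (i , refl , h)) rewrite loadOn-entry pl i | loadOn-entry pl j with loadOf I pl i ≤ᵇ loadOf I pl j in eq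
        ... | true  = inj₂ (i , refl , λ { l (inj₁ p) → h l p ; l (inj₂ refl) → ≤ᵇ⇒≤ _ _ (subst T (sym eq) tt) })
        ... | false = inj₂ (j , refl , λ { l (inj₁ p) → ≤-trans (<⇒≤ (≰⇒> (λ le → subst T eq (≤⇒≤ᵇ le)))) (h l p) ; l (inj₂ refl) → ≤-refl })

        least-foldl : ∀ pl P js o → LeastOf pl P o → LeastOf pl (λ i → P i ⊎ i ∈ js) (foldl (least-step (map entry pl)) o (map toℕ js))
        least-foldl pl P []       o h = leastOf-weaken {pl} (λ { (inj₁ p) → p ; (inj₂ ()) }) h
        least-foldl pl P (j ∷ js) o h = leastOf-weaken {pl}
          (λ { (inj₁ p) → inj₁ (inj₁ p) ; (inj₂ (here refl)) → inj₁ (inj₂ refl) ; (inj₂ (there p)) → inj₂ p })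
          (least-foldl pl _ js _ (least-once pl P o j h))

        least-all : ∀ pl → ∃[ i ] leastLoaded (map toℕ (allFin m)) (map entry pl) ≡ toℕ i ∷ [] × Least I j₀ identical a a≡ pl i
        least-all pl with least-foldl pl (λ _ → ⊥) (allFin m) [] (inj₁ (refl , λ _ ()))
        ... | inj₁ (_ , h)      = contradiction (inj₂ (∈-allFin j₀)) (h j₀)
        ... | inj₂ (i , eq , h) = i , eq , λ j → h j (inj₂ (∈-allFin j))

      -- The assignment is read off the run of the program instead of being defined a second time on
      -- finite types, together with the fact that each chosen machine was least loaded.
      place-correct : ∀ es → ∃[ pl ] place (map toℕ (allFin m)) (map code es) ≡ map entry pl × ListSchedule I j₀ identical a a≡ es pl
      place-correct [] = [] , refl , []
      place-correct ((v , S) ∷ es) with place-correct es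
      ... | pl , eq , ls with least-all pl
      ...   | i , eq′ , least = (i , S) ∷ pl ,
        cong₂ (λ is pl → map (λ i → i , (toℕ S , c S j₀)) is ++ pl) (trans (cong (leastLoaded (map toℕ (allFin m))) eq) eq′) eq ,
        assign least ls

-- Bounds on e / (e - 1) and embedding of natural numbers.

module Rationals where

  open import Defs
  open import Data.Integer as ℤ using (+_)
  import Data.Integer.Properties as ℤ
  open import Data.Nat as ℕ using (ℕ; zero; suc)
  import Data.Nat.Properties as ℕ
  open import Data.Product using (_×_; _,_; ∃-syntax)
  open import Data.Rational
  import Data.Rational.Properties as ℚ
  import Data.Rational.Unnormalised as ℚᵘ
  import Data.Rational.Unnormalised.Properties as ℚᵘ
  open import Algebra.Definitions.RawSemiring +-*-rawSemiring using (_^_)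
  open import Relation.Binary.PropositionalEquality
  open import Relation.Nullary.Decidable using (toWitness)
  open CauchyLemmas using (*-mono)
  open RecipLemmas
  open SeriesLemmas

  private
    fromℕᵘ : ∀ n → toℚᵘ (fromℕ n) ℚᵘ.≃ ℚᵘ.mkℚᵘ (+ n) 0
    fromℕᵘ n = ℚ.toℚᵘ-fromℚᵘ (ℚᵘ.mkℚᵘ (+ n) 0)

  fromℕ-* : ∀ m n → fromℕ (m ℕ.* n) ≡ fromℕ m * fromℕ n
  fromℕ-* m n = ℚ.toℚᵘ-injective (begin
    toℚᵘ (fromℕ (m ℕ.* n))                       ≈⟨ fromℕᵘ (m ℕ.* n) ⟩
    ℚᵘ.mkℚᵘ (+ (m ℕ.* n)) 0                      ≈⟨ ℚᵘ.*≡* (cong (ℤ._* + 1) (ℤ.pos-* m n)) ⟩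
    ℚᵘ.mkℚᵘ (+ m) 0 ℚᵘ.* ℚᵘ.mkℚᵘ (+ n) 0         ≈⟨ ℚᵘ.≃-sym (ℚᵘ.*-cong (fromℕᵘ m) (fromℕᵘ n)) ⟩
    toℚᵘ (fromℕ m) ℚᵘ.* toℚᵘ (fromℕ n)           ≈⟨ ℚᵘ.≃-sym (ℚ.toℚᵘ-homo-* (fromℕ m) (fromℕ n)) ⟩
    toℚᵘ (fromℕ m * fromℕ n)                     ∎)
    where open import Relation.Binary.Reasoning.Setoid ℚᵘ.≃-setoid

  fromℕ-mono : ∀ {m n} → m ℕ.≤ n → fromℕ m ≤ fromℕ n
  fromℕ-mono {m} {n} m≤n = ℚ.toℚᵘ-cancel-≤ (begin
    toℚᵘ (fromℕ m)      ≃⟨ fromℕᵘ m ⟩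
    ℚᵘ.mkℚᵘ (+ m) 0     ≤⟨ ℚᵘ.*≤* (ℤ.*-monoʳ-≤-nonNeg (+ 1) (ℤ.+≤+ m≤n)) ⟩
    ℚᵘ.mkℚᵘ (+ n) 0     ≃⟨ ℚᵘ.≃-sym (fromℕᵘ n) ⟩
    toℚᵘ (fromℕ n)      ∎)
    where open ℚᵘ.≤-Reasoning

  fromℕ-nonNeg : ∀ n → NonNegative (fromℕ n)
  fromℕ-nonNeg n = nonNegative (fromℕ-mono (ℕ.z≤n {n}))

  fromℕ-^ : ∀ m d → fromℕ (m ℕ.^ d) ≡ fromℕ m ^ d
  fromℕ-^ m zero    = refl
  fromℕ-^ m (suc d) = trans (fromℕ-* m (m ℕ.^ d)) (cong (fromℕ m *_) (fromℕ-^ m d))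

  private
    -- The upper estimates `eSeq n` + 1 / n! decrease from n = 1 on, where the value is 3.
    e≤3 : ∀ n → 1 ℕ.≤ n → eSeq n ≤ fromℕ 3
    e≤3 n 1≤n = ℚ.≤-trans (ℚ.≤-trans (ℚ.≤-reflexive (sym (ℚ.+-identityʳ (eSeq n)))) (ℚ.+-monoʳ-≤ (eSeq n) (0≤invFact n)))
      (upper-mono (ℕ.s≤s ℕ.z≤n) (ℕ.≤⇒≤′ 1≤n))

    ratio : ℕ → ℚ
    ratio n = eSeq n * recip (eSeq n - 1ℚ)

    -- In this form x / (x - 1) is visibly decreasing in x, so bounds on e turn into bounds on the
    -- ratio.
    ratio≡ : ∀ n → 1 ℕ.≤ n → ratio n ≡ 1ℚ + recip (eSeq n - 1ℚ)
    ratio≡ n 1≤n = begin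
      eSeq n * recip d            ≡⟨ cong (_* recip d) (CauchyLemmas.sub-add (eSeq n) 1ℚ) ⟩
      (d + 1ℚ) * recip d          ≡⟨ ℚ.*-distribʳ-+ (recip d) d 1ℚ ⟩
      d * recip d + 1ℚ * recip d  ≡⟨ cong₂ _+_ (recip-inverse d 0<d) (ℚ.*-identityˡ (recip d)) ⟩
      1ℚ + recip d                ∎
      where
      open ≡-Reasoning
      d = eSeq n - 1ℚ
      0<d : 0ℚ < d
      0<d = ℚ.<-≤-trans (ℚ.positive⁻¹ 1ℚ) (ℚ.+-monoˡ-≤ (- 1ℚ) (eSeq-mono (ℕ.≤⇒≤′ 1≤n)))

    ratio-lower : ∀ n → 1 ℕ.≤ n → + 3 / 2 ≤ ratio n
    ratio-lower n 1≤n = subst (+ 3 / 2 ≤_) (sym (ratio≡ n 1≤n)) (ℚ.+-monoʳ-≤ 1ℚ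
      (recip-anti (eSeq n - 1ℚ) (fromℕ 2) (ℚ.<-≤-trans (ℚ.positive⁻¹ 1ℚ) (ℚ.+-monoˡ-≤ (- 1ℚ) (eSeq-mono (ℕ.≤⇒≤′ 1≤n))))
        (ℚ.+-monoˡ-≤ (- 1ℚ) (e≤3 n 1≤n))))

    -- Index 6 is the first that is good enough: 4 times the bound is about 6.3282, while `eSeq 5`
    -- would give 6.3301.
    ratio-upper : ∀ n → 6 ℕ.≤ n → ratio n ≤ 1ℚ + recip (eSeq 6 - 1ℚ)
    ratio-upper n 6≤n = ℚ.≤-trans (ℚ.≤-reflexive (ratio≡ n (ℕ.≤-trans (ℕ.s≤s ℕ.z≤n) 6≤n))) (ℚ.+-monoʳ-≤ 1ℚ
      (recip-anti (eSeq 6 - 1ℚ) (eSeq n - 1ℚ) (toWitness {a? = 0ℚ ℚ.<? (eSeq 6 - 1ℚ)} _) (ℚ.+-monoˡ-≤ (- 1ℚ) (eSeq-mono (ℕ.≤⇒≤′ 6≤n)))))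

  -- e ≤ 3 gives e / (e - 1) ≥ 3 / 2.
  scaled-lower : ∀ c r → .{{_ : NonNegative c}} → fromℕ r ≤ c * (+ 3 / 2) → ∀ n → 1 ℕ.≤ n → fromℕ r ≤ ℝ.seq (fromℚ c *ℝ e/[e-1]) n
  scaled-lower c r h n 1≤n = ℚ.≤-trans h (ℚ.*-monoˡ-≤-nonNeg c (ratio-lower n 1≤n))

  scaled-upper : ∀ c b → .{{_ : NonNegative c}} → c * (1ℚ + recip (eSeq 6 - 1ℚ)) + (+ 1 / 2000) + (+ 1 / 2000) ≤ b →
                 ∃[ ε ] Positive ε × fromℚ c *ℝ e/[e-1] +ℝ fromℚ ε <ℝ fromℚ b
  -- The first 1 / 2000 is ε, the second the gap that `_<ℝ_` asks for. The available margins are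
  -- about 0.0018 for the factor 4 and 0.0036 for 8.
  scaled-upper c b h = + 1 / 2000 , _ , + 1 / 2000 , ℚ.positive⁻¹ (+ 1 / 2000) , 6 , λ n 6≤n →
    ℚ.≤-trans (ℚ.+-monoˡ-≤ (+ 1 / 2000) (ℚ.+-monoˡ-≤ (+ 1 / 2000) (ℚ.*-monoˡ-≤-nonNeg c (ratio-upper n 6≤n)))) h

  -- The bound on ρ is asked from index 1 on: at index 0 the sequence of `e/[e-1]` shows the default
  -- value of `recip`, as `eSeq 0` is 1.
  within : ∀ ρ ε → .{{_ : Positive ε}} → ∀ r x v → (∀ n → 1 ℕ.≤ n → fromℕ r ≤ ℝ.seq ρ n) → x ℕ.≤ r ℕ.* v →
           fromℚ (fromℕ x) ≤ℝ (ρ +ℝ fromℚ ε) *ℝ fromℚ (fromℕ v)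
  within ρ ε r x v h x≤ δ 0<δ = 1 , λ n 1≤n → begin
    fromℕ x                                ≤⟨ fromℕ-mono x≤ ⟩
    fromℕ (r ℕ.* v)                        ≡⟨ fromℕ-* r v ⟩
    fromℕ r * fromℕ v                      ≤⟨ ℚ.*-monoʳ-≤-nonNeg (fromℕ v) {{fromℕ-nonNeg v}} (begin
        fromℕ r                              ≡⟨ sym (ℚ.+-identityʳ (fromℕ r)) ⟩
        fromℕ r + 0ℚ                         ≤⟨ ℚ.+-mono-≤ (h n 1≤n) (ℚ.<⇒≤ (ℚ.positive⁻¹ ε)) ⟩
        ℝ.seq ρ n + ε                        ∎) ⟩
    (ℝ.seq ρ n + ε) * fromℕ v              ≡⟨ sym (ℚ.+-identityʳ _) ⟩
    (ℝ.seq ρ n + ε) * fromℕ v + 0ℚ         ≤⟨ ℚ.+-monoʳ-≤ ((ℝ.seq ρ n + ε) * fromℕ v) (ℚ.<⇒≤ 0<δ) ⟩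
    (ℝ.seq ρ n + ε) * fromℕ v + δ          ∎
    where open ℚ.≤-Reasoning

-- The approximation algorithms and their constants.

module Assembly where

  open import Defs hiding (initial)
  open Bounds
  open PolynomialTime using (PolyTime)
  open InOut
  open GreedyProgram using (machineOf; setOf; module G)
  open Algorithms
  open Correct
  open Analysis
  open Schedules
  open Ratio
  open Rationals
  open import Data.Fin as Fin using (Fin)
  open import Data.Integer as ℤ using (+_)
  open import Data.List using (List; []; _∷_; _++_; map; reverse; length; allFin; foldl; tabulate)
  open import Data.List.Properties using (map-∘; reverse-map; length-map; length-tabulate)
  open import Data.Nat as ℕ using (ℕ; zero; suc; s≤s; z≤n)
  import Data.Nat.Properties as ℕ
  open import Data.Nat.Tactic.RingSolver using (solve-∀)
  open import Data.Product using (Σ; Σ-syntax; ∃-syntax; _×_; _,_; proj₁; proj₂)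
  open import Data.Rational hiding (_⊔_; _⊓_)
  import Data.Rational.Properties as ℚ
  open import Algebra.Definitions.RawSemiring +-*-rawSemiring using (_^_)
  open import Function using (id; _∘_)
  open import Relation.Binary.PropositionalEquality
  open import Relation.Nullary.Decidable using (toWitness)

  -- An integer ratio against every feasible schedule keeps the correctness proofs in ℕ; the minimum
  -- and the real ratio are brought in by `approximates⇒`.
  Approximates : (Instance → Set) → ℕ → (List Token → List Token) → Set
  Approximates P r f = ∀ I → P I → ∀ ε → ∃[ σ ] Σ[ φ ∈ Feasible I σ ] f (encodeInstance I ++ encodeℚ ε) ≡ encodeSchedule σ ×
                       (∀ σ′ φ′ → cost I σ φ ℕ.≤ r ℕ.* cost I σ′ φ′)

  private
    monomial-eval : ∀ C D L y → eval ((C , D , 0) ∷ []) (fromℕ L) y ≡ fromℕ (C ℕ.* L ℕ.^ D)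
    monomial-eval C D L y = begin
      fromℕ C * fromℕ L ^ D * 1ℚ + 0ℚ   ≡⟨ ℚ.+-identityʳ _ ⟩
      fromℕ C * fromℕ L ^ D * 1ℚ        ≡⟨ ℚ.*-identityʳ _ ⟩
      fromℕ C * fromℕ L ^ D             ≡⟨ cong (fromℕ C *_) (sym (fromℕ-^ L D)) ⟩
      fromℕ C * fromℕ (L ℕ.^ D)         ≡⟨ sym (fromℕ-* C (L ℕ.^ D)) ⟩
      fromℕ (C ℕ.* L ℕ.^ D)             ∎
      where open ≡-Reasoning

    -- The time bound is known at `suc L` but has to be a polynomial in the input length L itself.
    -- For a nonempty input suc L ≤ 2 L, at the price of a factor 2 ^ D.
    pow-suc : ∀ L D → 1 ℕ.≤ L → suc L ℕ.^ D ℕ.≤ 2 ℕ.^ D ℕ.* L ℕ.^ D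
    pow-suc L zero    1≤L = s≤s z≤n
    pow-suc L (suc D) 1≤L = begin
      suc L ℕ.* suc L ℕ.^ D                           ≤⟨ ℕ.*-mono-≤ (ℕ.≤-trans (ℕ.+-monoˡ-≤ L 1≤L) (ℕ.≤-reflexive (cong (L ℕ.+_) (sym (ℕ.+-identityʳ L))))) (pow-suc L D 1≤L) ⟩
      (2 ℕ.* L) ℕ.* (2 ℕ.^ D ℕ.* L ℕ.^ D)             ≡⟨ ℕ.[m*n]*[o*p]≡[m*o]*[n*p] 2 L (2 ℕ.^ D) (L ℕ.^ D) ⟩
      2 ℕ.^ suc D ℕ.* L ℕ.^ suc D                     ∎
      where open ℕ.≤-Reasoning

    module _ (M : TM) (C D : ℕ) where

      polynomial : Polynomial
      polynomial = (C ℕ.* 2 ℕ.^ D , D , 0) ∷ []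

      time : ∀ L y t → 1 ℕ.≤ L → t ℕ.≤ C ℕ.* suc L ℕ.^ D → fromℕ t ≤ eval polynomial (fromℕ L) y
      time L y t 1≤L t≤ = ℚ.≤-trans (fromℕ-mono (begin
        t                                ≤⟨ t≤ ⟩
        C ℕ.* suc L ℕ.^ D                ≤⟨ ℕ.*-monoʳ-≤ C (pow-suc L D 1≤L) ⟩
        C ℕ.* (2 ℕ.^ D ℕ.* L ℕ.^ D)      ≡⟨ sym (ℕ.*-assoc C (2 ℕ.^ D) (L ℕ.^ D)) ⟩
        C ℕ.* 2 ℕ.^ D ℕ.* L ℕ.^ D        ∎)) (ℚ.≤-reflexive (sym (monomial-eval (C ℕ.* 2 ℕ.^ D) D L y)))
        where open ℕ.≤-Reasoning

      approximates⇒ : ∀ {P f} r ρ → Approximates P r f → (∀ n → 1 ℕ.≤ n → fromℕ r ≤ ℝ.seq ρ n) →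
                      (∀ xs → ∃[ t ] t ℕ.≤ C ℕ.* suc (length xs) ℕ.^ D × Computes_↦_In_Steps M xs (f xs) t) → HasApproximation P ρ
      approximates⇒ {P} {f} r ρ app lower computes = M , polynomial , λ I pI ε → result I ε (app I pI ε) (computes (encodeInstance I ++ encodeℚ ε))
        where
        input : Instance → ℚ → List Token
        input I ε = encodeInstance I ++ encodeℚ ε
        result : ∀ I ε .{{_ : Positive ε}} →
          (∃[ σ ] Σ[ φ ∈ Feasible I σ ] f (input I ε) ≡ encodeSchedule σ × (∀ σ′ φ′ → cost I σ φ ℕ.≤ r ℕ.* cost I σ′ φ′)) →
          (∃[ t ] t ℕ.≤ C ℕ.* suc (length (input I ε)) ℕ.^ D × Computes_↦_In_Steps M (input I ε) (f (input I ε)) t) →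
          Σ (Schedule I) λ σ → Σ (Feasible I σ) λ feasible → ∃[ t ]
            (Computes_↦_In_Steps M (input I ε) (encodeSchedule σ) t
              × fromℕ t ≤ eval polynomial (fromℕ (length (input I ε))) ((1/ ε) {{ℚ.pos⇒nonZero ε}}))
            × ∃[ opt ] IsMinCost I opt
              × fromℚ (fromℕ (cost I σ feasible)) ≤ℝ (ρ +ℝ fromℚ ε) *ℝ fromℚ (fromℕ opt)
        result I ε (σ , φ , output , ratio) (t , t≤ , run) = σ , φ , t ,
          (subst (λ y → Computes_↦_In_Steps M (input I ε) y t) output run , time (length (input I ε)) ((1/ ε) {{ℚ.pos⇒nonZero ε}}) t (s≤s z≤n) t≤) ,
          cost I (proj₁ best) (proj₂ best) , proj₂ (minCost-exists I (σ , φ)) ,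
          within ρ ε r (cost I σ φ) _ lower (ratio (proj₁ best) (proj₂ best))
          where best = proj₁ (minCost-exists I (σ , φ))

  approximation : ∀ {P f} r ρ → PolyTime f → Approximates P r f → (∀ n → 1 ℕ.≤ n → fromℕ r ≤ ℝ.seq ρ n) → HasApproximation P ρ
  approximation r ρ p app lower = approximates⇒ (machine p) (proj₁ bound) (proj₁ (proj₂ bound)) r ρ app lower
    (λ xs → let t , t≤ , run = proj₂ (machine-correct p) xs in t , ℕ.≤-trans t≤ (proj₂ (proj₂ bound) (length xs)) , run)
    where bound = monomial (proj₁ (machine-correct p))

  private
    length-weights : ∀ I → Instance.n I ℕ.≤ length (weights I)
    length-weights I = ℕ.≤-reflexive (sym (trans (length-map _ (allFin (Instance.n I))) (length-tabulate {n = Instance.n I} id)))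

  unrelated-approximates : Approximates Unrelated 8 unrelated
  unrelated-approximates I _ ε = result , feasible ,
    trans (cong out (parse-correct I ε)) printed , λ σ φ → begin
      cost I result feasible        ≡⟨ sym (ℕ.*-identityˡ _) ⟩
      1 ℕ.* cost I result feasible  ≤⟨ placed-cost tr ex pl j₀ ⟩
      1 ℕ.* V.total es                              ≡⟨ ℕ.*-identityˡ _ ⟩
      V.total es                                    ≤⟨ unrelated-total I tr ex σ φ ⟩
      8 ℕ.* cost I σ φ                              ∎
    where
    open ℕ.≤-Reasoning
    open Instance I
    open Unrel I using (placed-feasible; placed-cost; placed-unique)
    open Encoded I c c≥1 3 using (module V; code; events-code; jobs-code)
    j₀ : Fin m
    j₀ = Fin.fromℕ< m≥1
    es = V.events V.allJobs (weights I)
    tr = proj₁ (V.events-trace (weights I) (length-weights I))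
    ex = proj₂ (V.events-trace (weights I) (length-weights I))
    pl = unrelated-placing I es
    unique = placed-unique tr ex pl j₀
    result = schedule I (reverse es) unique
    feasible = placed-feasible tr ex pl j₀
    out : Parsed → List Token
    out ((ws , sets) , rows) = print (map (λ e → machineOf e , setOf e) (reverse (G.events ((ws , jobs sets rows) , 3) (jobs sets rows) ws))) (labels′ rows)
      where labels′ = GreedyProgram.labels
    printed : out ((weights I , masks I) , map (costRow I) (allFin m)) ≡ encodeSchedule result
    printed = trans (cong₂ print
        (trans (cong (map _ ∘ reverse) (trans (cong (λ J → G.events ((weights I , J) , 3) J (weights I)) jobs-code) (events-code (map code V.allJobs))))
          (trans (cong (map _) (sym (reverse-map code es))) (sym (map-∘ (reverse es)))))
        (labels-allFin (costRow I)))
      (print-correct I (reverse es) unique)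

  private
    firstRow-map : ∀ {m} (f : Fin m → List ℕ) (m≥1 : 1 ℕ.≤ m) → firstRow (map f (allFin m)) ≡ f (Fin.fromℕ< m≥1) ∷ []
    firstRow-map {suc m} f m≥1 = refl

    delay-map : ∀ {m} (f : Fin m → List ℕ) → 1 ℕ.≤ m → suc (delay (map f (allFin m))) ≡ 3 ℕ.* m
    delay-map {suc m} f m≥1 = trans (cong suc (go (map f (tabulate Fin.suc)) 2))
      (trans (cong (λ l → suc (3 ℕ.* l ℕ.+ 2)) (trans (length-map f (tabulate Fin.suc)) (length-tabulate {n = m} Fin.suc))) (arith m))
      where
      three : ∀ l t → 3 ℕ.* l ℕ.+ (3 ℕ.+ t) ≡ 3 ℕ.* suc l ℕ.+ t
      three = solve-∀
      go : ∀ {A : Set} (xs : List A) t → foldl (λ t _ → 3 ℕ.+ t) t xs ≡ 3 ℕ.* length xs ℕ.+ t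
      go []       t = refl
      go (x ∷ xs) t = trans (go xs (3 ℕ.+ t)) (three (length xs) t)
      arith : ∀ m → suc (3 ℕ.* m ℕ.+ 2) ≡ 3 ℕ.* suc m
      arith = solve-∀

  -- The factor 4 / (3 m) of list scheduling times the factor 9 m / 2 of the virtual machine is 6;
  -- both sides carry a common factor 6 m to stay in ℕ.
  identical-approximates : Approximates Identical 6 identical
  identical-approximates I same ε = result , feasible ,
    trans (cong out (parse-correct I ε)) printed , λ σ φ →
      ℕ.*-cancelˡ-≤ (6 ℕ.* m) {{ℕ.>-nonZero (ℕ.≤-trans m≥1 (ℕ.m≤m+n m _))}} (begin
        6 ℕ.* m ℕ.* cost I result feasible              ≡⟨ arith₁ m (cost I result feasible) ⟩
        2 ℕ.* (3 ℕ.* m ℕ.* cost I result feasible)      ≤⟨ ℕ.*-monoʳ-≤ 2 (placed-cost tr ex placing Fin.zero) ⟩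
        2 ℕ.* (4 ℕ.* V.total es)                   ≡⟨ arith₂ (V.total es) ⟩
        4 ℕ.* (2 ℕ.* V.total es)                   ≤⟨ ℕ.*-monoʳ-≤ 4 (identical-total I j₀ same a a≡ tr ex σ φ) ⟩
        4 ℕ.* (9 ℕ.* m ℕ.* cost I σ φ)             ≡⟨ arith₃ m (cost I σ φ) ⟩
        6 ℕ.* m ℕ.* (6 ℕ.* cost I σ φ)             ∎)
    where
    open ℕ.≤-Reasoning
    open Instance I
    j₀ : Fin m
    j₀ = Fin.fromℕ< m≥1
    a = delay (map (costRow I) (allFin m))
    a≡ : suc a ≡ 3 ℕ.* m
    a≡ = delay-map (costRow I) m≥1
    open Ident I j₀ same a a≡ using (placed-feasible; placed-cost; placed-unique)
    open Encoded I (c₁ I j₀ same a a≡) (λ S _ → c≥1 S j₀) a using (module V; code; events-code; jobs-code)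
    es = V.events V.allJobs (weights I)
    tr = proj₁ (V.events-trace (weights I) (length-weights I))
    ex = proj₂ (V.events-trace (weights I) (length-weights I))
    placed = place-correct I j₀ same a a≡ es
    pl = proj₁ placed
    placing = identical-placing I j₀ same a a≡ (proj₂ (proj₂ placed))
    unique = placed-unique tr ex placing Fin.zero
    result = schedule I (reverse pl) unique
    feasible = placed-feasible tr ex placing Fin.zero
    arith₁ : ∀ m x → 6 ℕ.* m ℕ.* x ≡ 2 ℕ.* (3 ℕ.* m ℕ.* x)
    arith₁ = solve-∀
    arith₂ : ∀ x → 2 ℕ.* (4 ℕ.* x) ≡ 4 ℕ.* (2 ℕ.* x)
    arith₂ = solve-∀
    arith₃ : ∀ m x → 4 ℕ.* (9 ℕ.* m ℕ.* x) ≡ 6 ℕ.* m ℕ.* (6 ℕ.* x)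
    arith₃ = solve-∀
    out : Parsed → List Token
    out ((ws , sets) , rows) = print (map (λ (i , (S , _)) → i , S) (reverse (place (labels′ rows)
      (G.events ((ws , jobs sets (firstRow rows)) , delay rows) (jobs sets (firstRow rows)) ws)))) (labels′ rows)
      where labels′ = GreedyProgram.labels
    events≡ : G.events ((weights I , jobs (masks I) (firstRow (map (costRow I) (allFin m)))) , a)
                       (jobs (masks I) (firstRow (map (costRow I) (allFin m)))) (weights I) ≡ map code es
    events≡ = trans (cong (λ J → G.events ((weights I , J) , a) J (weights I))
      (trans (cong (jobs (masks I)) (firstRow-map (costRow I) m≥1)) jobs-code)) (events-code (map code V.allJobs))
    printed : out ((weights I , masks I) , map (costRow I) (allFin m)) ≡ encodeSchedule result
    printed = trans (cong₂ print
        (trans (cong (map _ ∘ reverse) (trans (cong₂ place (labels-allFin (costRow I)) events≡) (proj₁ (proj₂ placed))))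
          (trans (cong (map _) (sym (reverse-map (entry I j₀ same a a≡) pl))) (sym (map-∘ (reverse pl)))))
        (labels-allFin (costRow I)))
      (print-correct I (reverse pl) unique)

  identical-approximation : HasApproximation Identical (fromℚ (+ 4 / 1) *ℝ e/[e-1])
  identical-approximation = approximation 6 (fromℚ (+ 4 / 1) *ℝ e/[e-1]) identicalᵖ identical-approximates
    -- The lower bound 3 / 2 is just enough here: 4 times it is exactly 6.
    (scaled-lower (+ 4 / 1) 6 (toWitness {a? = fromℕ 6 ℚ.≤? (+ 4 / 1) * (+ 3 / 2)} _))

  unrelated-approximation : HasApproximation Unrelated (fromℚ (+ 8 / 1) *ℝ e/[e-1])
  unrelated-approximation = approximation 8 (fromℚ (+ 8 / 1) *ℝ e/[e-1]) unrelatedᵖ unrelated-approximates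
    (scaled-lower (+ 8 / 1) 8 (toWitness {a? = fromℕ 8 ℚ.≤? (+ 8 / 1) * (+ 3 / 2)} _))

  identical-constant : ∃[ ε ] Positive ε × fromℚ (+ 4 / 1) *ℝ e/[e-1] +ℝ fromℚ ε <ℝ fromℚ (+ 633 / 100)
  identical-constant = scaled-upper (+ 4 / 1) (+ 633 / 100) (toWitness {a? = _ ℚ.≤? _} _)

  unrelated-constant : ∃[ ε ] Positive ε × fromℚ (+ 8 / 1) *ℝ e/[e-1] +ℝ fromℚ ε <ℝ fromℚ (+ 1266 / 100)
  unrelated-constant = scaled-upper (+ 8 / 1) (+ 1266 / 100) (toWitness {a? = _ ℚ.≤? _} _)

open import Defs
open import Data.Integer using (+_)
open import Data.Product using (_×_; ∃-syntax; _,_)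
open import Data.Rational using (_/_; Positive)
open Assembly using (identical-approximation; identical-constant; unrelated-approximation; unrelated-constant)

corollary3p4 : ( HasApproximation Identical (fromℚ (+ 4 / 1) *ℝ e/[e-1])
    × ∃[ ε ] Positive ε × fromℚ (+ 4 / 1) *ℝ e/[e-1] +ℝ fromℚ ε <ℝ fromℚ (+ 633 / 100) )
    ×
    ( HasApproximation Unrelated (fromℚ (+ 8 / 1) *ℝ e/[e-1])
    × ∃[ ε ] Positive ε × fromℚ (+ 8 / 1) *ℝ e/[e-1] +ℝ fromℚ ε <ℝ fromℚ (+ 1266 / 100) )
corollary3p4 = (identical-approximation , identical-constant) , (unrelated-approximation , unrelated-constant)
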